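{- There is an absolute constant $C$ such that for every integer $k\geq 2$ there exist two non-isomorphic graphs, each of twin-width at most $4$ and with at most $C\,k\log k$ vertices, which are not distinguished by the $k$-dimensional Weisfeiler-Leman algorithm. (That is: for all $k$ there are such pairs of size $O(k\log k)$.)
   Context: All graphs are finite and simple. Trigraphs are graphs whose edges are colored red or black; a graph is a trigraph with only black edges. For a partition $\mathcal P$ of $V(G)$, the quotient trigraph $G/\mathcal P$ has vertex set $\mathcal P$; two parts $U,W$ are joined by a black edge if every vertex of $U$ is adjacent to every vertex of $W$, are non-adjacent if no vertex of $U$ is adjacent to a vertex of $W$, and are joined by a red edge otherwise. A partition sequence of an $n$-vertex graph $G$ is a sequence $\mathcal P_n,\dots,\mathcal P_1$ of partitions of $V(G)$ where $\mathcal P_n$ is the partition into singletons and each $\mathcal P_i$ arises from $\mathcal P_{i+1}$ by merging two parts; its width is the maximum number of red edges at a vertex over all $G/\mathcal P_i$. The twin-width of $G$ is the minimum width of a partition sequence. The $k$-dimensional Weisfeiler-Leman algorithm ($k$-WL) iteratively refines the coloring of $V(G)^k$ by atomic types via $\chi^{i+1}(\vec v)=(\chi^i(\vec v),\{\!\{(\mathrm{atp}(\vec v w),\chi^i(\vec v[w/1]),\dots,\chi^i(\vec v[w/k])):w\in V(G)\}\!\})$ until stable; it distinguishes $G$ and $H$ if some stable color occurs a different number of times on $V(G)^k$ and $V(H)^k$. -}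

module Defs where

open import Data.Nat using (ℕ; zero; suc; _≤_; _<_)
open import Data.Bool using (Bool; true; false)
import Data.Bool.Properties as BoolP
open import Data.Fin using (Fin)
open import Data.Fin.Properties using (any?; _≟_)
open import Data.Vec using (Vec; lookup; _∷ʳ_; _[_]≔_)
open import Data.List using (length; filter)
open import Data.Product using (Σ; ∃; ∃-syntax; _×_; _,_)
open import Data.Sum using (_⊎_)
open import Function.Bundles using (_⤖_; Bijection; _⇔_)
open import Function.Definitions using (Injective; Surjective)
open import Relation.Binary.PropositionalEquality using (_≡_; _≢_)
open import Relation.Nullary using (¬_; Dec; ¬?)
open import Relation.Nullary.Decidable using (_×-dec_)
import Data.List as L

record Graph : Set where
  field
    n      : ℕ
    adj    : Fin n → Fin n → Bool
    sym    : ∀ u v → adj u v ≡ adj v u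
    irrefl : ∀ v → adj v v ≡ false

open Graph public

V : Graph → Set
V G = Fin (n G)

Isomorphic : Graph → Graph → Set
Isomorphic G H =
  Σ (V G ⤖ V H) λ f → ∀ u v → adj G u v ≡ adj H (Bijection.to f u) (Bijection.to f v)

-- Twin-width
--
-- A partition of V(G) into p parts is represented by a surjective
-- labelling  Fin (n G) → Fin p  (vertices with the same label form a part).

module _ (G : Graph) where

  Red : ∀ {p} → (V G → Fin p) → Fin p → Fin p → Set
  Red lab U W =
    U ≢ W
    × (∃[ u ] ∃[ w ] (lab u ≡ U × lab w ≡ W × adj G u w ≡ true))
    × (∃[ u ] ∃[ w ] (lab u ≡ U × lab w ≡ W × adj G u w ≡ false))

  red? : ∀ {p} (lab : V G → Fin p) (U W : Fin p) → Dec (Red lab U W)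
  red? lab U W =
    ¬? (U ≟ W)
    ×-dec any? (λ u → any? (λ w → (lab u ≟ U) ×-dec ((lab w ≟ W) ×-dec (adj G u w BoolP.≟ true))))
    ×-dec any? (λ u → any? (λ w → (lab u ≟ U) ×-dec ((lab w ≟ W) ×-dec (adj G u w BoolP.≟ false))))

  redDeg : ∀ {p} → (V G → Fin p) → Fin p → ℕ
  redDeg lab U = length (filter (red? lab U) (L.allFin _))

  MergeOf : ∀ {p} → (V G → Fin (suc p)) → (V G → Fin p) → Set
  MergeOf {p} lab lab′ =
    Σ (Fin (suc p)) λ a → Σ (Fin (suc p)) λ b → a ≢ b ×
      (∀ x y → (lab′ x ≡ lab′ y) ⇔
                 (lab x ≡ lab y ⊎ (lab x ≡ a × lab y ≡ b) ⊎ (lab x ≡ b × lab y ≡ a)))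

  -- A partition sequence P_n, …, P_1 : seq i is the partition with (suc i)
  -- parts, for i < n G.
  record PartitionSequence : Set where
    field
      seq        : (i : ℕ) → V G → Fin (suc i)
      surjective : ∀ i → i < n G → Surjective _≡_ _≡_ (seq i)
      singletons : ∀ i → suc i ≡ n G → Injective _≡_ _≡_ (seq i)
      merge      : ∀ i → suc i < n G → MergeOf (seq (suc i)) (seq i)

  open PartitionSequence public

  WidthAtMost : PartitionSequence → ℕ → Set
  WidthAtMost S d = ∀ i → i < n G → ∀ (U : Fin (suc i)) → redDeg (seq S i) U ≤ d

  TwinWidthAtMost : ℕ → Set
  TwinWidthAtMost d = Σ PartitionSequence λ S → WidthAtMost S d

-- k-dimensional Weisfeiler–Leman
--
-- Tuples are vectors.  Colours of tuples in G and H are compared via the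
-- relation  WLEq G H i v u  meaning  χ^i_G(v) = χ^i_H(u).

SameAtp : (G H : Graph) {m : ℕ} → Vec (V G) m → Vec (V H) m → Set
SameAtp G H v u = ∀ a b →
  ((lookup v a ≡ lookup v b) ⇔ (lookup u a ≡ lookup u b))
  × adj G (lookup v a) (lookup v b) ≡ adj H (lookup u a) (lookup u b)

-- χ^i(v) = χ^i(u); equality of multisets in the refinement step is
-- expressed by a bijection σ : V(G) → V(H) matching the entries.
WLEq : (G H : Graph) (k : ℕ) → ℕ → Vec (V G) k → Vec (V H) k → Set
WLEq G H k zero    v u = SameAtp G H v u
WLEq G H k (suc i) v u =
  WLEq G H k i v u ×
  Σ (V G ⤖ V H) λ σ → ∀ w →
    SameAtp G H (v ∷ʳ w) (u ∷ʳ Bijection.to σ w)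
    × (∀ j → WLEq G H k i (v [ j ]≔ w) (u [ j ]≔ Bijection.to σ w))

-- k-WL does not distinguish G and H: for every round i, every colour occurs
-- equally often on V(G)^k and V(H)^k (witnessed by a colour-preserving
-- bijection V(G)^k → V(H)^k).
NotDistinguishedByWL : ℕ → Graph → Graph → Set
NotDistinguishedByWL k G H =
  ∀ i → Σ (Vec (V G) k ⤖ Vec (V H) k) λ π → ∀ v → WLEq G H k i v (Bijection.to π v)

{-# OPTIONS --safe #-}
module Submission where

-- The pair consists of the Cai–Fürer–Immerman graphs, untwisted and twisted at one node, of
-- a cubic graph with O(k) nodes whose edges are subdivided into O(log k) vertices.
--
-- The cubic graph has linear tree-width: it is built from 4q blocks of bounded size, joined
-- by boundedly many permutations such that any two sets of q blocks are linked; these exist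
-- by counting. Removing suc k ≤ q nodes therefore leaves a component with at least q live
-- blocks, and the duplicator in the bijective pebble game keeps the twist inside it.
--
-- An isomorphism would map the all-zero section of the untwisted graph to a solution of the
-- twisted parity system, which has none since every edge is counted at both of its ends.
--
-- For the twin-width, the gadgets are first contracted to obtain the subdivided cubic graph.
-- Its nodes are regarded as leaves of a binary tree of depth L, and each path, having 2L
-- vertices, is folded onto the tree: up from one end to the root and down to the other. A
-- tree node has three neighbours in the tree, and at most one more on the path being folded.
-- Finally the tree is contracted level by level.

open import Defs
open import Algebra.Bundles using (CommutativeMonoid; CommutativeRing)
open import Data.Bool using (Bool; true; false; not; if_then_else_; _∨_; _xor_)
open import Data.Bool.Properties as BoolP using (xor-assoc; xor-comm; xor-same; xor-identityʳ)
open import Data.Empty using (⊥; ⊥-elim)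
open import Data.Fin as Fin
  using (Fin; zero; suc; toℕ; fromℕ; fromℕ<; inject₁; punchIn; punchOut; combine; remQuot)
open import Data.Fin.Induction using (<-weakInduction)
open import Data.Fin.Permutation as Perm using (Permutation′; _⟨$⟩ʳ_; _⟨$⟩ˡ_; insert; insert-punchIn)
open import Data.Fin.Properties as FinP using (any?)
open import Data.List as List using (List; []; _∷_; _++_; length; map; filter; allFin; cartesianProduct)
open import Data.List.Membership.Propositional using (_∈_; _∉_)
open import Data.List.Membership.Propositional.Properties
  using (∈-++⁺ˡ; ∈-++⁺ʳ; ∈-map⁺; ∈-filter⁺; ∈-filter⁻; ∈-lookup; ∈-tabulate⁺; ∈-cartesianProduct⁺; ∈-cartesianProduct⁻)
open import Data.List.Properties using (length-filter; length-map; length-++)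
open import Data.List.Relation.Unary.All as All using (All; []; _∷_)
import Data.List.Relation.Unary.All.Properties as AllP
open import Data.List.Relation.Unary.AllPairs using (_∷_)
open import Data.List.Relation.Unary.Any as Any using (here; there)
import Data.List.Relation.Unary.Any.Properties as AnyP
open import Data.List.Relation.Unary.Unique.Propositional using (Unique)
import Data.List.Relation.Unary.Unique.Propositional.Properties as UniqueP
open import Data.Nat
open import Data.Nat.Induction using (<-rec)
open import Data.Nat.Logarithm using (⌈log₂_⌉; ⌈log₂⌉-mono-≤; ⌈log₂2^n⌉≡n; ⌈log₂⌈n/2⌉⌉≡⌈log₂n⌉∸1)
open import Data.Nat.Properties
open import Data.Nat.Tactic.RingSolver using (solve-∀)
open import Data.Product using (Σ; ∃; ∃-syntax; _×_; _,_; proj₁; proj₂)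
open import Data.Product.Function.NonDependent.Propositional using (_×-↔_)
import Data.Product.Properties as ProdP
open import Data.Sum as Sum using (_⊎_; inj₁; inj₂)
open import Data.Sum.Function.Propositional using (_⊎-↔_)
import Data.Sum.Properties as SumP
open import Data.Unit using (⊤; tt)
open import Data.Vec as Vec using (Vec; []; _∷_; lookup; _∷ʳ_; _[_]≔_; toList)
import Data.Vec.Properties as VecP
open import Function using (_∘_; _↔_; _⇔_; mk↔ₛ′; mk⇔; Inverse; Equivalence)
open import Function.Bundles using (_⤖_; Bijection)
open import Function.Construct.Composition using (_↔-∘_)
open import Function.Construct.Identity using (↔-id)
open import Function.Construct.Symmetry using (↔-sym)
open import Function.Properties.Bijection using (⤖⇒↔)
open import Function.Properties.Inverse using (↔⇒⤖)
open import Relation.Binary using (DecidableEquality; tri<; tri≈; tri>)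
open import Relation.Binary.PropositionalEquality renaming (sym to ≡-sym) hiding ([_])
open import Relation.Nullary
open import Relation.Nullary.Decidable using (_×-dec_; _⊎-dec_; dec-true; dec-false; does-⇔; map′; toWitness)
open import Algebra.Properties.CommutativeMonoid.Sum
  (CommutativeRing.+-commutativeMonoid BoolP.xor-∧-commutativeRing)
  using () renaming (sum to ⊕; sum-cong-≗ to ⊕-cong; sum-permute to ⊕-permute; ∑-distrib-+ to ⊕-xor)
open import Algebra.Properties.CommutativeSemigroup
  (CommutativeMonoid.commutativeSemigroup (CommutativeRing.+-commutativeMonoid BoolP.xor-∧-commutativeRing))
  using (interchange)
open import Algebra.Properties.Semiring.Sum +-*-semiring
  using (sum; sum-cong-≗; ∑-distrib-+; *-distribʳ-sum; sum-remove)

-- Counting permutations that avoid hitting one set from another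

-- Two demands pull against each other. Expansion is obtained from many permutations at once,
-- whereas width 4 wants degree three: a merged gadget sees both copies of the path at one port and
-- one collapsed pair at each other port, which makes four only for three ports. Hence every
-- permutation gets a node pair of its own in each block, and a block is a cycle through these
-- pairs; this costs a constant factor.
--
-- The base graph is given by three permutations between two sides. It is then cubic by
-- construction, and the parity argument reduces to comparing the two sides.
--
-- The logarithm in the size is the depth of a binary tree with one leaf per node: a path has to be
-- long enough to climb to the root and to descend again, whichever nodes it joins.
--
-- Two points need care. The duplicator must answer with bijections, so the answers are chosen to be
-- involutions. And an isomorphism need not respect gadgets or paths, so these have to be recognised
-- from adjacency alone.

FSet : ℕ → Set
FSet n = Fin n → Bool

[_] : Bool → ℕ
[ b ] = if b then 1 else 0

card : ∀ {n} → FSet n → ℕ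
card A = sum (λ x → [ A x ])

sum-mono : ∀ {n} {f g : Fin n → ℕ} → (∀ i → f i ≤ g i) → sum f ≤ sum g
sum-mono {zero}  h = z≤n
sum-mono {suc n} h = +-mono-≤ (h zero) (sum-mono (h ∘ suc))

card-∁ : ∀ {n} (A : FSet n) → card A + card (not ∘ A) ≡ n
card-∁ {zero}  A = refl
card-∁ {suc n} A with A zero
... | true  = cong suc (card-∁ (A ∘ suc))
... | false = trans (+-suc _ _) (cong suc (card-∁ (A ∘ suc)))

card-punchIn : ∀ {n} (B : FSet (suc n)) i → card B ≡ [ B i ] + card (B ∘ punchIn i)
card-punchIn B i = sum-remove {i = i} ([_] ∘ B)

-- The falling factorial, which counts the injections of an `a`-element set into an `m`-element set.
fall : ℕ → ℕ → ℕ
fall m       zero    = 1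
fall zero    (suc a) = 0
fall (suc m) (suc a) = suc m * fall m a

fall-suc : ∀ m a → fall m (suc a) ≡ m * fall (m ∸ 1) a
fall-suc zero    a = refl
fall-suc (suc m) a = refl

-- A product of `suc a` descending factors, split once at its first and once at its last factor.
-- With truncated subtraction both sides vanish when `m ≤ a`.
*-fall-pred : ∀ m a → m * fall (m ∸ 1) a ≡ fall m a * (m ∸ a)
*-fall-pred zero    a = ≡-sym (trans (cong (fall 0 a *_) (0∸n≡0 a)) (*-zeroʳ (fall 0 a)))
*-fall-pred (suc m) zero = trans (*-identityʳ _) (≡-sym (+-identityʳ _))
*-fall-pred (suc m) (suc a) = begin
  suc m * fall m (suc a)           ≡⟨ cong (suc m *_) (fall-suc m a) ⟩
  suc m * (m * fall (m ∸ 1) a)     ≡⟨ cong (suc m *_) (*-fall-pred m a) ⟩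
  suc m * (fall m a * (m ∸ a))     ≡⟨ ≡-sym (*-assoc (suc m) (fall m a) (m ∸ a)) ⟩
  suc m * fall m a * (m ∸ a)       ∎
  where open ≡-Reasoning

fall-< : ∀ {m a} → m < a → fall m a ≡ 0
fall-< {zero}  {suc a} _       = refl
fall-< {suc m} {suc a} (s≤s p) = trans (cong (suc m *_) (fall-< p)) (*-zeroʳ (suc m))

fall-! : ∀ a b → fall (a + b) a * b ! ≡ (a + b) !
fall-! zero    b = +-identityʳ _
fall-! (suc a) b = trans (*-assoc (suc (a + b)) (fall (a + b) a) (b !)) (cong (suc (a + b) *_) (fall-! a b))

-- Factor by factor: lowering `x` and `y` by one takes `q` from the left of `q * x ≤ p * y` and only
-- `p` from its right, so every quotient of factors stays at most p/q.
fall-ratio : ∀ p q x y a → q * x ≤ p * y → p ≤ q → q ^ a * fall x a ≤ p ^ a * fall y a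
fall-ratio p q x y zero h pq = ≤-refl
fall-ratio p q zero y (suc a) h pq = ≤-trans (≤-reflexive (*-zeroʳ (q ^ suc a))) z≤n
fall-ratio p q (suc x) zero (suc a) h pq =
  ≤-trans (≤-reflexive (trans (rearr q (q ^ a) (suc x) (fall x a)) (cong (_* (q ^ a * fall x a)) q0))) z≤n
  where
  q0 : q * suc x ≡ 0
  q0 = n≤0⇒n≡0 (≤-trans h (≤-reflexive (*-zeroʳ p)))
  rearr : ∀ q r x f → q * r * (x * f) ≡ q * x * (r * f)
  rearr = solve-∀
fall-ratio p q (suc x) (suc y) (suc a) h pq = begin
  q * q ^ a * (suc x * fall x a)   ≡⟨ rearr q (q ^ a) (suc x) (fall x a) ⟩
  q * suc x * (q ^ a * fall x a)   ≤⟨ *-mono-≤ h (fall-ratio p q x y a h′ pq) ⟩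
  p * suc y * (p ^ a * fall y a)   ≡⟨ rearr p (p ^ a) (suc y) (fall y a) ⟨
  p * p ^ a * (suc y * fall y a)   ∎
  where
  open ≤-Reasoning
  rearr : ∀ q r x f → q * r * (x * f) ≡ q * x * (r * f)
  rearr = solve-∀
  h′ : q * x ≤ p * y
  h′ = +-cancelˡ-≤ q _ _ (≤-trans (≤-reflexive (≡-sym (*-suc q x)))
         (≤-trans h (≤-trans (≤-reflexive (*-suc p y)) (+-monoˡ-≤ (p * y) pq))))

Hit : ∀ {n} → FSet n → FSet n → Permutation′ n → Set
Hit A B π = ∃ λ x → A x ≡ true × B (π ⟨$⟩ʳ x) ≡ true

hit? : ∀ {n} (A B : FSet n) π → Dec (Hit A B π)
hit? A B π = any? λ x → (A x BoolP.≟ true) ×-dec (B (π ⟨$⟩ʳ x) BoolP.≟ true)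

miss : ∀ {n} → FSet n → FSet n → Permutation′ n → ℕ
miss A B π = [ not (does (hit? A B π)) ]

miss≤1 : ∀ {n} (A B : FSet n) π → miss A B π ≤ 1
miss≤1 A B π with does (hit? A B π)
... | true  = z≤n
... | false = ≤-refl

-- Enumerates the n! permutations by the image of `zero` and a permutation of the rest, which lets
-- counting arguments go by induction on `n`.
sumP : ∀ n → (Permutation′ n → ℕ) → ℕ
sumP zero    g = g Perm.id
sumP (suc n) g = sum λ i → sumP n λ π → g (insert zero i π)

sumP-mono : ∀ n {g h : Permutation′ n → ℕ} → (∀ π → g π ≤ h π) → sumP n g ≤ sumP n h
sumP-mono zero    p = p Perm.id
sumP-mono (suc n) p = sum-mono λ i → sumP-mono n λ π → p (insert zero i π)

sumP-+ : ∀ n g h → sumP n (λ π → g π + h π) ≡ sumP n g + sumP n h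
sumP-+ zero    g h = refl
sumP-+ (suc n) g h = trans
  (sum-cong-≗ {n = suc n} λ i → sumP-+ n (λ π → g (insert zero i π)) (λ π → h (insert zero i π)))
  (∑-distrib-+ {n = suc n} (λ i → sumP n λ π → g (insert zero i π)) (λ i → sumP n λ π → h (insert zero i π)))

sum-zero : ∀ {n} → sum {n} (λ _ → 0) ≡ 0
sum-zero {zero}  = refl
sum-zero {suc n} = sum-zero {n}

sumP-zero : ∀ n → sumP n (λ _ → 0) ≡ 0
sumP-zero zero    = refl
sumP-zero (suc n) = trans (sum-cong-≗ {n = suc n} λ i → sumP-zero n) (sum-zero {suc n})

miss-hit : ∀ {n} (A B : FSet n) π → Hit A B π → miss A B π ≡ 0
miss-hit A B π h = cong (λ b → [ not b ]) (dec-true (hit? A B π) h)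

miss-anti : ∀ {m n} {A B : FSet m} {A′ B′ : FSet n} {π π′} →
  (Hit A′ B′ π′ → Hit A B π) → miss A B π ≤ miss A′ B′ π′
miss-anti {A = A} {B} {A′} {B′} {π} {π′} f with hit? A′ B′ π′
... | no  _ = miss≤1 A B π
... | yes h = ≤-reflexive (miss-hit A B π (f h))

miss-insert : ∀ {n} (A B : FSet (suc n)) i π →
  miss A B (insert zero i π) ≤ miss (A ∘ suc) (B ∘ punchIn i) π
miss-insert A B i π = miss-anti {A = A} {B} {A ∘ suc} {B ∘ punchIn i} {insert zero i π} {π} λ (x , a , b) →
  suc x , a , trans (cong B (insert-punchIn zero i π x)) b

-- A permutation without a hit sends `A` injectively into the complement of `B` and the other points
-- arbitrarily onto what is left. The induction fixes the image of `zero`; whether `zero` lies in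
-- `A` decides which of the two factors is consumed.
miss-count : ∀ n (A B : FSet n) →
  sumP n (miss A B) ≤ fall (card (not ∘ B)) (card A) * card (not ∘ A) !
miss-count zero A B = miss≤1 A B Perm.id
miss-count (suc n) A B = by-cases (A zero) refl
  where
  A′ = A ∘ suc
  α = card A′
  δ = card (not ∘ A′)
  m = card (not ∘ B)
  S : Fin (suc n) → ℕ
  S i = sumP n λ π → miss A B (insert zero i π)
  m∖ : ∀ i → B i ≡ false → card (not ∘ B ∘ punchIn i) ≡ m ∸ 1
  m∖ i e = ≡-sym (trans (cong (_∸ 1) (card-punchIn (not ∘ B) i))
                      (cong (λ b → [ not b ] + card (not ∘ B ∘ punchIn i) ∸ 1) e))
  m∖′ : ∀ i → B i ≡ true → card (not ∘ B ∘ punchIn i) ≡ m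
  m∖′ i e = ≡-sym (trans (card-punchIn (not ∘ B) i) (cong (λ b → [ not b ] + card (not ∘ B ∘ punchIn i)) e))
  IH : ∀ i → S i ≤ fall (card (not ∘ B ∘ punchIn i)) α * δ !
  IH i = ≤-trans (sumP-mono n (miss-insert A B i)) (miss-count n A′ (B ∘ punchIn i))
  out : ∀ i → B i ≡ false → S i ≤ fall (m ∸ 1) α * δ !
  out i e = ≤-trans (IH i) (≤-reflexive (cong (λ z → fall z α * δ !) (m∖ i e)))
  inn : ∀ i → B i ≡ true → S i ≤ fall m α * δ !
  inn i e = ≤-trans (IH i) (≤-reflexive (cong (λ z → fall z α * δ !) (m∖′ i e)))
  open ≤-Reasoning
  Goal : Bool → Set
  Goal b = sum S ≤ fall m ([ b ] + α) * ([ not b ] + δ) !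
  by-cases : ∀ b → A zero ≡ b → sum S ≤ fall m ([ A zero ] + α) * ([ not (A zero) ] + δ) !
  by-cases true e = subst Goal (≡-sym e) (begin
    sum S                                              ≤⟨ sum-mono (λ i → bound′ i (B i) refl) ⟩
    sum (λ i → [ not (B i) ] * (fall (m ∸ 1) α * δ !)) ≡⟨ *-distribʳ-sum (fall (m ∸ 1) α * δ !) (λ i → [ not (B i) ]) ⟨
    m * (fall (m ∸ 1) α * δ !)                         ≡⟨ *-assoc m _ _ ⟨
    m * fall (m ∸ 1) α * δ !                           ≡⟨ cong (_* δ !) (fall-suc m α) ⟨
    fall m (suc α) * δ !                               ∎)
    where
    bound′ : ∀ i b → B i ≡ b → S i ≤ [ not b ] * (fall (m ∸ 1) α * δ !)
    bound′ i false eq = ≤-trans (out i eq) (≤-reflexive (≡-sym (+-identityʳ _)))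
    bound′ i true  eq = ≤-trans (sumP-mono n {h = λ _ → 0}
                     λ π → ≤-reflexive (miss-hit A B (insert zero i π) (zero , e , eq)))
                     (≤-reflexive (sumP-zero n))
  by-cases false e = subst Goal (≡-sym e) (begin
    sum S                                              ≤⟨ sum-mono (λ i → bound′ i (B i) refl) ⟩
    sum (λ i → [ B i ] * x + [ not (B i) ] * y)        ≡⟨ ∑-distrib-+ (λ i → [ B i ] * x) (λ i → [ not (B i) ] * y) ⟩
    sum (λ i → [ B i ] * x) + sum (λ i → [ not (B i) ] * y)
      ≡⟨ cong₂ _+_ (*-distribʳ-sum x (λ i → [ B i ])) (*-distribʳ-sum y (λ i → [ not (B i) ])) ⟨
    card B * x + m * y                                 ≡⟨ cong (card B * x +_) (≡-sym (*-assoc m _ _)) ⟩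
    card B * x + m * fall (m ∸ 1) α * δ !              ≡⟨ cong (λ z → card B * x + z * δ !) (*-fall-pred m α) ⟩
    card B * x + fall m α * (m ∸ α) * δ !              ≡⟨ rearr (card B) (fall m α) (m ∸ α) (δ !) ⟩
    fall m α * (card B + (m ∸ α)) * δ !                ≤⟨ *-monoˡ-≤ (δ !) final ⟩
    fall m α * suc δ * δ !                             ≡⟨ *-assoc (fall m α) (suc δ) (δ !) ⟩
    fall m α * (suc δ) !                               ∎)
    where
    x = fall m α * δ !
    y = fall (m ∸ 1) α * δ !
    rearr : ∀ b f c d → b * (f * d) + f * c * d ≡ f * (b + c) * d
    rearr = solve-∀
    bound′ : ∀ i b → B i ≡ b → S i ≤ [ b ] * x + [ not b ] * y
    bound′ i false eq = ≤-trans (out i eq) (≤-reflexive (≡-sym (+-identityʳ _)))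
    bound′ i true  eq = ≤-trans (inn i eq) (≤-reflexive (≡-sym (trans (+-identityʳ _) (+-identityʳ _))))
    -- For `α ≤ m` the second factors agree, by counting all points once along `B` and once along
    -- `A`. For `m < α` there is no injection and `fall m α` is zero.
    final : fall m α * (card B + (m ∸ α)) ≤ fall m α * suc δ
    final with <-≤-connex m α
    ... | inj₁ m<α = ≤-reflexive (trans (cong (_* (card B + (m ∸ α))) (fall-< m<α)) (cong (_* suc δ) (≡-sym (fall-< m<α))))
    ... | inj₂ α≤m = *-monoʳ-≤ (fall m α) (≤-reflexive (+-cancelˡ-≡ α _ _ (≡.begin
      α + (card B + (m ∸ α))  ≡.≡⟨ cong (α +_) (+-comm (card B) _) ⟩
      α + ((m ∸ α) + card B)  ≡.≡⟨ +-assoc α _ _ ⟨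
      α + (m ∸ α) + card B    ≡.≡⟨ cong (_+ card B) (m+[n∸m]≡n α≤m) ⟩
      m + card B              ≡.≡⟨ +-comm m _ ⟩
      card B + m              ≡.≡⟨ card-∁ B ⟩
      suc n                   ≡.≡⟨ cong suc (card-∁ A′) ⟨
      suc (α + δ)             ≡.≡⟨ +-suc α δ ⟨
      α + suc δ               ≡.∎)))
      where module ≡ = ≡-Reasoning

^-distribʳ-* : ∀ n a b → (a * b) ^ n ≡ a ^ n * b ^ n
^-distribʳ-* zero    a b = refl
^-distribʳ-* (suc n) a b = trans (cong (a * b *_) (^-distribʳ-* n a b)) (swap a b (a ^ n) (b ^ n))
  where
  swap : ∀ a b c d → a * b * (c * d) ≡ a * c * (b * d)
  swap = solve-∀

argmin : ∀ n (f : Fin (suc n) → ℕ) → ∃ λ i → suc n * f i ≤ sum f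
argmin zero    f = zero , ≤-refl
argmin (suc n) f with argmin n (f ∘ suc)
... | j , p with ≤-total (f zero) (f (suc j))
...   | inj₁ q = zero , +-monoʳ-≤ (f zero) (≤-trans (*-monoʳ-≤ (suc n) q) p)
...   | inj₂ q = suc j , +-mono-≤ q p

-- The least value is at most the mean; a permutation below the mean is found by fixing one image at
-- a time.
averaging : ∀ n (g : Permutation′ n → ℕ) → ∃ λ π → n ! * g π ≤ sumP n g
averaging zero    g = Perm.id , ≤-reflexive (+-identityʳ _)
averaging (suc n) g with argmin n (λ i → sumP n λ π → g (insert zero i π))
... | i , p with averaging n (λ π → g (insert zero i π))
...   | π , q = insert zero i π ,
        ≤-trans (≤-reflexive (*-assoc (suc n) (n !) _)) (≤-trans (*-monoʳ-≤ (suc n) q) p)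

-- Greedy choice of the permutations

length-cartesianProduct : ∀ {A B : Set} (xs : List A) (ys : List B) →
  length (cartesianProduct xs ys) ≡ length xs * length ys
length-cartesianProduct []       ys = refl
length-cartesianProduct (x ∷ xs) ys = trans (length-++ (map (x ,_) ys))
  (cong₂ _+_ (length-map (x ,_) ys) (length-cartesianProduct xs ys))

Pair : ℕ → Set
Pair n = FSet n × FSet n

Hit₂ : ∀ {n} → Permutation′ n → Pair n → Set
Hit₂ π (A , B) = Hit A B π

survivors : ∀ {n} → Permutation′ n → List (Pair n) → List (Pair n)
survivors π = filter λ (A , B) → ¬? (hit? A B π)

length-survivors : ∀ {n} (A B : FSet n) I π →
  length (survivors π ((A , B) ∷ I)) ≡ miss A B π + length (survivors π I)
length-survivors A B I π with does (hit? A B π)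
... | true  = refl
... | false = refl

sumP-survivors : ∀ n K (I : List (Pair n)) → All (λ (A , B) → sumP n (miss A B) ≤ K) I →
  sumP n (λ π → length (survivors π I)) ≤ length I * K
sumP-survivors n K [] [] = ≤-reflexive (sumP-zero n)
sumP-survivors n K ((A , B) ∷ I) (p ∷ ps) = begin
  sumP n (λ π → length (survivors π ((A , B) ∷ I)))
    ≤⟨ sumP-mono n (λ π → ≤-reflexive (length-survivors A B I π)) ⟩
  sumP n (λ π → miss A B π + length (survivors π I))
    ≡⟨ sumP-+ n (miss A B) (λ π → length (survivors π I)) ⟩
  sumP n (miss A B) + sumP n (λ π → length (survivors π I))
    ≤⟨ +-mono-≤ p (sumP-survivors n K I ps) ⟩
  K + length I * K ∎
  where open ≤-Reasoning

module _ (q : ℕ) where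

  -- A sum, so that the complement of `q` points has size `3 * q` by cancellation. In the
  -- exploration below the four quarters cover the dead, the done, the current and the fresh blocks.
  ground : ℕ
  ground = q + 3 * q

  Sized : Pair ground → Set
  Sized (A , B) = card A ≡ q × card B ≡ q

  missing-bound : ∀ p → Sized p → sumP ground (miss (proj₁ p) (proj₂ p)) ≤ fall (3 * q) q * (3 * q) !
  missing-bound (A , B) (a , b) = ≤-trans (miss-count ground A B)
    (≤-reflexive (cong₂ _*_ (cong₂ fall (∁-size B b) a) (cong _! (∁-size A a))))
    where
    ∁-size : ∀ (C : FSet ground) → card C ≡ q → card (not ∘ C) ≡ 3 * q
    ∁-size C c = +-cancelˡ-≡ q _ _ (trans (cong (_+ card (not ∘ C)) (≡-sym c)) (card-∁ C))

  -- Relative to all permutations, the bound of `miss-count` is the quotient of two falling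
  -- factorials that start at 3q and at 4q, hence at most (3/4)^q.
  missing-ratio : 4 ^ q * (fall (3 * q) q * (3 * q) !) ≤ 3 ^ q * ground !
  missing-ratio = begin
    4 ^ q * (fall (3 * q) q * (3 * q) !)  ≡⟨ *-assoc (4 ^ q) (fall (3 * q) q) ((3 * q) !) ⟨
    4 ^ q * fall (3 * q) q * (3 * q) !    ≤⟨ *-monoˡ-≤ ((3 * q) !) (fall-ratio 3 4 (3 * q) ground q (≤-reflexive (eq q)) (n≤1+n 3)) ⟩
    3 ^ q * fall ground q * (3 * q) !          ≡⟨ *-assoc (3 ^ q) (fall ground q) ((3 * q) !) ⟩
    3 ^ q * (fall ground q * (3 * q) !)        ≡⟨ cong (3 ^ q *_) (fall-! q (3 * q)) ⟩
    3 ^ q * ground !                           ∎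
    where
    open ≤-Reasoning
    eq : ∀ q → 4 * (3 * q) ≡ 3 * (q + 3 * q)
    eq = solve-∀

  thin-out : ∀ I → All Sized I → ∃ λ π → 4 ^ q * length (survivors π I) ≤ 3 ^ q * length I
  thin-out I sized with averaging ground (λ π → length (survivors π I))
  ... | π , p = π , *-cancelˡ-≤ (ground !) {{ground !≢0}} (begin
    ground ! * (4 ^ q * s)      ≡⟨ swap (ground !) (4 ^ q) s ⟩
    4 ^ q * (ground ! * s)      ≤⟨ *-monoʳ-≤ (4 ^ q) (≤-trans p (sumP-survivors ground K I (All.map (λ {p} → missing-bound p) sized))) ⟩
    4 ^ q * (length I * K) ≡⟨ swap (4 ^ q) (length I) K ⟩
    length I * (4 ^ q * K) ≤⟨ *-monoʳ-≤ (length I) missing-ratio ⟩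
    length I * (3 ^ q * ground !) ≡⟨ rot (length I) (3 ^ q) (ground !) ⟩
    ground ! * (3 ^ q * length I) ∎)
    where
    open ≤-Reasoning
    s = length (survivors π I)
    K = fall (3 * q) q * (3 * q) !
    swap : ∀ a b c → a * (b * c) ≡ b * (a * c)
    swap = solve-∀
    rot : ∀ a b c → a * (b * c) ≡ c * (b * a)
    rot = solve-∀

  -- `J` is what `D` greedy choices leave unhit: a fraction of at most (3/4)^(qD) of `I`, written
  -- without division.
  Thinning : ℕ → List (Pair ground) → Set
  Thinning D I = Σ (Fin D → Permutation′ ground) λ πs → Σ (List (Pair ground)) λ J →
    (4 ^ q) ^ D * length J ≤ (3 ^ q) ^ D * length I ×
    (∀ {p} → p ∈ I → p ∈ J ⊎ ∃ λ d → Hit₂ (πs d) p)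

  thin-out-cons : ∀ {D I} π → 4 ^ q * length (survivors π I) ≤ 3 ^ q * length I →
    Thinning D (survivors π I) → Thinning (suc D) I
  thin-out-cons {D} {I} π shrunk (πs , J , small , hit) = πs′ , J , bound , hit′
    where
    open ≤-Reasoning
    πs′ : Fin (suc D) → Permutation′ ground
    πs′ zero    = π
    πs′ (suc d) = πs d
    swap : ∀ a b c → a * (b * c) ≡ b * (a * c)
    swap = solve-∀
    bound : (4 ^ q) ^ suc D * length J ≤ (3 ^ q) ^ suc D * length I
    bound = begin
      4 ^ q * (4 ^ q) ^ D * length J                 ≡⟨ *-assoc (4 ^ q) _ _ ⟩
      4 ^ q * ((4 ^ q) ^ D * length J)               ≤⟨ *-monoʳ-≤ (4 ^ q) small ⟩
      4 ^ q * ((3 ^ q) ^ D * length (survivors π I)) ≡⟨ swap (4 ^ q) ((3 ^ q) ^ D) _ ⟩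
      (3 ^ q) ^ D * (4 ^ q * length (survivors π I)) ≤⟨ *-monoʳ-≤ ((3 ^ q) ^ D) shrunk ⟩
      (3 ^ q) ^ D * (3 ^ q * length I)               ≡⟨ swap ((3 ^ q) ^ D) (3 ^ q) _ ⟩
      3 ^ q * ((3 ^ q) ^ D * length I)               ≡⟨ *-assoc (3 ^ q) _ _ ⟨
      (3 ^ q) ^ suc D * length I                     ∎
    hit′ : ∀ {p} → p ∈ I → p ∈ J ⊎ ∃ λ d → Hit₂ (πs′ d) p
    hit′ {A , B} p∈I with hit? A B π
    ... | yes h = inj₂ (zero , h)
    ... | no ¬h with hit (∈-filter⁺ (λ (A , B) → ¬? (hit? A B π)) p∈I ¬h)
    ...   | inj₁ p∈J     = inj₁ p∈J
    ...   | inj₂ (d , h) = inj₂ (suc d , h)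

  thin-out-repeatedly : ∀ D I → All Sized I → Thinning D I
  thin-out-repeatedly zero I sized = (λ ()) , I , ≤-refl , inj₁
  thin-out-repeatedly (suc D) I sized =
    let π , shrunk = thin-out I sized in
    thin-out-cons π shrunk (thin-out-repeatedly D (survivors π I) (AllP.filter⁺ _ sized))

infixr 5 _◂_
_◂_ : ∀ {n} → Bool → FSet n → FSet (suc n)
(b ◂ A) zero    = b
(b ◂ A) (suc x) = A x

allSets : ∀ n → List (FSet n)
allSets zero    = (λ ()) ∷ []
allSets (suc n) = map (true ◂_) (allSets n) ++ map (false ◂_) (allSets n)

length-allSets : ∀ n → length (allSets n) ≡ 2 ^ n
length-allSets zero    = refl
length-allSets (suc n) = begin
  length (map (true ◂_) (allSets n) ++ map (false ◂_) (allSets n)) ≡⟨ length-++ (map (true ◂_) (allSets n)) ⟩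
  length (map (true ◂_) (allSets n)) + length (map (false ◂_) (allSets n))
    ≡⟨ cong₂ _+_ (trans (length-map _ (allSets n)) (length-allSets n)) (trans (length-map _ (allSets n)) (length-allSets n)) ⟩
  2 ^ n + 2 ^ n ≡⟨ cong (2 ^ n +_) (+-identityʳ (2 ^ n)) ⟨
  2 ^ suc n ∎
  where open ≡-Reasoning

-- Equality of sets is pointwise, since functions are not extensional; this suffices for cardinality
-- and membership.
allSets-complete : ∀ {n} (A : FSet n) → ∃ λ A′ → A′ ∈ allSets n × A′ ≗ A
allSets-complete {zero}  A = (λ ()) , here refl , λ ()
allSets-complete {suc n} A with allSets-complete (A ∘ suc) | A zero in eq
... | A′ , A′∈ , A′≗ | true  = true ◂ A′ , ∈-++⁺ˡ (∈-map⁺ (true ◂_) A′∈) ,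
      λ { zero → ≡-sym eq ; (suc x) → A′≗ x }
... | A′ , A′∈ , A′≗ | false = false ◂ A′ , ∈-++⁺ʳ (map (true ◂_) (allSets n)) (∈-map⁺ (false ◂_) A′∈) ,
      λ { zero → ≡-sym eq ; (suc x) → A′≗ x }

card-cong : ∀ {n} {A B : FSet n} → A ≗ B → card A ≡ card B
card-cong A≗B = sum-cong-≗ (cong [_] ∘ A≗B)

_⊑_ : ∀ {n} → FSet n → FSet n → Set
A ⊑ B = ∀ x → A x ≡ true → B x ≡ true

shrink : ∀ {n} (A : FSet n) a → a ≤ card A → ∃ λ A′ → card A′ ≡ a × A′ ⊑ A
shrink {zero} A zero p = (λ ()) , refl , λ ()
shrink {suc n} A a p with A zero in eq
shrink {suc n} A a p | false with shrink (A ∘ suc) a p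
... | A′ , c , s = false ◂ A′ , c , λ { (suc x) → s x }
shrink {suc n} A zero p | true with shrink (A ∘ suc) zero z≤n
... | A′ , c , s = false ◂ A′ , c , λ { (suc x) → s x }
shrink {suc n} A (suc a) (s≤s p) | true with shrink (A ∘ suc) a p
... | A′ , c , s = true ◂ A′ , cong suc c , λ { zero _ → eq ; (suc x) → s x }

-- A permutation may be chosen to leave at most the fraction (3/4)^q of the at most 256^q
-- pairs of q-element sets unhit.
expander : ∀ D → 3 ^ D * 256 < 4 ^ D → ∀ q → 1 ≤ q → Σ (Fin D → Permutation′ (q + 3 * q)) λ πs →
  ∀ A B → q ≤ card A → q ≤ card B → ∃ λ d → Hit A B (πs d)
expander D D-large q q≥1 with thin-out-repeatedly q D pairs sized
  where
  m = q + 3 * q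
  sets = filter (λ A → card A ≟ q) (allSets m)
  pairs = cartesianProduct sets sets
  sized : All (Sized q) pairs
  sized = All.tabulate λ p∈ → let a , b = ∈-cartesianProduct⁻ sets sets p∈ in
    proj₂ (∈-filter⁻ (λ A → card A ≟ q) {xs = allSets m} a) , proj₂ (∈-filter⁻ (λ A → card A ≟ q) {xs = allSets m} b)
... | πs , J , small , hit = πs , linked
  where
  m = q + 3 * q
  sets = filter (λ A → card A ≟ q) (allSets m)
  pairs = cartesianProduct sets sets
  length-pairs : length pairs ≤ 256 ^ q
  length-pairs = begin
    length pairs               ≡⟨ length-cartesianProduct sets sets ⟩
    length sets * length sets  ≤⟨ *-mono-≤ (length-filter (λ A → card A ≟ q) (allSets m)) (length-filter (λ A → card A ≟ q) (allSets m)) ⟩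
    length (allSets m) * length (allSets m) ≡⟨ cong₂ _*_ (length-allSets m) (length-allSets m) ⟩
    2 ^ m * 2 ^ m              ≡⟨ ^-distribˡ-+-* 2 m m ⟨
    2 ^ (m + m)                ≡⟨ cong (2 ^_) (eq q) ⟩
    2 ^ (8 * q)                ≡⟨ ^-*-assoc 2 8 q ⟨
    256 ^ q                    ∎
    where
    open ≤-Reasoning
    eq : ∀ q → q + 3 * q + (q + 3 * q) ≡ 8 * q
    eq = solve-∀
  pow : ∀ a → (a ^ q) ^ D ≡ (a ^ D) ^ q
  pow a = trans (^-*-assoc a q D) (trans (cong (a ^_) (*-comm q D)) (≡-sym (^-*-assoc a D q)))
  -- The hypothesis on `D` says that 256 times (3/4)^D is below one. The number of survivors is at
  -- most the `q`-th power of this, so there is none.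
  J-empty : length J < 1
  J-empty = *-cancelˡ-< ((4 ^ D) ^ q) (length J) 1 (begin-strict
    (4 ^ D) ^ q * length J            ≡⟨ cong (_* length J) (pow 4) ⟨
    (4 ^ q) ^ D * length J            ≤⟨ small ⟩
    (3 ^ q) ^ D * length pairs        ≤⟨ *-monoʳ-≤ ((3 ^ q) ^ D) length-pairs ⟩
    (3 ^ q) ^ D * 256 ^ q             ≡⟨ cong (_* 256 ^ q) (pow 3) ⟩
    (3 ^ D) ^ q * 256 ^ q             ≡⟨ ^-distribʳ-* q (3 ^ D) 256 ⟨
    (3 ^ D * 256) ^ q                 <⟨ ^-monoˡ-< q {{>-nonZero q≥1}} D-large ⟩
    (4 ^ D) ^ q                       ≡⟨ *-identityʳ _ ⟨
    (4 ^ D) ^ q * 1                   ∎)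
    where open ≤-Reasoning
  no-survivor : ∀ {p K} → length K < 1 → ¬ p ∈ K
  no-survivor {K = _ ∷ _} (s≤s ()) _
  pick : ∀ A → q ≤ card A → ∃ λ A′ → A′ ∈ sets × A′ ⊑ A
  pick A h with shrink A q h
  ... | A₁ , c , A₁⊑A with allSets-complete A₁
  ...   | A₂ , A₂∈ , A₂≗ = A₂ , ∈-filter⁺ (λ A → card A ≟ q) A₂∈ (trans (card-cong A₂≗) c) ,
            λ x a → A₁⊑A x (trans (≡-sym (A₂≗ x)) a)
  linked : ∀ A B → q ≤ card A → q ≤ card B → ∃ λ d → Hit A B (πs d)
  linked A B a b with pick A a | pick B b
  ... | A′ , A′∈ , A′⊑ | B′ , B′∈ , B′⊑ with hit (∈-cartesianProduct⁺ A′∈ B′∈)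
  ...   | inj₁ p∈J = contradiction p∈J (no-survivor J-empty)
  ...   | inj₂ (d , x , a′ , b′) = d , x , A′⊑ x a′ , B′⊑ _ b′

-- Cai–Fürer–Immerman graphs

xor-interchange : ∀ a b c d → (a xor b) xor (c xor d) ≡ (a xor c) xor (b xor d)
xor-interchange = interchange

xor-cancelʳ : ∀ a f → (a xor f) xor f ≡ a
xor-cancelʳ a f = trans (xor-assoc a f f) (trans (cong (a xor_) (xor-same f)) (xor-identityʳ a))

xor-cancel-≡ : ∀ {a b} f → a xor f ≡ b xor f → a ≡ b
xor-cancel-≡ {a} {b} f eq = trans (≡-sym (xor-cancelʳ a f)) (trans (cong (_xor f) eq) (xor-cancelʳ b f))

xor-telescope : ∀ a b c → (a xor b) xor (b xor c) ≡ a xor c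
xor-telescope a b c = trans (≡-sym (xor-assoc (a xor b) b c)) (cong (_xor c) (xor-cancelʳ a b))

-- The base graph is cubic and bipartite: edge (i , x) joins port i of node (false , x) to
-- port i of node (true , ρ i x), and is subdivided into P vertices. In the graph cfi tw,
-- vertex st u a b is the gadget state of u whose three ports carry the bits a, b and
-- a xor b xor tw u, and pt e p c is the copy of the p-th path vertex of e with bit c.
module CFI (N P : ℕ) (ρ : Fin 3 → Permutation′ N) where

  Node : Set
  Node = Bool × Fin N

  Edge : Set
  Edge = Fin 3 × Fin N

  endnode : Edge → Bool → Node
  endnode (i , x) false = false , x
  endnode (i , x) true  = true , ρ i ⟨$⟩ʳ x

  edgeAt : Node → Fin 3 → Edge
  edgeAt (false , x) i = i , x
  edgeAt (true  , y) i = i , ρ i ⟨$⟩ˡ y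

  edgeAt-endnode : ∀ e s → edgeAt (endnode e s) (proj₁ e) ≡ e
  edgeAt-endnode (i , x) false = refl
  edgeAt-endnode (i , x) true  = cong (i ,_) (Perm.inverseˡ (ρ i))

  endnode-edgeAt : ∀ u i → endnode (edgeAt u i) (proj₁ u) ≡ u
  endnode-edgeAt (false , x) i = refl
  endnode-edgeAt (true  , y) i = cong (true ,_) (Perm.inverseʳ (ρ i))

  _≟ᴺ_ : DecidableEquality Node
  _≟ᴺ_ = ProdP.≡-dec BoolP._≟_ FinP._≟_

  _≟ᴱ_ : DecidableEquality Edge
  _≟ᴱ_ = ProdP.≡-dec FinP._≟_ FinP._≟_

  data Vtx : Set where
    st : Node → Bool → Bool → Vtx
    pt : Edge → Fin P → Bool → Vtx

  size : ℕ
  size = 2 * N * (2 * 2) + 3 * N * (P * 2)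

  abstract
    Vtx↔Fin : Fin size ↔ Vtx
    Vtx↔Fin = ⊎↔ ↔-∘ ((((node ×-↔ bits) ↔-∘ FinP.*↔×) ⊎-↔ ((FinP.*↔× ×-↔ tail) ↔-∘ FinP.*↔×)) ↔-∘ FinP.+↔⊎)
      where
      ⊎↔ : (Node × Bool × Bool ⊎ Edge × Fin P × Bool) ↔ Vtx
      ⊎↔ = mk↔ₛ′ (λ { (inj₁ (u , a , b)) → st u a b ; (inj₂ (e , p , c)) → pt e p c })
                 (λ { (st u a b) → inj₁ (u , a , b) ; (pt e p c) → inj₂ (e , p , c) })
                 (λ { (st u a b) → refl ; (pt e p c) → refl })
                 (λ { (inj₁ _) → refl ; (inj₂ _) → refl })
      bits : Fin (2 * 2) ↔ (Bool × Bool)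
      bits = (FinP.2↔Bool ×-↔ FinP.2↔Bool) ↔-∘ FinP.*↔×
      node : Fin (2 * N) ↔ Node
      node = (FinP.2↔Bool ×-↔ ↔-id (Fin N)) ↔-∘ FinP.*↔×
      tail : Fin (P * 2) ↔ (Fin P × Bool)
      tail = (↔-id (Fin P) ×-↔ FinP.2↔Bool) ↔-∘ FinP.*↔×

  endpos : Bool → ℕ
  endpos false = 0
  endpos true  = P ∸ 1

  -- A node can be an end of an edge only on its own side, so `proj₁ u` selects both the end of `e`
  -- and the position on its path.
  Inc : Node → Edge → Fin P → Set
  Inc u e p = u ≡ endnode e (proj₁ u) × toℕ p ≡ endpos (proj₁ u)

  val : (Node → Bool) → Node → Fin 3 → Bool → Bool → Bool
  val tw u zero             a b = a
  val tw u (suc zero)       a b = b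
  val tw u (suc (suc zero)) a b = (a xor b) xor tw u

  Adj : (Node → Bool) → Vtx → Vtx → Set
  Adj tw (st u a b) (st u′ a′ b′) = ⊥
  Adj tw (st u a b) (pt e p c)    = Inc u e p × val tw u (proj₁ e) a b ≡ c
  Adj tw (pt e p c) (st u a b)    = Inc u e p × val tw u (proj₁ e) a b ≡ c
  Adj tw (pt e p c) (pt e′ p′ c′) = e ≡ e′ × c ≡ c′ × (suc (toℕ p) ≡ toℕ p′ ⊎ suc (toℕ p′) ≡ toℕ p)

  Adj? : ∀ tw x y → Dec (Adj tw x y)
  Adj? tw (st u a b) (st u′ a′ b′) = no λ ()
  Adj? tw (st u a b) (pt e p c) =
    ((u ≟ᴺ endnode e (proj₁ u)) ×-dec (toℕ p ≟ endpos (proj₁ u))) ×-dec (val tw u (proj₁ e) a b BoolP.≟ c)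
  Adj? tw (pt e p c) (st u a b) =
    ((u ≟ᴺ endnode e (proj₁ u)) ×-dec (toℕ p ≟ endpos (proj₁ u))) ×-dec (val tw u (proj₁ e) a b BoolP.≟ c)
  Adj? tw (pt e p c) (pt e′ p′ c′) =
    (e ≟ᴱ e′) ×-dec ((c BoolP.≟ c′) ×-dec ((suc (toℕ p) ≟ toℕ p′) ⊎-dec (suc (toℕ p′) ≟ toℕ p)))

  Adj-sym : ∀ tw x y → Adj tw x y → Adj tw y x
  Adj-sym tw (st _ _ _) (pt _ _ _) a = a
  Adj-sym tw (pt _ _ _) (st _ _ _) a = a
  Adj-sym tw (pt _ _ _) (pt _ _ _) (e , c , inj₁ p) = ≡-sym e , ≡-sym c , inj₂ p
  Adj-sym tw (pt _ _ _) (pt _ _ _) (e , c , inj₂ p) = ≡-sym e , ≡-sym c , inj₁ p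

  Adj-irrefl : ∀ tw x → ¬ Adj tw x x
  Adj-irrefl tw (pt _ _ _) (_ , _ , inj₁ p) = 1+n≢n p
  Adj-irrefl tw (pt _ _ _) (_ , _ , inj₂ p) = 1+n≢n p

  dec : Fin size → Vtx
  dec = Inverse.to Vtx↔Fin

  enc : Vtx → Fin size
  enc = Inverse.from Vtx↔Fin

  dec-enc : ∀ x → dec (enc x) ≡ x
  dec-enc x = Inverse.inverseˡ Vtx↔Fin refl

  enc-dec : ∀ v → enc (dec v) ≡ v
  enc-dec v = Inverse.inverseʳ Vtx↔Fin refl

  cfi : (Node → Bool) → Graph
  cfi tw = record
    { n      = size
    ; adj    = λ u v → does (Adj? tw (dec u) (dec v))
    ; sym    = λ u v → does-⇔ (mk⇔ (Adj-sym tw (dec u) (dec v)) (Adj-sym tw (dec v) (dec u)))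
                 (Adj? tw (dec u) (dec v)) (Adj? tw (dec v) (dec u))
    ; irrefl = λ v → dec-false (Adj? tw (dec v) (dec v)) (Adj-irrefl tw (dec v))
    }

  -- Flipping the bits along edges

  Flip : Set
  Flip = Edge → Bool

  -- Ports 0 and 1 are flipped as their edges demand. The bit at port 2 follows from them, and it
  -- follows its own edge exactly when `∂ F u` accounts for the twist at `u`.
  flip : Flip → Vtx → Vtx
  flip F (st u a b) = st u (a xor F (edgeAt u zero)) (b xor F (edgeAt u (suc zero)))
  flip F (pt e p c) = pt e p (c xor F e)

  -- A pebble on a path vertex is charged to the first end of its edge: flips that agree on all
  -- edges at that node treat the vertex alike.
  base : Vtx → Node
  base (st u a b) = u
  base (pt e p c) = endnode e false

  ∂ : Flip → Node → Bool
  ∂ F u = (F (edgeAt u zero) xor F (edgeAt u (suc zero))) xor F (edgeAt u (suc (suc zero)))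

  δ : Node → Node → Bool
  δ t u = does (t ≟ᴺ u)

  base-flip : ∀ F x → base (flip F x) ≡ base x
  base-flip F (st u a b) = refl
  base-flip F (pt e p c) = refl

  flip-involutive : ∀ F x → flip F (flip F x) ≡ x
  flip-involutive F (st u a b) = cong₂ (st u) (xor-cancelʳ a _) (xor-cancelʳ b _)
  flip-involutive F (pt e p c) = cong (pt e p) (xor-cancelʳ c _)

  untwisted : Node → Bool
  untwisted u = false

  val-flip : ∀ F tw u → ∂ F u ≡ tw u → ∀ i a b →
    val tw u i (a xor F (edgeAt u zero)) (b xor F (edgeAt u (suc zero)))
      ≡ val untwisted u i a b xor F (edgeAt u i)
  val-flip F tw u d zero             a b = refl
  val-flip F tw u d (suc zero)       a b = refl
  val-flip F tw u d (suc (suc zero)) a b = begin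
    ((a xor f) xor (b xor g)) xor tw u          ≡⟨ cong (((a xor f) xor (b xor g)) xor_) d ⟨
    ((a xor f) xor (b xor g)) xor ((f xor g) xor h) ≡⟨ cong (_xor ((f xor g) xor h)) (xor-interchange a f b g) ⟩
    ((a xor b) xor (f xor g)) xor ((f xor g) xor h) ≡⟨ xor-telescope (a xor b) (f xor g) h ⟩
    (a xor b) xor h                             ≡⟨ cong (_xor h) (xor-identityʳ (a xor b)) ⟨
    ((a xor b) xor false) xor h                 ∎
    where
    open ≡-Reasoning
    f = F (edgeAt u zero)
    g = F (edgeAt u (suc zero))
    h = F (edgeAt u (suc (suc zero)))

  Inc⇒edgeAt : ∀ u e p → Inc u e p → edgeAt u (proj₁ e) ≡ e
  Inc⇒edgeAt u e p (eq , _) = trans (cong (λ u → edgeAt u (proj₁ e)) eq) (edgeAt-endnode e (proj₁ u))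

  incident-flip : ∀ F tw u a b e p c → ∂ F u ≡ tw u →
    Adj untwisted (st u a b) (pt e p c) ⇔ Adj tw (flip F (st u a b)) (flip F (pt e p c))
  incident-flip F tw u a b e p c d = mk⇔
    (λ (inc , v) → inc , trans (eq inc) (cong (_xor F e) v))
    (λ (inc , v) → inc , xor-cancel-≡ (F e) (trans (≡-sym (eq inc)) v))
    where
    eq : Inc u e p → _ ≡ val untwisted u (proj₁ e) a b xor F e
    eq inc = trans (val-flip F tw u d (proj₁ e) a b)
      (cong (λ e′ → val untwisted u (proj₁ e) a b xor F e′) (Inc⇒edgeAt u e p inc))

  -- A condition on `F` arises only from a gadget vertex and its third port. Two vertices of one
  -- path carry the same flip, so their adjacency always survives.
  Adj-flip : ∀ F tw x y → ∂ F (base x) ≡ tw (base x) → ∂ F (base y) ≡ tw (base y) →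
    Adj untwisted x y ⇔ Adj tw (flip F x) (flip F y)
  Adj-flip F tw (st u a b) (st u′ a′ b′) dx dy = mk⇔ (λ ()) (λ ())
  Adj-flip F tw (st u a b) (pt e p c) dx dy = incident-flip F tw u a b e p c dx
  Adj-flip F tw (pt e p c) (st u a b) dx dy = incident-flip F tw u a b e p c dy
  Adj-flip F tw (pt e p c) (pt e′ p′ c′) dx dy = mk⇔
    (λ { (refl , refl , q) → refl , refl , q })
    (λ { (refl , eq , q) → refl , xor-cancel-≡ (F e) eq , q })

-- The bijective pebble game

module Walks (N P : ℕ) (ρ : Fin 3 → Permutation′ N) where
  open CFI N P ρ

  -- Both ends of every step avoid `X`, so toggling the edges of a walk changes no edge at a node of
  -- `X`.
  data Walk (X : List Node) : Node → Node → Set where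
    []   : ∀ {t} → Walk X t t
    step : ∀ e s {t′} → endnode e s ∉ X → endnode e (not s) ∉ X →
           Walk X (endnode e (not s)) t′ → Walk X (endnode e s) t′

  _++ʷ_ : ∀ {X t t′ t″} → Walk X t t′ → Walk X t′ t″ → Walk X t t″
  []             ++ʷ w′ = w′
  step e s p q w ++ʷ w′ = step e s p q (w ++ʷ w′)

  reverseʷ : ∀ {X t t′} → Walk X t t′ → Walk X t′ t
  reverseʷ [] = []
  reverseʷ (step e false p q w) = reverseʷ w ++ʷ step e true q p []
  reverseʷ (step e true  p q w) = reverseʷ w ++ʷ step e false q p []

  toggle : Edge → Flip → Flip
  toggle e F e′ = F e′ xor does (e ≟ᴱ e′)

  does-ρ : ∀ i x y → does (x FinP.≟ (ρ i ⟨$⟩ˡ y)) ≡ does ((ρ i ⟨$⟩ʳ x) FinP.≟ y)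
  does-ρ i x y = does-⇔ (mk⇔ (λ { refl → Perm.inverseʳ (ρ i) }) (λ { refl → ≡-sym (Perm.inverseˡ (ρ i)) }))
    (x FinP.≟ (ρ i ⟨$⟩ˡ y)) ((ρ i ⟨$⟩ʳ x) FinP.≟ y)

  -- The ends of an edge lie on different sides and cannot both be `u`, so the exclusive or acts as
  -- a disjunction.
  incidence : ∀ e u → does (e ≟ᴱ edgeAt u (proj₁ e)) ≡ δ (endnode e false) u xor δ (endnode e true) u
  incidence (zero             , x) (false , y) = ≡-sym (xor-identityʳ _)
  incidence (suc zero         , x) (false , y) = ≡-sym (xor-identityʳ _)
  incidence (suc (suc zero)   , x) (false , y) = ≡-sym (xor-identityʳ _)
  incidence (zero             , x) (true  , y) = does-ρ _ x y
  incidence (suc zero         , x) (true  , y) = does-ρ _ x y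
  incidence (suc (suc zero)   , x) (true  , y) = does-ρ _ x y

  ∂-+ : ∀ F G u → ∂ (λ e → F e xor G e) u ≡ ∂ F u xor ∂ G u
  ∂-+ F G u = trans (cong (_xor (f₂ xor g₂)) (xor-interchange f₀ g₀ f₁ g₁))
    (xor-interchange (f₀ xor f₁) (g₀ xor g₁) f₂ g₂)
    where
    f₀ = F (edgeAt u zero)
    f₁ = F (edgeAt u (suc zero))
    f₂ = F (edgeAt u (suc (suc zero)))
    g₀ = G (edgeAt u zero)
    g₁ = G (edgeAt u (suc zero))
    g₂ = G (edgeAt u (suc (suc zero)))

  ∂-single : ∀ e u → ∂ (λ e′ → does (e ≟ᴱ e′)) u ≡ does (e ≟ᴱ edgeAt u (proj₁ e))
  ∂-single (zero           , x) (false , y) = trans (xor-identityʳ _) (xor-identityʳ _)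
  ∂-single (zero           , x) (true  , y) = trans (xor-identityʳ _) (xor-identityʳ _)
  ∂-single (suc zero       , x) (false , y) = xor-identityʳ _
  ∂-single (suc zero       , x) (true  , y) = xor-identityʳ _
  ∂-single (suc (suc zero) , x) (false , y) = refl
  ∂-single (suc (suc zero) , x) (true  , y) = refl

  ∂-toggle : ∀ e s F u → ∂ (toggle e F) u ≡ ∂ F u xor (δ (endnode e s) u xor δ (endnode e (not s)) u)
  ∂-toggle e s F u = trans (∂-+ F (λ e′ → does (e ≟ᴱ e′)) u)
    (cong (∂ F u xor_) (trans (∂-single e u) (trans (incidence e u) (order s))))
    where
    order : ∀ s → δ (endnode e false) u xor δ (endnode e true) u
      ≡ δ (endnode e s) u xor δ (endnode e (not s)) u
    order false = refl
    order true  = xor-comm (δ (endnode e false) u) _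

  -- F carries cfi untwisted to cfi tw everywhere except at the node t.
  Moves : (Node → Bool) → Flip → Node → Set
  Moves tw F t = ∀ u → ∂ F u ≡ tw u xor δ t u

  AgreeOn : List Node → Flip → Flip → Set
  AgreeOn X F F′ = ∀ e s → endnode e s ∈ X → F e ≡ F′ e

  toggle-agrees : ∀ X e s F → endnode e s ∉ X → endnode e (not s) ∉ X → AgreeOn X F (toggle e F)
  toggle-agrees X e s F p q e′ s′ e′∈ = ≡-sym (trans (cong (F e′ xor_) (dec-false (e ≟ᴱ e′) (e≢ s s′ p q e′∈))) (xor-identityʳ _))
    where
    e≢ : ∀ s s′ → endnode e s ∉ X → endnode e (not s) ∉ X → endnode e′ s′ ∈ X → e ≢ e′
    e≢ false false p q e′∈ refl = p e′∈
    e≢ false true  p q e′∈ refl = q e′∈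
    e≢ true  false p q e′∈ refl = q e′∈
    e≢ true  true  p q e′∈ refl = p e′∈

  moves-toggle : ∀ tw F e s → Moves tw F (endnode e s) → Moves tw (toggle e F) (endnode e (not s))
  moves-toggle tw F e s m u = begin
    ∂ (toggle e F) u                    ≡⟨ ∂-toggle e s F u ⟩
    ∂ F u xor (δ₁ xor δ₂)               ≡⟨ cong (_xor (δ₁ xor δ₂)) (m u) ⟩
    (tw u xor δ₁) xor (δ₁ xor δ₂)       ≡⟨ xor-telescope (tw u) δ₁ δ₂ ⟩
    tw u xor δ₂                         ∎
    where
    open ≡-Reasoning
    δ₁ = δ (endnode e s) u
    δ₂ = δ (endnode e (not s)) u

  -- The boundary of a walk, modulo two, consists of its ends. Toggling its edges therefore carries
  -- the defect from `t` to `t′` and leaves the pebbled nodes alone.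
  carry : ∀ {X t t′} tw F → Walk X t t′ → Moves tw F t → ∃ λ F′ → Moves tw F′ t′ × AgreeOn X F F′
  carry tw F [] m = F , m , λ _ _ _ → refl
  carry {X} tw F (step e s p q w) m =
    let F′ , mF′ , agree = carry tw (toggle e F) w (moves-toggle tw F e s m) in
    F′ , mF′ , λ e′ s′ e′∈ → trans (toggle-agrees X e s F p q e′ s′ e′∈) (agree e′ s′ e′∈)

  flip-agree : ∀ {X F F′} → AgreeOn X F F′ → ∀ x → base x ∈ X → flip F x ≡ flip F′ x
  flip-agree {X} agree (st u a b) u∈ = cong₂ (λ f g → st u (a xor f) (b xor g)) (at zero) (at (suc zero))
    where
    at = λ i → agree (edgeAt u i) (proj₁ u) (subst (_∈ X) (≡-sym (endnode-edgeAt u i)) u∈)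
  flip-agree agree (pt e p c) e∈ = cong (λ f → pt e p (c xor f)) (agree e false e∈)

  flipᶠ : Flip → Fin size → Fin size
  flipᶠ F v = enc (flip F (dec v))

  baseᶠ : Fin size → Node
  baseᶠ v = base (dec v)

  dec-flipᶠ : ∀ F v → dec (flipᶠ F v) ≡ flip F (dec v)
  dec-flipᶠ F v = dec-enc _

  baseᶠ-flipᶠ : ∀ F v → baseᶠ (flipᶠ F v) ≡ baseᶠ v
  baseᶠ-flipᶠ F v = trans (cong base (dec-flipᶠ F v)) (base-flip F (dec v))

  flipᶠ-involutive : ∀ F v → flipᶠ F (flipᶠ F v) ≡ v
  flipᶠ-involutive F v = trans (cong (enc ∘ flip F) (dec-flipᶠ F v))
    (trans (cong enc (flip-involutive F (dec v))) (enc-dec v))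

  positions : ∀ {m} → Vec (Fin size) m → List Node
  positions v = toList (Vec.map baseᶠ v)

  lookup-∈ : ∀ {m} (v : Vec (Fin size) m) a → baseᶠ (lookup v a) ∈ positions v
  lookup-∈ (x ∷ v) zero    = here refl
  lookup-∈ (x ∷ v) (suc a) = there (lookup-∈ v a)

  map-flip-agree : ∀ {m F F′} (v : Vec (Fin size) m) → AgreeOn (positions v) F F′ →
    Vec.map (flipᶠ F) v ≡ Vec.map (flipᶠ F′) v
  map-flip-agree []      agree = refl
  map-flip-agree (x ∷ v) agree = cong₂ _∷_ (cong enc (flip-agree agree (dec x) (here refl)))
    (map-flip-agree v λ e s e∈ → agree e s (there e∈))

  positions-∷ʳ : ∀ {m} (v : Vec (Fin size) m) w {x} → x ∈ positions (v ∷ʳ w) → x ∈ baseᶠ w ∷ positions v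
  positions-∷ʳ []      w x∈ = x∈
  positions-∷ʳ (y ∷ v) w (here refl) = there (here refl)
  positions-∷ʳ (y ∷ v) w (there x∈) with positions-∷ʳ v w x∈
  ... | here eq  = here eq
  ... | there p  = there (there p)

  positions-≔ : ∀ {m} (v : Vec (Fin size) m) j w {x} → x ∈ positions (v [ j ]≔ w) → x ∈ baseᶠ w ∷ positions v
  positions-≔ (y ∷ v) zero    w (here refl) = here refl
  positions-≔ (y ∷ v) zero    w (there x∈)  = there (there x∈)
  positions-≔ (y ∷ v) (suc j) w (here refl) = there (here refl)
  positions-≔ (y ∷ v) (suc j) w (there x∈) with positions-≔ v j w x∈
  ... | here eq  = here eq
  ... | there p  = there (there p)

  length-positions : ∀ {m} (v : Vec (Fin size) m) → length (positions v) ≡ m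
  length-positions []      = refl
  length-positions (x ∷ v) = cong suc (length-positions v)

  sameAtp-flip : ∀ {m} tw F t (v : Vec (Fin size) m) → Moves tw F t → t ∉ positions v →
    SameAtp (cfi untwisted) (cfi tw) v (Vec.map (flipᶠ F) v)
  sameAtp-flip tw F t v moves t∉ a b = mk⇔
      (λ eq → trans (VecP.lookup-map a (flipᶠ F) v) (trans (cong (flipᶠ F) eq) (≡-sym (VecP.lookup-map b (flipᶠ F) v))))
      (λ eq → injective (trans (≡-sym (VecP.lookup-map a (flipᶠ F) v)) (trans eq (VecP.lookup-map b (flipᶠ F) v))))
    , trans (does-⇔ (Adj-flip F tw (dec (lookup v a)) (dec (lookup v b)) (even a) (even b))
        (Adj? untwisted (dec (lookup v a)) (dec (lookup v b)))
        (Adj? tw (flip F (dec (lookup v a))) (flip F (dec (lookup v b)))))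
      (≡-sym (cong₂ (λ x y → does (Adj? tw x y)) (image a) (image b)))
    where
    injective : ∀ {x y} → flipᶠ F x ≡ flipᶠ F y → x ≡ y
    injective {x} {y} eq = trans (≡-sym (flipᶠ-involutive F x)) (trans (cong (flipᶠ F) eq) (flipᶠ-involutive F y))
    image : ∀ a → dec (lookup (Vec.map (flipᶠ F) v) a) ≡ flip F (dec (lookup v a))
    image a = trans (cong dec (VecP.lookup-map a (flipᶠ F) v)) (dec-flipᶠ F (lookup v a))
    even : ∀ a → ∂ F (baseᶠ (lookup v a)) ≡ tw (baseᶠ (lookup v a))
    even a = trans (moves _) (trans (cong (tw (baseᶠ (lookup v a)) xor_) (dec-false (t ≟ᴺ _) λ { refl → t∉ (lookup-∈ v a) }))
      (xor-identityʳ _))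

  -- A haven of order suc k in the cops-and-robber game; the robber marks the one node
  -- at which the duplicator's partial isomorphism fails.
  record Haven (k : ℕ) : Set₁ where
    field
      Safe     : List Node → Node → Set
      safe     : ∀ X → length X ≤ suc k → ∃ (Safe X)
      antitone : ∀ {X Y t} → (∀ {x} → x ∈ X → x ∈ Y) → Safe Y t → Safe X t
      avoids   : ∀ {X t} → Safe X t → t ∉ X
      connect  : ∀ {X t t′} → Safe X t → Safe X t′ → Walk X t t′

  module _ {k : ℕ} (haven : Haven k) where
    open Haven haven

    t₀ : Node
    t₀ = proj₁ (safe [] z≤n)

    twist : Node → Bool
    twist = δ t₀

    Position : List Node → Set
    Position X = Σ Flip λ F → Σ Node λ t → Moves twist F t × Safe X t

    abstract
      -- A node that is safe for the larger `Y` is safe for `X` as well, so a walk avoiding `X`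
      -- leads the defect there. The flip stays as it was on the pebbles already placed.
      advance : ∀ {X} (p : Position X) Y → (∀ {x} → x ∈ X → x ∈ Y) → length Y ≤ suc k →
        Σ (Position Y) λ p′ → AgreeOn X (proj₁ p) (proj₁ p′)
      advance (F , t , moves , s) Y X⊆Y len =
        let t′ , s′ = safe Y len
            F′ , moves′ , agree = carry twist F (connect s (antitone X⊆Y s′)) moves
        in (F′ , t′ , moves′ , s′) , agree

    weaken : ∀ {X Y} → (∀ {x} → x ∈ X → x ∈ Y) → Position Y → Position X
    weaken X⊆Y (F , t , moves , s) = F , t , moves , antitone X⊆Y s

    sameAtp-∷ʳ : ∀ {m F G t} (v : Vec (Fin size) m) w → AgreeOn (positions v) F G → Moves twist G t →
      t ∉ positions (v ∷ʳ w) → SameAtp (cfi untwisted) (cfi twist) (v ∷ʳ w) (Vec.map (flipᶠ F) v ∷ʳ flipᶠ G w)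
    sameAtp-∷ʳ {F = F} {G} {t} v w agree moves t∉ =
      subst (SameAtp (cfi untwisted) (cfi twist) (v ∷ʳ w))
        (trans (VecP.map-∷ʳ (flipᶠ G) w v) (≡-sym (cong (_∷ʳ flipᶠ G w) (map-flip-agree v agree))))
        (sameAtp-flip twist G t (v ∷ʳ w) moves t∉)

    -- The invariant of the duplicator: the tuples are related by one flip whose only defect is at a
    -- node safe from all pebbles.
    indistinguishable : ∀ i (v : Vec (Fin size) k) (p : Position (positions v)) →
      WLEq (cfi untwisted) (cfi twist) k i v (Vec.map (flipᶠ (proj₁ p)) v)
    indistinguishable zero v (F , t , moves , s) = sameAtp-flip twist F t v moves (avoids s)
    indistinguishable (suc i) v p@(F , t , moves , s) =
      indistinguishable i v p , ↔⇒⤖ σ , λ w → atomic w , λ j → refined w j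
      where
      -- The new flip is chosen from the node of `w` rather than from `w`. Flips preserve this node,
      -- so `move` uses the same flip on the way back and is an involution, hence a bijection.
      next : ∀ u → Σ (Position (u ∷ positions v)) λ p′ → AgreeOn (positions v) F (proj₁ p′)
      next u = advance p (u ∷ positions v) there (s≤s (≤-reflexive (length-positions v)))
      F′ : Node → Flip
      F′ u = proj₁ (proj₁ (next u))
      move : Fin size → Fin size
      move w = flipᶠ (F′ (baseᶠ w)) w
      move-involutive : ∀ w → move (move w) ≡ w
      move-involutive w = trans (cong (λ u → flipᶠ (F′ u) (move w)) (baseᶠ-flipᶠ (F′ (baseᶠ w)) w))
        (flipᶠ-involutive (F′ (baseᶠ w)) w)
      σ : Fin size ↔ Fin size
      σ = mk↔ₛ′ move move move-involutive move-involutive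
      same : ∀ w → Vec.map (flipᶠ F) v ≡ Vec.map (flipᶠ (F′ (baseᶠ w))) v
      same w = map-flip-agree v (proj₂ (next (baseᶠ w)))
      atomic : ∀ w → SameAtp (cfi untwisted) (cfi twist) (v ∷ʳ w) (Vec.map (flipᶠ F) v ∷ʳ move w)
      atomic w = sameAtp-∷ʳ v w (proj₂ (next (baseᶠ w))) (proj₁ (proj₂ (proj₂ (proj₁ (next (baseᶠ w))))))
        (λ t∈ → avoids (proj₂ (proj₂ (proj₂ (proj₁ (next (baseᶠ w)))))) (positions-∷ʳ v w t∈))
      refined : ∀ w j → WLEq (cfi untwisted) (cfi twist) k i (v [ j ]≔ w) (Vec.map (flipᶠ F) v [ j ]≔ move w)
      refined w j = subst (WLEq (cfi untwisted) (cfi twist) k i (v [ j ]≔ w))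
        (trans (VecP.map-[]≔ (flipᶠ (F′ (baseᶠ w))) v j)
          (≡-sym (cong (_[ j ]≔ move w) (same w))))
        (indistinguishable i (v [ j ]≔ w) (weaken (positions-≔ v j w) (proj₁ (next (baseᶠ w)))))

    start : Position []
    -- The zero flip fails exactly where the twist sits, so the defect starts at `t₀`.
    start = (λ _ → false) , t₀ , (λ u → ≡-sym (xor-same (δ t₀ u))) , proj₂ (safe [] z≤n)

    initial : (us : Vec Node k) → Position (toList us)
    initial us = proj₁ (advance start (toList us) (λ ()) (≤-trans (≤-reflexive (VecP.length-toList us)) (n≤1+n k)))

    -- As in a single round, the flip applied to a tuple depends only on the nodes of its entries,
    -- which makes `π` an involution on tuples.
    not-distinguished : NotDistinguishedByWL k (cfi untwisted) (cfi twist)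
    not-distinguished i = ↔⇒⤖ (mk↔ₛ′ π π π-involutive π-involutive) ,
        λ v → indistinguishable i v (initial (Vec.map baseᶠ v))
      where
      at : Vec Node k → Flip
      at us = proj₁ (initial us)
      π : Vec (Fin size) k → Vec (Fin size) k
      π v = Vec.map (flipᶠ (at (Vec.map baseᶠ v))) v
      map-base : ∀ F v → Vec.map baseᶠ (Vec.map (flipᶠ F) v) ≡ Vec.map baseᶠ v
      map-base F v = trans (≡-sym (VecP.map-∘ baseᶠ (flipᶠ F) v)) (VecP.map-cong (baseᶠ-flipᶠ F) v)
      map-involutive : ∀ F (v : Vec (Fin size) k) → Vec.map (flipᶠ F) (Vec.map (flipᶠ F) v) ≡ v
      map-involutive F v = trans (≡-sym (VecP.map-∘ (flipᶠ F) (flipᶠ F) v))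
        (trans (VecP.map-cong (flipᶠ-involutive F) v) (VecP.map-id v))
      π-involutive : ∀ v → π (π v) ≡ v
      π-involutive v = trans (cong (λ us → Vec.map (flipᶠ (at us)) (π v)) (map-base (at (Vec.map baseᶠ v)) v))
        (map-involutive (at (Vec.map baseᶠ v)) v)

-- A haven in the block graph

-- `dead` blocks contain a pebbled node, `done` ones belong to completed components, `current` ones
-- to the component being grown, and `fresh` ones are unexplored.
data Status : Set where
  dead done current fresh : Status

is : Status → Status → Bool
is dead    dead    = true
is done    done    = true
is current current = true
is fresh   fresh   = true
is _       _       = false

is-sound : ∀ s r → is s r ≡ true → r ≡ s
is-sound dead    dead    _ = refl
is-sound done    done    _ = refl
is-sound current current _ = refl
is-sound fresh   fresh   _ = refl

# : ∀ {n} → Status → (Fin n → Status) → ℕ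
# s c = card (is s ∘ c)

status-total : ∀ {n} (c : Fin n → Status) → # dead c + (# done c + (# current c + # fresh c)) ≡ n
status-total {zero}  c = refl
status-total {suc n} c = trans (head (c zero) _ _ _ _) (cong suc (status-total (c ∘ suc)))
  where
  head : ∀ s a b d e → ([ is dead s ] + a) + (([ is done s ] + b) + (([ is current s ] + d) + ([ is fresh s ] + e)))
    ≡ suc (a + (b + (d + e)))
  head dead    a b d e = refl
  head done    a b d e = +-suc a _
  head current a b d e = trans (cong (a +_) (+-suc b _)) (+-suc a _)
  head fresh   a b d e = trans (cong (λ z → a + (b + z)) (+-suc d e)) (trans (cong (a +_) (+-suc b _)) (+-suc a _))

assign : ∀ {n} → Fin n → Status → (Fin n → Status) → Fin n → Status
assign w s c x = if does (w FinP.≟ x) then s else c x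

assign-same : ∀ {n} (w : Fin n) s c → assign w s c w ≡ s
assign-same w s c = cong (if_then s else c w) (dec-true (w FinP.≟ w) refl)

assign-other : ∀ {n} (w : Fin n) s c {x} → w ≢ x → assign w s c x ≡ c x
assign-other w s c {x} w≢x = cong (if_then s else c x) (dec-false (w FinP.≟ x) w≢x)

#-assign : ∀ {n} (w : Fin n) s c r →
  # r (assign w s c) + [ is r (c w) ] ≡ # r c + [ is r s ]
#-assign {suc n} w s c r = begin
  # r c′ + [ is r (c w) ]                  ≡⟨ cong (_+ [ is r (c w) ]) (card-punchIn (is r ∘ c′) w) ⟩
  [ is r (c′ w) ] + card (is r ∘ c′ ∘ punchIn w) + [ is r (c w) ]
    ≡⟨ cong₂ (λ a b → [ is r a ] + b + [ is r (c w) ]) (assign-same w s c)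
        (sum-cong-≗ (λ x → cong (λ y → [ is r y ]) (assign-other w s c (λ eq → FinP.punchInᵢ≢i w x (≡-sym eq))))) ⟩
  [ is r s ] + rest + [ is r (c w) ]        ≡⟨ rearr [ is r s ] rest [ is r (c w) ] ⟩
  [ is r (c w) ] + rest + [ is r s ]        ≡⟨ cong (_+ [ is r s ]) (card-punchIn (is r ∘ c) w) ⟨
  # r c + [ is r s ]                       ∎
  where
  open ≡-Reasoning
  c′ = assign w s c
  rest = card (is r ∘ c ∘ punchIn w)
  rearr : ∀ a b d → a + b + d ≡ d + b + a
  rearr = solve-∀

retire : Status → Status
retire current = done
retire s       = s

#-retire-done : ∀ {n} (c : Fin n → Status) → # done (retire ∘ c) ≡ # done c + # current c
#-retire-done {zero}  c = refl
#-retire-done {suc n} c = trans (cong ([ is done (retire (c zero)) ] +_) (#-retire-done (c ∘ suc))) (head (c zero) _ _)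
  where
  head : ∀ s a b → [ is done (retire s) ] + (a + b) ≡ ([ is done s ] + a) + ([ is current s ] + b)
  head dead    a b = refl
  head done    a b = refl
  head current a b = ≡-sym (+-suc a b)
  head fresh   a b = refl

#-retire-current : ∀ {n} (c : Fin n → Status) → # current (retire ∘ c) ≡ 0
#-retire-current {zero}  c = refl
#-retire-current {suc n} c = trans (cong (_+ # current (retire ∘ c ∘ suc)) (head (c zero))) (#-retire-current (c ∘ suc))
  where
  head : ∀ s → [ is current (retire s) ] ≡ 0
  head dead    = refl
  head done    = refl
  head current = refl
  head fresh   = refl

#-retire-fresh : ∀ {n} (c : Fin n → Status) → # fresh (retire ∘ c) ≡ # fresh c
#-retire-fresh {zero}  c = refl
#-retire-fresh {suc n} c = cong₂ _+_ (head (c zero)) (#-retire-fresh (c ∘ suc))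
  where
  head : ∀ s → [ is fresh (retire s) ] ≡ [ is fresh s ]
  head dead    = refl
  head done    = refl
  head current = refl
  head fresh   = refl

member : ∀ {n} (A : FSet n) → 0 < card A → ∃ λ x → A x ≡ true
member {suc n} A h with A zero in eq
... | true  = zero , eq
... | false = let x , p = member (A ∘ suc) h in suc x , p

-- The cubic graph of blocks

rotation : ∀ n → Permutation′ (suc n)
rotation n = insert (fromℕ n) zero Perm.id

punchIn-fromℕ : ∀ n k → punchIn (fromℕ n) k ≡ inject₁ k
punchIn-fromℕ (suc n) zero    = refl
punchIn-fromℕ (suc n) (suc k) = cong suc (punchIn-fromℕ n k)

rotation-inject₁ : ∀ n k → rotation n ⟨$⟩ʳ inject₁ k ≡ suc k
rotation-inject₁ n k = trans (cong (rotation n ⟨$⟩ʳ_) (≡-sym (punchIn-fromℕ n k)))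
  (insert-punchIn (fromℕ n) zero Perm.id k)

module BlockGraph (n D₁ : ℕ) (π : Fin (suc D₁) → Permutation′ n) (P : ℕ) where

  D : ℕ
  D = suc D₁

  onSlots : (Fin n × Fin D) ↔ (Fin n × Fin D) → Permutation′ (n * D)
  onSlots f = ↔-sym (FinP.*↔× {n} {D}) ↔-∘ (f ↔-∘ FinP.*↔× {n} {D})

  matching : (Fin n × Fin D) ↔ (Fin n × Fin D)
  matching = mk↔ₛ′ (λ (j , d) → π d ⟨$⟩ʳ j , d) (λ (j , d) → π d ⟨$⟩ˡ j , d)
    (λ (j , d) → cong (_, d) (Perm.inverseʳ (π d))) (λ (j , d) → cong (_, d) (Perm.inverseˡ (π d)))

  -- A slot (j, d) has one node on each side. Port 0 joins these two, and port 1 joins the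
  -- first-side node to the second-side node of the next slot in cyclic order, so that block j is a
  -- cycle through its 2D nodes. Port 2 realises permutation `π d` between the slots numbered d.
  ρ : Fin 3 → Permutation′ (n * D)
  ρ zero             = Perm.id
  ρ (suc zero)       = onSlots (↔-id (Fin n) ×-↔ rotation D₁)
  ρ (suc (suc zero)) = onSlots matching

  onSlots-combine : ∀ f j d → onSlots f ⟨$⟩ʳ combine j d ≡ combine (proj₁ (Inverse.to f (j , d))) (proj₂ (Inverse.to f (j , d)))
  onSlots-combine f j d = cong (λ p → let (j , d) = Inverse.to f p in combine j d) (FinP.remQuot-combine j d)

  open CFI (n * D) P ρ
  open Walks (n * D) P ρ

  node : Bool → Fin n → Fin D → Node
  node s j d = s , combine j d

  block : Node → Fin n
  block (s , x) = proj₁ (remQuot D x)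

  block-node : ∀ s j d → block (node s j d) ≡ j
  block-node s j d = cong proj₁ (FinP.remQuot-combine j d)

  Alive : List Node → Fin n → Set
  Alive X j = ∀ {u} → u ∈ X → block u ≢ j

  Alive⇒∉ : ∀ {X j} → Alive X j → ∀ s d → node s j d ∉ X
  Alive⇒∉ alive s d u∈ = alive u∈ (block-node s _ d)

  center : Fin n → Node
  center j = node false j zero

  traverse : ∀ {X} i {j j′ d d′} → Alive X j → Alive X j′ → ρ i ⟨$⟩ʳ combine j d ≡ combine j′ d′ →
    Walk X (node false j d) (node true j′ d′)
  traverse {X} i {j} {j′} {d} {d′} a a′ eq =
    subst (Walk X (node false j d)) (cong (true ,_) eq)
      (step (i , combine j d) false (Alive⇒∉ a false d)
        (subst (_∉ X) (cong (true ,_) (≡-sym eq)) (Alive⇒∉ a′ true d′)) [])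

  -- The next slot is reached through its second-side node: out along port 1, back along port 0. All
  -- of this stays inside one live block.
  spoke : ∀ {X j} → Alive X j → ∀ d → Walk X (center j) (node false j d)
  spoke {X} {j} a = <-weakInduction (λ d → Walk X (center j) (node false j d)) [] λ d w →
    w ++ʷ (traverse (suc zero) a a (trans (onSlots-combine (↔-id (Fin n) ×-↔ rotation D₁) j (inject₁ d))
             (cong (combine j) (rotation-inject₁ D₁ d)))
    ++ʷ reverseʷ (traverse zero a a refl))

  cross : ∀ {X j} d → Alive X j → Alive X (π d ⟨$⟩ʳ j) → Walk X (center j) (center (π d ⟨$⟩ʳ j))
  cross {j = j} d a a′ = spoke a d ++ʷ (traverse (suc (suc zero)) a a′ (onSlots-combine matching j d)
    ++ʷ (reverseʷ (traverse zero a′ a′ refl) ++ʷ reverseʷ (spoke a′ d)))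

  weakenʷ : ∀ {X Y t t′} → (∀ {x} → x ∈ X → x ∈ Y) → Walk Y t t′ → Walk X t t′
  weakenʷ X⊆Y [] = []
  weakenʷ X⊆Y (step e s p q w) = step e s (p ∘ X⊆Y) (q ∘ X⊆Y) (weakenʷ X⊆Y w)

-- A haven from expansion

module Expansion (q D₁ : ℕ) (π : Fin (suc D₁) → Permutation′ (q + 3 * q))
  (linked : ∀ A B → q ≤ card A → q ≤ card B → ∃ λ d → Hit A B (π d)) (P : ℕ) where

  open BlockGraph (q + 3 * q) D₁ π P
  open CFI ((q + 3 * q) * D) P ρ
  open Walks ((q + 3 * q) * D) P ρ

  -- The robber stands in a component with at least `q` live blocks. Any two sets of `q` blocks are
  -- linked, so all safe nodes share one component; and asking merely for some such set makes safety
  -- pass to smaller `X`.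
  Safe : List Node → Node → Set
  Safe X t = t ∉ X × Σ (FSet (q + 3 * q)) λ A → q ≤ card A ×
    (∀ j → A j ≡ true → Alive X j × Walk X t (center j))

  connect : ∀ {X t t′} → Safe X t → Safe X t′ → Walk X t t′
  connect (_ , A , A-large , reach) (_ , A′ , A′-large , reach′) =
    let d , j , j∈A , πj∈A′ = linked A A′ A-large A′-large
        alive , w   = reach j j∈A
        alive′ , w′ = reach′ _ πj∈A′
    in w ++ʷ (cross d alive alive′ ++ʷ reverseʷ w′)

  antitone : ∀ {X Y t} → (∀ {x} → x ∈ X → x ∈ Y) → Safe Y t → Safe X t
  antitone X⊆Y (t∉ , A , large , reach) = t∉ ∘ X⊆Y , A , large , λ j j∈A →
    let alive , w = reach j j∈A in alive ∘ X⊆Y , weakenʷ X⊆Y w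

  -- Blocks are explored one component at a time: the current component is grown
  -- until it has q blocks or is complete; a complete component of fewer than q blocks
  -- is retired, and expansion forbids q retired blocks next to q fresh ones.
  record Exploration (X : List Node) (c : Fin (q + 3 * q) → Status) (j₀ : Fin (q + 3 * q)) : Set where
    field
      alive₀     : Alive X j₀
      alive      : ∀ j → c j ≢ dead → Alive X j
      reached    : ∀ j → c j ≡ current → Walk X (center j₀) (center j)
      -- Only forward along the permutations, in the same direction as `linked` and the search for a
      -- crossing.
      separated  : ∀ d j → c j ≡ done → c (π d ⟨$⟩ʳ j) ≢ fresh
      few-done   : # done c < q
      -- Counts the blocks that are not dead; of the 4q blocks at most `q` are.
      enough     : 3 * q ≤ # done c + (# current c + # fresh c)

  is-complete : ∀ {r} s → r ≡ s → is s r ≡ true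
  is-complete dead    refl = refl
  is-complete done    refl = refl
  is-complete current refl = refl
  is-complete fresh   refl = refl

  module _ {X : List Node} where

    -- Serves both continuations: extending the current component, with `j₁` equal to `j₀`, and
    -- opening a new one at `w` once the old one is retired. Turning a fresh block into a current
    -- one cannot spoil the separation of done from fresh.
    pick-fresh : ∀ {c : Fin (q + 3 * q) → Status} {w j₀} → c w ≡ fresh → (alive-w : Alive X w) → Exploration X c j₀ → ∀ j₁ → Alive X j₁ →
      (∀ j → assign w current c j ≡ current → Walk X (center j₁) (center j)) →
      Exploration X (assign w current c) j₁
    pick-fresh {c} {w} cw alive-w ex j₁ alive₁ reach = record
      { alive₀    = alive₁
      ; alive     = alive′
      ; reached   = reach
      ; separated = separated′
      ; few-done  = subst (_< q) (≡-sym done-same) few-done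
      ; enough    = subst (3 * q ≤_) total enough
      }
      where
      open Exploration ex
      c′ = assign w current c
      count : ∀ r → # r c′ + [ is r fresh ] ≡ # r c + [ is r current ]
      count r = subst (λ s → # r c′ + [ is r s ] ≡ # r c + [ is r current ]) cw (#-assign w current c r)
      done-same : # done c′ ≡ # done c
      done-same = trans (≡-sym (+-identityʳ _)) (trans (count done) (+-identityʳ _))
      total : # done c + (# current c + # fresh c) ≡ # done c′ + (# current c′ + # fresh c′)
      total = cong₂ _+_ (≡-sym done-same) (begin
        # current c + # fresh c         ≡⟨ cong (# current c +_) (trans (≡-sym (+-identityʳ _)) (≡-sym (count fresh))) ⟩
        # current c + (# fresh c′ + 1)  ≡⟨ rearr (# current c) (# fresh c′) ⟩
        (# current c + 1) + # fresh c′  ≡⟨ cong (_+ # fresh c′) (trans (≡-sym (count current)) (+-identityʳ _)) ⟩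
        # current c′ + # fresh c′       ∎)
        where
        open ≡-Reasoning
        rearr : ∀ a b → a + (b + 1) ≡ (a + 1) + b
        rearr = solve-∀
      unchanged : ∀ j → c′ j ≡ current ⊎ c′ j ≡ c j
      unchanged j with w FinP.≟ j
      ... | yes _ = inj₁ refl
      ... | no  _ = inj₂ refl
      alive′ : ∀ j → c′ j ≢ dead → Alive X j
      alive′ j ¬dead with w FinP.≟ j
      ... | yes refl = alive-w
      ... | no  _    = alive j ¬dead
      separated′ : ∀ d j → c′ j ≡ done → c′ (π d ⟨$⟩ʳ j) ≢ fresh
      separated′ d j cj cπj with unchanged j | unchanged (π d ⟨$⟩ʳ j)
      ... | inj₁ e | _      = contradiction (trans (≡-sym e) cj) λ ()
      ... | inj₂ e | inj₁ f = contradiction (trans (≡-sym f) cπj) λ ()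
      ... | inj₂ e | inj₂ f = separated d j (trans (≡-sym e) cj) (trans (≡-sym f) cπj)

    fresh-decreases : ∀ {c : Fin (q + 3 * q) → Status} {w} → c w ≡ fresh → # fresh c ≡ suc (# fresh (assign w current c))
    fresh-decreases {c} {w} cw = trans (≡-sym (+-identityʳ _)) (trans
      (≡-sym (subst (λ s → # fresh (assign w current c) + [ is fresh s ] ≡ # fresh c + [ is fresh current ]) cw
        (#-assign w current c fresh))) (+-comm _ 1))

    Result : Set
    Result = ∃ (Safe X)

    crossing? : ∀ c → Dec (∃ λ d → Hit (is current ∘ c) (is fresh ∘ c) (π d))
    crossing? c = any? λ d → hit? (is current ∘ c) (is fresh ∘ c) (π d)

    -- `m` bounds the fresh blocks, of which each round consumes one: the target of a crossing, or
    -- the seed of a new component.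
    explore : ∀ m c j₀ → # fresh c ≤ m → Exploration X c j₀ → Result
    grow   : ∀ m c j₀ → # fresh c ≤ m → Exploration X c j₀ →
             ∃ (λ d → Hit (is current ∘ c) (is fresh ∘ c) (π d)) → Result
    restart : ∀ m c j₀ → # fresh c ≤ m → Exploration X c j₀ → # current c < q →
             ¬ ∃ (λ d → Hit (is current ∘ c) (is fresh ∘ c) (π d)) → Result

    explore m c j₀ bound ex with q ≤? # current c
    ... | yes large = center j₀ , Alive⇒∉ (Exploration.alive₀ ex) false zero , is current ∘ c , large ,
            λ j j-current → let cj = is-sound current (c j) j-current in
              Exploration.alive ex j (λ e → contradiction (trans (≡-sym cj) e) λ ()) ,
              Exploration.reached ex j cj
    ... | no small with crossing? c
    ...   | yes hit = grow m c j₀ bound ex hit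
    ...   | no ¬hit = restart m c j₀ bound ex (≰⇒> small) ¬hit

    grow m c j₀ bound ex (d , j , cj , cw) = descend m bound
      where
      open Exploration ex
      w = π d ⟨$⟩ʳ j
      cj′ = is-sound current (c j) cj
      cw′ = is-sound fresh (c w) cw
      alive-w : Alive X w
      alive-w = alive w (λ e → contradiction (trans (≡-sym cw′) e) λ ())
      reach : ∀ i → assign w current c i ≡ current → Walk X (center j₀) (center i)
      reach i ci with w FinP.≟ i
      ... | yes refl = reached j cj′ ++ʷ cross d (alive j (λ e → contradiction (trans (≡-sym cj′) e) λ ())) alive-w
      ... | no  _    = reached i ci
      descend : ∀ m → # fresh c ≤ m → Result
      descend m b with subst (_≤ m) (fresh-decreases {c} {w} cw′) b
      descend (suc m) b | s≤s b′ = explore m (assign w current c) j₀ b′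
        (pick-fresh cw′ alive-w ex j₀ alive₀ reach)

    restart m c j₀ bound ex current<q ¬hit = descend m bound
      where
      open Exploration ex
      c″ = retire ∘ c
      -- Fewer than `q` blocks are done and fewer than `q` current, out of at least 3q. The
      -- remaining third is what allows `linked` to be applied against the retired blocks.
      fresh-large : q ≤ # fresh c
      fresh-large = +-cancelˡ-≤ (q + q) _ _ (begin
        q + q + q                                     ≡⟨ three q ⟩
        3 * q                                         ≤⟨ enough ⟩
        # done c + (# current c + # fresh c)       ≡⟨ +-assoc (# done c) _ _ ⟨
        # done c + # current c + # fresh c         ≤⟨ +-monoˡ-≤ (# fresh c) (+-mono-≤ (<⇒≤ few-done) (<⇒≤ current<q)) ⟩
        q + q + # fresh c                            ∎)
        where
        open ≤-Reasoning
        three : ∀ q → q + q + q ≡ 3 * q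
        three = solve-∀
      retired-fresh : ∀ s → retire s ≡ fresh → s ≡ fresh
      retired-fresh fresh _ = refl
      retired-done : ∀ s → retire s ≡ done → s ≡ done ⊎ s ≡ current
      retired-done done    _ = inj₁ refl
      retired-done current _ = inj₂ refl
      retired-dead : ∀ s → s ≡ dead → retire s ≡ dead
      retired-dead dead _ = refl
      not-current : ∀ s → retire s ≢ current
      not-current dead    ()
      not-current done    ()
      not-current current ()
      not-current fresh   ()
      separated″ : ∀ d j → c″ j ≡ done → c″ (π d ⟨$⟩ʳ j) ≢ fresh
      separated″ d j cj cπj with retired-done (c j) cj
      ... | inj₁ e = separated d j e (retired-fresh (c (π d ⟨$⟩ʳ j)) cπj)
      ... | inj₂ e = ¬hit (d , j , is-complete current e , is-complete fresh (retired-fresh (c (π d ⟨$⟩ʳ j)) cπj))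
      few-done″ : # done c″ < q
      few-done″ = ≰⇒> λ large →
        let d , j , j-done , πj-fresh = linked (is done ∘ c″) (is fresh ∘ c″) large
              (≤-trans fresh-large (≤-reflexive (≡-sym (#-retire-fresh c))))
        in separated″ d j (is-sound done (c″ j) j-done) (is-sound fresh (c″ (π d ⟨$⟩ʳ j)) πj-fresh)
      total : # done c + (# current c + # fresh c) ≡ # done c″ + (# current c″ + # fresh c″)
      total = trans (≡-sym (+-assoc (# done c) _ _)) (≡-sym (cong₂ _+_ (#-retire-done c)
        (cong₂ _+_ (#-retire-current c) (#-retire-fresh c))))
      ex″ : Exploration X c″ j₀
      ex″ = record
        { alive₀    = alive₀
        ; alive     = λ j ¬dead → alive j (λ e → ¬dead (retired-dead (c j) e))
        ; reached   = λ j e → contradiction e (not-current (c j))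
        ; separated = separated″
        ; few-done  = few-done″
        ; enough    = subst (3 * q ≤_) total enough
        }
      some-fresh : ∃ λ w → is fresh (c w) ≡ true
      some-fresh = member (is fresh ∘ c) (≤-trans (≤-trans (s≤s z≤n) few-done) fresh-large)
      w = proj₁ some-fresh
      cw : c w ≡ fresh
      cw = is-sound fresh (c w) (proj₂ some-fresh)
      c″w : c″ w ≡ fresh
      c″w = cong retire cw
      alive-w : Alive X w
      alive-w = alive w (λ e → contradiction (trans (≡-sym cw) e) λ ())
      reach : ∀ i → assign w current c″ i ≡ current → Walk X (center w) (center i)
      reach i ci with w FinP.≟ i
      ... | yes refl = []
      ... | no  _    = contradiction ci (not-current (c i))
      descend : ∀ m → # fresh c ≤ m → Result
      descend m b with subst (_≤ m) (fresh-decreases {c″} {w} c″w) (subst (_≤ m) (≡-sym (#-retire-fresh c)) b)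
      descend (suc m) b | s≤s b′ = explore m (assign w current c″) w b′
        (pick-fresh c″w alive-w ex″ w alive-w reach)

  kill : List Node → Fin (q + 3 * q) → Status
  kill []      = λ _ → fresh
  kill (u ∷ X) = assign (block u) dead (kill X)

  kill-alive : ∀ X j → kill X j ≢ dead → Alive X j
  kill-alive (v ∷ X) j ¬dead (here refl) eq =
    ¬dead (cong (if_then dead else kill X j) (dec-true (block v FinP.≟ j) eq))
  kill-alive (v ∷ X) j ¬dead (there u∈) with block v FinP.≟ j
  ... | yes _ = contradiction refl ¬dead
  ... | no  _ = kill-alive X j ¬dead u∈

  kill-status : ∀ X j → kill X j ≡ dead ⊎ kill X j ≡ fresh
  kill-status []      j = inj₂ refl
  kill-status (u ∷ X) j with block u FinP.≟ j
  ... | yes _ = inj₁ refl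
  ... | no  _ = kill-status X j

  #-kill-dead : ∀ X → # dead (kill X) ≤ length X
  #-kill-dead []      = ≤-reflexive (#-none {q + 3 * q})
    where
    #-none : ∀ {n} → # {n} dead (λ _ → fresh) ≡ 0
    #-none {zero}  = refl
    #-none {suc n} = #-none {n}
  #-kill-dead (u ∷ X) = ≤-trans (m≤m+n _ _) (≤-trans (≤-reflexive (#-assign (block u) dead (kill X) dead))
    (≤-trans (+-monoˡ-≤ 1 (#-kill-dead X)) (≤-reflexive (+-comm (length X) 1))))

  #-zero : ∀ {n} s (c : Fin n → Status) → (∀ j → c j ≢ s) → # s c ≡ 0
  #-zero {zero}  s c none = refl
  #-zero {suc n} s c none with is s (c zero) in eq
  ... | true  = contradiction (is-sound s (c zero) eq) (none zero)
  ... | false = #-zero s (c ∘ suc) (none ∘ suc)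

  haven : ∀ {k} → suc k ≤ q → Haven k
  haven {k} k<q = record
    { Safe = Safe ; safe = find ; antitone = antitone ; avoids = proj₁ ; connect = connect }
    where
    find : ∀ X → length X ≤ suc k → ∃ (Safe X)
    find X len = explore (# fresh c) c w ≤-refl (record
      { alive₀    = kill-alive X w (λ e → contradiction (trans (≡-sym cw) e) λ ())
      ; alive     = kill-alive X
      ; reached   = λ j e → contradiction e (not-current j)
      ; separated = λ d j e → contradiction e (not-done j)
      ; few-done  = subst (_< q) (≡-sym no-done) (≤-trans (s≤s z≤n) k<q)
      ; enough    = enough
      })
      where
      c = kill X
      not-current : ∀ j → c j ≢ current
      not-current j e with kill-status X j
      ... | inj₁ f = contradiction (trans (≡-sym f) e) λ ()
      ... | inj₂ f = contradiction (trans (≡-sym f) e) λ ()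
      not-done : ∀ j → c j ≢ done
      not-done j e with kill-status X j
      ... | inj₁ f = contradiction (trans (≡-sym f) e) λ ()
      ... | inj₂ f = contradiction (trans (≡-sym f) e) λ ()
      no-done : # done c ≡ 0
      no-done = #-zero done c not-done
      enough : 3 * q ≤ # done c + (# current c + # fresh c)
      enough = +-cancelˡ-≤ q _ _ (begin
        q + 3 * q                                                  ≡⟨ status-total c ⟨
        # dead c + (# done c + (# current c + # fresh c))      ≤⟨ +-monoˡ-≤ _ (≤-trans (#-kill-dead X) (≤-trans len k<q)) ⟩
        q + (# done c + (# current c + # fresh c))              ∎)
        where open ≤-Reasoning
      fresh-exists : 0 < # fresh c
      fresh-exists = begin-strict
        0                                        <⟨ s≤s z≤n ⟩
        suc k                                    ≤⟨ k<q ⟩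
        q                                        ≤⟨ m≤m+n q _ ⟩
        3 * q                                    ≤⟨ enough ⟩
        # done c + (# current c + # fresh c)  ≡⟨ cong₂ (λ a b → a + (b + # fresh c)) no-done (#-zero current c not-current) ⟩
        # fresh c                               ∎
        where open ≤-Reasoning
      w = proj₁ (member (is fresh ∘ c) fresh-exists)
      cw : c w ≡ fresh
      cw = is-sound fresh (c w) (proj₂ (member (is fresh ∘ c) fresh-exists))

-- Non-isomorphism

⊕-false : ∀ n → ⊕ {n} (λ _ → false) ≡ false
⊕-false zero    = refl
⊕-false (suc n) = ⊕-false n

⊕-indicator : ∀ {n} (x : Fin n) → ⊕ (λ y → does (x FinP.≟ y)) ≡ true
⊕-indicator {suc n} zero    = cong not (⊕-false n)
⊕-indicator {suc n} (suc x) = ⊕-indicator x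

module Parity (N P : ℕ) (ρ : Fin 3 → Permutation′ N) where
  open CFI N P ρ

  -- Every edge has one end on each side, so both sides see the same total.
  ∂-balanced : ∀ F → ⊕ (λ x → ∂ F (false , x)) ≡ ⊕ (λ y → ∂ F (true , y))
  ∂-balanced F = trans (split (λ i x → F (i , x)))
    (trans (cong₂ _xor_ (cong₂ _xor_ (moved zero) (moved (suc zero))) (moved (suc (suc zero))))
    (≡-sym (split (λ i y → F (i , ρ i ⟨$⟩ˡ y)))))
    where
    split : (f : Fin 3 → Fin N → Bool) →
      ⊕ (λ x → (f zero x xor f (suc zero) x) xor f (suc (suc zero)) x)
        ≡ (⊕ (f zero) xor ⊕ (f (suc zero))) xor ⊕ (f (suc (suc zero)))
    split f = trans (⊕-xor (λ x → f zero x xor f (suc zero) x) (f (suc (suc zero))))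
      (cong (_xor ⊕ (f (suc (suc zero)))) (⊕-xor (f zero) (f (suc zero))))
    moved : ∀ i → ⊕ (λ x → F (i , x)) ≡ ⊕ (λ y → F (i , ρ i ⟨$⟩ˡ y))
    moved i = ⊕-permute (λ x → F (i , x)) (Perm.flip (ρ i))

  -- `δ t` has odd total on the side of `t` and even total on the other, against `∂-balanced`.
  ∂≢δ : ∀ F t → ¬ (∀ u → ∂ F u ≡ δ t u)
  ∂≢δ F (s , x) eq = go s x (trans (≡-sym (⊕-cong (λ y → eq (false , y)))) (trans (∂-balanced F) (⊕-cong (λ y → eq (true , y)))))
    where
    go : ∀ s x → ⊕ (λ y → δ (s , x) (false , y)) ≢ ⊕ (λ y → δ (s , x) (true , y))
    go false x eq = contradiction (trans (≡-sym (⊕-indicator x)) (trans eq (⊕-false N))) λ ()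
    go true  x eq = contradiction (trans (≡-sym (⊕-indicator x)) (trans (≡-sym eq) (⊕-false N))) λ ()

-- Gadgets and the zero section under isomorphism

module Rigidity (N P₃ : ℕ) (ρ : Fin 3 → Permutation′ N) where
  open CFI N (3 + P₃) ρ

  end : Bool → Fin (3 + P₃)
  end false = zero
  end true  = fromℕ (2 + P₃)

  toℕ-end : ∀ s → toℕ (end s) ≡ endpos s
  toℕ-end false = refl
  toℕ-end true  = FinP.toℕ-fromℕ (2 + P₃)

  endpos-injective : ∀ s s′ → endpos s ≡ endpos s′ → s ≡ s′
  endpos-injective false false _ = refl
  endpos-injective true  true  _ = refl

  port : ∀ u i → proj₁ (edgeAt u i) ≡ i
  port (false , _) i = refl
  port (true  , _) i = refl

  attach : ∀ tw u i a b → Adj tw (st u a b) (pt (edgeAt u i) (end (proj₁ u)) (val tw u i a b))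
  attach tw u i a b = (≡-sym (trans (cong (endnode (edgeAt u i)) refl) (endnode-edgeAt u i)) , toℕ-end (proj₁ u)) ,
    cong (λ j → val tw u j a b) (port u i)

  -- The path position determines the side, because the first and the last position of a path
  -- differ; edge and side determine the node.
  same-node : ∀ tw tw′ {u u′ a b a′ b′ e p c c′} →
    Adj tw (st u a b) (pt e p c) → Adj tw′ (st u′ a′ b′) (pt e p c′) → u ≡ u′
  same-node tw tw′ {u} {u′} {e = e} ((eq , pos) , _) ((eq′ , pos′) , _) =
    trans eq (trans (cong (endnode e) (endpos-injective _ _ (trans (≡-sym pos) pos′))) (≡-sym eq′))

  Distinct : Vtx → Vtx → Vtx → Set
  Distinct x y z = x ≢ y × x ≢ z × y ≢ z

  Deg3 : (Node → Bool) → Vtx → Set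
  Deg3 tw x = ∃ λ y₁ → ∃ λ y₂ → ∃ λ y₃ → Distinct y₁ y₂ y₃ × Adj tw x y₁ × Adj tw x y₂ × Adj tw x y₃

  -- An isomorphism-invariant description of the gadget vertices.
  Branching : (Node → Bool) → Vtx → Set
  Branching tw x = Deg3 tw x × (∀ y → Adj tw x y → Deg3 tw y)

  bit₁ bit₂ : Vtx → Bool
  bit₁ (st u a b) = a
  bit₁ (pt e p c) = c
  bit₂ (st u a b) = b
  bit₂ (pt e p c) = c

  neighbour : ∀ s → Σ (Fin (3 + P₃)) λ p → suc (toℕ p) ≡ endpos s ⊎ suc (endpos s) ≡ toℕ p
  neighbour false = suc zero , inj₂ refl
  neighbour true  = inject₁ (fromℕ (suc P₃)) , inj₁ (cong suc (trans (FinP.toℕ-inject₁ _) (FinP.toℕ-fromℕ (suc P₃))))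

  path-neighbour : ∀ tw u e p c → Inc u e p → ∃ λ p′ → Adj tw (pt e p c) (pt e p′ c)
  path-neighbour tw u e p c (_ , pos) with neighbour (proj₁ u)
  ... | p′ , inj₁ q = p′ , refl , refl , inj₂ (trans q (≡-sym pos))
  ... | p′ , inj₂ q = p′ , refl , refl , inj₁ (trans (cong suc pos) q)

  -- Two of the four states share each port bit; at port 2 they differ in both stored bits. This
  -- gives a path end two gadget neighbours besides its neighbour on the path.
  twin : ∀ tw u i a b → ∃ λ a′ → ∃ λ b′ → st u a b ≢ st u a′ b′ × val tw u i a′ b′ ≡ val tw u i a b
  twin tw u zero             a b = a , not b , (λ eq → BoolP.not-¬ refl (cong bit₂ eq)) , refl
  twin tw u (suc zero)       a b = not a , b , (λ eq → BoolP.not-¬ refl (cong bit₁ eq)) , refl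
  twin tw u (suc (suc zero)) a b = not a , not b , (λ eq → BoolP.not-¬ refl (cong bit₁ eq)) , cong (_xor tw u) (BoolP.xor-annihilates-not a b)

  st-Branching : ∀ tw u a b → Branching tw (st u a b)
  st-Branching tw u a b = (_ , _ , _ ,
      ((λ eq → contradiction (trans (≡-sym (port u zero)) (trans (cong edge eq) (port u (suc zero)))) λ ())
      , (λ eq → contradiction (trans (≡-sym (port u zero)) (trans (cong edge eq) (port u (suc (suc zero))))) λ ())
      , (λ eq → contradiction (trans (≡-sym (port u (suc zero))) (trans (cong edge eq) (port u (suc (suc zero))))) λ ()))
    , attach tw u zero a b , attach tw u (suc zero) a b , attach tw u (suc (suc zero)) a b) , ends
    where
    edge : Vtx → Fin 3
    edge (st _ _ _) = zero
    edge (pt e _ _) = proj₁ e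
    ends : ∀ y → Adj tw (st u a b) y → Deg3 tw y
    ends (pt e p c) (inc , v) with twin tw u (proj₁ e) a b | path-neighbour tw u e p c inc
    ... | a′ , b′ , distinct , v′ | p′ , adj′ = st u a b , st u a′ b′ , pt e p′ c ,
      (distinct , (λ ()) , λ ()) , (inc , v) , (inc , trans v′ v) , adj′

  inner-¬Deg3 : ∀ tw e p c → toℕ p ≢ 0 → toℕ p ≢ 2 + P₃ → ¬ Deg3 tw (pt e p c)
  inner-¬Deg3 tw e p c p≢0 p≢last (y₁ , y₂ , y₃ , (d₁₂ , d₁₃ , d₂₃) , a₁ , a₂ , a₃) = go (look y₁ a₁) (look y₂ a₂) (look y₃ a₃)
    where
    Above Below : Vtx → Set
    Above y = ∃ λ p′ → y ≡ pt e p′ c × suc (toℕ p) ≡ toℕ p′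
    Below y = ∃ λ p′ → y ≡ pt e p′ c × suc (toℕ p′) ≡ toℕ p
    look : ∀ y → Adj tw (pt e p c) y → Above y ⊎ Below y
    look (st (false , _) _ _) ((_ , pos) , _) = contradiction pos p≢0
    look (st (true  , _) _ _) ((_ , pos) , _) = contradiction pos p≢last
    look (pt e p′ c) (refl , refl , inj₁ q) = inj₁ (p′ , refl , q)
    look (pt e p′ c) (refl , refl , inj₂ q) = inj₂ (p′ , refl , q)
    above : ∀ {y y′} → Above y → Above y′ → y ≡ y′
    above (_ , refl , q) (_ , refl , q′) = cong (λ p → pt e p c) (FinP.toℕ-injective (trans (≡-sym q) q′))
    below : ∀ {y y′} → Below y → Below y′ → y ≡ y′
    below (_ , refl , q) (_ , refl , q′) = cong (λ p → pt e p c) (FinP.toℕ-injective (suc-injective (trans q (≡-sym q′))))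
    go : _ → _ → _ → ⊥
    go (inj₁ p) (inj₁ q) _        = d₁₂ (above p q)
    go (inj₂ p) (inj₂ q) _        = d₁₂ (below p q)
    go (inj₁ p) (inj₂ q) (inj₁ r) = d₁₃ (above p r)
    go (inj₁ p) (inj₂ q) (inj₂ r) = d₂₃ (below q r)
    go (inj₂ p) (inj₁ q) (inj₂ r) = d₁₃ (below p r)
    go (inj₂ p) (inj₁ q) (inj₁ r) = d₂₃ (above q r)

  -- Inner path vertices have just two neighbours, and a path end has an inner neighbour because a
  -- path has at least three vertices.
  pt-¬Branching : ∀ tw e p c → ¬ Branching tw (pt e p c)
  pt-¬Branching tw e p c (deg , ends) with toℕ p ≟ 0 | toℕ p ≟ 2 + P₃
  ... | no p≢0 | no p≢last = inner-¬Deg3 tw e p c p≢0 p≢last deg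
  ... | yes p≡0 | _ = inner-¬Deg3 tw e (suc zero) c (λ ()) (λ ()) (ends _ (refl , refl , inj₁ (cong suc p≡0)))
  ... | no _ | yes p≡last = inner-¬Deg3 tw e p′ c (λ eq → contradiction (trans (≡-sym toℕ-p′) eq) λ ())
          (λ eq → contradiction (trans (≡-sym toℕ-p′) eq) λ e → contradiction (≡-sym e) 1+n≢n)
          (ends _ (refl , refl , inj₂ (trans (cong suc toℕ-p′) (≡-sym p≡last))))
    where
    p′ : Fin (3 + P₃)
    p′ = inject₁ (fromℕ (suc P₃))
    toℕ-p′ : toℕ p′ ≡ suc P₃
    toℕ-p′ = trans (FinP.toℕ-inject₁ (fromℕ (suc P₃))) (FinP.toℕ-fromℕ (suc P₃))

  does⇒ : ∀ {A B : Set} (a? : Dec A) (b? : Dec B) → does a? ≡ does b? → A → B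
  does⇒ a? (yes b) eq a = b
  does⇒ a? (no ¬b) eq a = contradiction (trans (≡-sym (dec-true a? a)) eq) λ ()

  record AdjIso (tw tw′ : Node → Bool) : Set where
    field
      to from : Vtx → Vtx
      to-from : ∀ y → to (from y) ≡ y
      from-to : ∀ x → from (to x) ≡ x
      Adj-to  : ∀ {x y} → Adj tw x y → Adj tw′ (to x) (to y)
      Adj-from : ∀ {x y} → Adj tw′ x y → Adj tw (from x) (from y)

  adjIso : ∀ {tw tw′} → Isomorphic (cfi tw) (cfi tw′) → AdjIso tw tw′
  adjIso {tw} {tw′} (f , pres) = record
    { to       = g
    ; from     = h
    ; to-from  = gh
    ; from-to  = λ x → trans (cong (dec ∘ Inverse.from f↔) (enc-dec _)) (trans (cong dec (Inverse.inverseʳ f↔ refl)) (dec-enc x))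
    ; Adj-to   = λ {x} {y} a → does⇒ (Adj? tw x y) (Adj? tw′ (g x) (g y)) (pres′ x y) a
    ; Adj-from = λ {x} {y} a → does⇒ (Adj? tw′ x y) (Adj? tw (h x) (h y))
        (≡-sym (trans (pres′ (h x) (h y)) (cong₂ (λ x y → does (Adj? tw′ x y)) (gh x) (gh y)))) a
    }
    where
    f↔ = ⤖⇒↔ f
    g h : Vtx → Vtx
    g x = dec (Bijection.to f (enc x))
    h y = dec (Inverse.from f↔ (enc y))
    gh : ∀ y → g (h y) ≡ y
    gh y = trans (cong (dec ∘ Bijection.to f) (enc-dec _)) (trans (cong dec (Inverse.inverseˡ f↔ refl)) (dec-enc y))
    pres′ : ∀ x y → does (Adj? tw x y) ≡ does (Adj? tw′ (g x) (g y))
    pres′ x y = trans (≡-sym (cong₂ (λ x y → does (Adj? tw x y)) (dec-enc x) (dec-enc y))) (pres (enc x) (enc y))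

  flip-iso : ∀ {tw tw′} → AdjIso tw tw′ → AdjIso tw′ tw
  flip-iso i = record
    { to = from ; from = to ; to-from = from-to ; from-to = to-from ; Adj-to = Adj-from ; Adj-from = Adj-to }
    where open AdjIso i

  module _ {tw tw′} (i : AdjIso tw tw′) where
    open AdjIso i

    to-injective : ∀ {x y} → to x ≡ to y → x ≡ y
    to-injective {x} {y} eq = trans (≡-sym (from-to x)) (trans (cong from eq) (from-to y))

    Deg3-to : ∀ {x} → Deg3 tw x → Deg3 tw′ (to x)
    Deg3-to (y₁ , y₂ , y₃ , (d₁₂ , d₁₃ , d₂₃) , a₁ , a₂ , a₃) = to y₁ , to y₂ , to y₃ ,
      (d₁₂ ∘ to-injective , d₁₃ ∘ to-injective , d₂₃ ∘ to-injective) , Adj-to a₁ , Adj-to a₂ , Adj-to a₃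

    Branching-to : ∀ {x} → Branching tw x → Branching tw′ (to x)
    Branching-to {x} (deg , ends) = Deg3-to deg , λ y a → subst (Deg3 tw′) (to-from y)
      (Deg3-to (ends (from y) (subst (λ x → Adj tw x (from y)) (from-to x) (Adj-from a))))

  IsSt : Vtx → Set
  IsSt (st _ _ _) = ⊤
  IsSt (pt _ _ _) = ⊥

  IsSt⇒Branching : ∀ tw x → IsSt x → Branching tw x
  IsSt⇒Branching tw (st u a b) _ = st-Branching tw u a b

  Branching⇒IsSt : ∀ tw x → Branching tw x → IsSt x
  Branching⇒IsSt tw (st u a b) _ = tt
  Branching⇒IsSt tw (pt e p c) b = pt-¬Branching tw e p c b

  -- The all-zero section of the untwisted graph, described by properties that
  -- survive isomorphism.
  Zero : Vtx → Set
  Zero (st u a b) = a ≡ false × b ≡ false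
  Zero (pt e p c) = c ≡ false

  val-zero : ∀ u i → val untwisted u i false false ≡ false
  val-zero u zero             = refl
  val-zero u (suc zero)       = refl
  val-zero u (suc (suc zero)) = refl

  module Section {tw} (i : AdjIso tw untwisted) where
    open AdjIso i using () renaming (to to h; from to g; Adj-to to Adj-h; Adj-from to Adj-g; to-from to hg; from-to to gh)

    -- The zero section pulled back along `h`. Since `h` may move gadgets and paths around,
    -- everything about `W` is derived from adjacency: it contains exactly one state of each gadget
    -- and keeps its bit along each path.
    W : Vtx → Set
    W y = Zero (h y)

    IsSt-h : ∀ y → IsSt y → IsSt (h y)
    IsSt-h y s = Branching⇒IsSt untwisted (h y) (Branching-to i (IsSt⇒Branching tw y s))

    IsSt-h⁻¹ : ∀ y → IsSt (h y) → IsSt y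
    IsSt-h⁻¹ y s = Branching⇒IsSt tw y (subst (Branching tw) (gh y)
      (Branching-to (flip-iso i) (IsSt⇒Branching untwisted (h y) s)))

    PtForm StForm : Vtx → Set
    PtForm x = ∃ λ e → ∃ λ p → ∃ λ c → x ≡ pt e p c
    StForm x = ∃ λ u → ∃ λ a → ∃ λ b → x ≡ st u a b

    pt-h : ∀ e p c → PtForm (h (pt e p c))
    pt-h e p c with h (pt e p c) in eq
    ... | pt e′ p′ c′ = e′ , p′ , c′ , refl
    ... | st u a b    = ⊥-elim (IsSt-h⁻¹ (pt e p c) (subst IsSt (≡-sym eq) tt))

    st-h : ∀ u a b → StForm (h (st u a b))
    st-h u a b with h (st u a b) in eq
    ... | st u′ a′ b′ = u′ , a′ , b′ , refl
    ... | pt e p c    = ⊥-elim (subst IsSt eq (IsSt-h (st u a b) tt))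

    W-port : ∀ {u a b e p c} → W (st u a b) → Adj tw (st u a b) (pt e p c) → W (pt e p c)
    W-port {u} {a} {b} {e} {p} {c} w adj = go (st-h u a b) (pt-h e p c)
      where
      go : StForm (h (st u a b)) → PtForm (h (pt e p c)) → W (pt e p c)
      go (u′ , a′ , b′ , eq) (e′ , p′ , c′ , eq′) with subst Zero eq w | subst₂ (Adj untwisted) eq eq′ (Adj-h adj)
      ... | refl , refl | _ , v = subst Zero (≡-sym eq′) (trans (≡-sym v) (val-zero u′ (proj₁ e′)))

    W-path : ∀ {e p c e′ p′ c′} → W (pt e p c) → Adj tw (pt e p c) (pt e′ p′ c′) → W (pt e′ p′ c′)
    W-path {e} {p} {c} {e′} {p′} {c′} w adj = go (pt-h e p c) (pt-h e′ p′ c′)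
      where
      go : PtForm (h (pt e p c)) → PtForm (h (pt e′ p′ c′)) → W (pt e′ p′ c′)
      go (_ , _ , _ , eq) (_ , _ , _ , eq′) with subst₂ (Adj untwisted) eq eq′ (Adj-h adj)
      ... | _ , c≡c′ , _ = subst Zero (≡-sym eq′) (trans (≡-sym c≡c′) (subst Zero eq w))

    pull : ∀ {u a b x} → Adj untwisted (st u a b) (h x) → ∃ λ v → ∃ λ a′ → ∃ λ b′ →
      Adj tw (st v a′ b′) x × h (st v a′ b′) ≡ st u a b
    pull {u} {a} {b} {x} adj with g (st u a b) in eq
    ... | st v a′ b′ = v , a′ , b′ , subst₂ (Adj tw) eq (gh x) (Adj-g adj) , trans (cong h (≡-sym eq)) (hg (st u a b))
    ... | pt e p c   = ⊥-elim (subst IsSt eq (Branching⇒IsSt tw _ (Branching-to (flip-iso i) (st-Branching untwisted u a b))))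

    -- In the untwisted graph the zero state of a gadget is adjacent to every zero copy at its
    -- ports. Its preimage is the state sought.
    W-state : ∀ {e p c u a b} → W (pt e p c) → Adj tw (st u a b) (pt e p c) →
      ∃ λ v → ∃ λ a′ → ∃ λ b′ → W (st v a′ b′) × Adj tw (st v a′ b′) (pt e p c)
    W-state {e} {p} {c} {u} {a} {b} w adj = go (pt-h e p c) (st-h u a b)
      where
      go : PtForm (h (pt e p c)) → StForm (h (st u a b)) →
        ∃ λ v → ∃ λ a′ → ∃ λ b′ → W (st v a′ b′) × Adj tw (st v a′ b′) (pt e p c)
      go (e′ , p′ , c′ , eq) (u′ , a′ , b′ , eq′) with subst₂ (Adj untwisted) eq′ eq (Adj-h adj) | subst Zero eq w
      ... | (inc , _) | refl with pull {u′} {false} {false} (subst (Adj untwisted (st u′ false false)) (≡-sym eq) (inc , val-zero u′ (proj₁ e′)))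
      ...   | v , a″ , b″ , adj″ , eq″ = v , a″ , b″ , subst Zero (≡-sym eq″) (refl , refl) , adj″

    -- Both images are zero states, and the common neighbour forces them into the same gadget.
    W-unique : ∀ {e p c u a b u′ a′ b′} → W (st u a b) → W (st u′ a′ b′) →
      Adj tw (st u a b) (pt e p c) → Adj tw (st u′ a′ b′) (pt e p c) → st u a b ≡ st u′ a′ b′
    W-unique {e} {p} {c} {u} {a} {b} {u′} {a′} {b′} w w′ adj adj′ =
      to-injective i (go (st-h u a b) (st-h u′ a′ b′) (pt-h e p c))
      where
      go : StForm (h (st u a b)) → StForm (h (st u′ a′ b′)) → PtForm (h (pt e p c)) → h (st u a b) ≡ h (st u′ a′ b′)
      go (v , x , y , eq) (v′ , x′ , y′ , eq′) (_ , _ , _ , eq″) with subst Zero eq w | subst Zero eq′ w′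
      ... | refl , refl | refl , refl = trans eq (trans (cong (λ v → st v false false)
        (same-node untwisted untwisted (subst₂ (Adj untwisted) eq eq″ (Adj-h adj)) (subst₂ (Adj untwisted) eq′ eq″ (Adj-h adj′))))
        (≡-sym eq′))

    -- The three port bits of an untwisted gadget have even parity, so they are not all `true`.
    zero-port : ∀ u a b → ∃ λ j → val untwisted u j a b ≡ false
    zero-port u false b     = zero , refl
    zero-port u true  false = suc zero , refl
    zero-port u true  true  = suc (suc zero) , refl

    abstract
      -- The image of some state of `u` has a port reading zero, where it shares a neighbour with
      -- the zero state of its gadget. Pulled back, that zero state shares a neighbour with a state
      -- of `u`, and so belongs to `u`.
      W-exists : ∀ u → ∃ λ a → ∃ λ b → W (st u a b)
      W-exists u with st-h u false false
      ... | u′ , a′ , b′ , eq with zero-port u′ a′ b′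
      ...   | j , v = found (pull {u′} {false} {false} (subst (Adj untwisted (st u′ false false)) (≡-sym (hg y)) zero-adj))
        where
        y : Vtx
        y = pt (edgeAt u′ j) (end (proj₁ u′)) false
        zero-adj : Adj untwisted (st u′ false false) y
        zero-adj = proj₁ (attach untwisted u′ j false false) , val-zero u′ (proj₁ (edgeAt u′ j))
        old-adj : Adj tw (st u false false) (g y)
        old-adj = subst (λ x → Adj tw x (g y)) (trans (cong g (≡-sym eq)) (gh _))
          (Adj-g {st u′ a′ b′} {y} (proj₁ (attach untwisted u′ j a′ b′) , trans (cong (λ j → val untwisted u′ j a′ b′) (port u′ j)) v))
        found : (∃ λ v → ∃ λ a → ∃ λ b → Adj tw (st v a b) (g y) × h (st v a b) ≡ st u′ false false) →
          ∃ λ a → ∃ λ b → W (st u a b)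
        found (v , a , b , adj , eq′) with g y | old-adj
        ... | pt e p c | old with same-node tw tw adj old
        ...   | refl = a , b , subst Zero (≡-sym eq′) (refl , refl)

    bits : Node → Bool × Bool
    bits u = proj₁ (W-exists u) , proj₁ (proj₂ (W-exists u))

    W-bits : ∀ u → W (st u (proj₁ (bits u)) (proj₂ (bits u)))
    W-bits u = proj₂ (proj₂ (W-exists u))

    reading : Node → Fin 3 → Bool
    reading u j = val tw u j (proj₁ (bits u)) (proj₂ (bits u))

    W-along : ∀ e c → W (pt e zero c) → ∀ p → W (pt e p c)
    W-along e c w = <-weakInduction (λ p → W (pt e p c)) w λ p wp →
      W-path wp (refl , refl , inj₁ (cong suc (FinP.toℕ-inject₁ p)))

    -- If both stored bits differ, their sum agrees. Hence any two states of a gadget have a common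
    -- neighbour, which is what `W-unique` asks for.
    common-port : ∀ u a b a′ b′ → ∃ λ j → val tw u j a b ≡ val tw u j a′ b′
    common-port u a b a′ b′ with a BoolP.≟ a′ | b BoolP.≟ b′
    ... | yes eq | _      = zero , eq
    ... | no  _  | yes eq = suc zero , eq
    ... | no  a≢ | no  b≢ = suc (suc zero) , cong (_xor tw u)
      (trans (cong₂ _xor_ (BoolP.¬-not a≢) (BoolP.¬-not b≢)) (BoolP.xor-annihilates-not a′ b′))

    preimage : ∀ u j c → ∃ λ a → ∃ λ b → val tw u j a b ≡ c
    preimage u zero             c = c , false , refl
    preimage u (suc zero)       c = false , c , refl
    preimage u (suc (suc zero)) c = c xor tw u , false ,
      trans (cong (_xor tw u) (xor-identityʳ (c xor tw u))) (xor-cancelʳ c (tw u))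

    reading-unique : ∀ u a b → W (st u a b) → ∀ j → val tw u j a b ≡ reading u j
    reading-unique u a b w j with common-port u a b (proj₁ (bits u)) (proj₂ (bits u))
    ... | i , eq = cong (λ x → val tw u j (bit₁ x) (bit₂ x)) (W-unique w (W-bits u)
      (attach tw u i a b) (subst (λ c → Adj tw (st u (proj₁ (bits u)) (proj₂ (bits u))) (pt (edgeAt u i) (end (proj₁ u)) c)) (≡-sym eq) (attach tw u i (proj₁ (bits u)) (proj₂ (bits u)))))

    -- Membership in `W` travels along the path with a constant bit. At the far end some state reads
    -- this bit, so `W-state` yields one in `W`, and uniqueness identifies it with the chosen state
    -- there.
    reading-ends : ∀ e → reading (endnode e false) (proj₁ e) ≡ reading (endnode e true) (proj₁ e)
    reading-ends e = arrive (W-state arrived (proj₂ (proj₂ arrival)))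
      where
      c = reading (endnode e false) (proj₁ e)
      arrived : W (pt e (end true) c)
      arrived = W-along e c (W-port (W-bits (endnode e false)) (attach tw (endnode e false) (proj₁ e) _ _)) (end true)
      arrival : ∃ λ a → ∃ λ b → Adj tw (st (endnode e true) a b) (pt e (end true) c)
      arrival = let a , b , v = preimage (endnode e true) (proj₁ e) c in a , b , (refl , toℕ-end true) , v
      arrive : (∃ λ v → ∃ λ a → ∃ λ b → W (st v a b) × Adj tw (st v a b) (pt e (end true) c)) →
        c ≡ reading (endnode e true) (proj₁ e)
      arrive (v , a , b , w , adj) with same-node tw tw adj (proj₂ (proj₂ arrival))
      ... | refl = trans (≡-sym (proj₂ adj)) (reading-unique _ a b w (proj₁ e))

    assignment : Flip
    assignment e = reading (endnode e false) (proj₁ e)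

    reading-assignment : ∀ u j → reading u j ≡ assignment (edgeAt u j)
    reading-assignment (false , x) j = refl
    reading-assignment (true  , y) j = trans (cong (λ y → reading (true , y) j) (≡-sym (Perm.inverseʳ (ρ j))))
      (≡-sym (reading-ends (j , ρ j ⟨$⟩ˡ y)))

    ∂-assignment : ∀ u → ∂ assignment u ≡ tw u
    ∂-assignment u = trans (≡-sym (cong₂ _xor_ (cong₂ _xor_ (reading-assignment u zero) (reading-assignment u (suc zero)))
        (reading-assignment u (suc (suc zero)))))
      (trans (≡-sym (xor-assoc s s (tw u))) (cong (_xor tw u) (xor-same s)))
      where
      s = proj₁ (bits u) xor proj₂ (bits u)

  not-isomorphic : ∀ t → ¬ Isomorphic (cfi untwisted) (cfi (δ t))
  not-isomorphic t iso = Parity.∂≢δ N (3 + P₃) ρ assignment t ∂-assignment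
    where open Section (flip-iso (adjIso iso))

-- Contraction sequences

lookup-injective : ∀ {A : Set} {xs : List A} → Unique xs → ∀ i j → List.lookup xs i ≡ List.lookup xs j → i ≡ j
lookup-injective (_ ∷ _)  zero    zero    _  = refl
lookup-injective (x≢ ∷ _) zero    (suc j) eq = contradiction eq (All.lookup x≢ (∈-lookup j))
lookup-injective (x≢ ∷ _) (suc i) zero    eq = contradiction (≡-sym eq) (All.lookup x≢ (∈-lookup i))
lookup-injective (_ ∷ u)  (suc i) (suc j) eq = cong suc (lookup-injective u i j eq)

module Contraction (G : Graph) {K : Set} (_≟ᴷ_ : DecidableEquality K) where

  Labelling : Set
  Labelling = V G → K

  RedL : Labelling → K → K → Set
  RedL κ U W = U ≢ W
    × (∃[ u ] ∃[ w ] (κ u ≡ U × κ w ≡ W × adj G u w ≡ true))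
    × (∃[ u ] ∃[ w ] (κ u ≡ U × κ w ≡ W × adj G u w ≡ false))

  -- A covering list bounds the red degree without counting; it may hold repetitions and parts that
  -- are not red neighbours.
  Narrow : ℕ → Labelling → Set
  Narrow d κ = ∀ U → ∃ λ l → length l ≤ d × (∀ W → RedL κ U W → W ∈ l)

  relabel : K → K → K → K
  relabel a b x = if does (a ≟ᴷ x) then b else x

  relabel-same : ∀ a b → relabel a b a ≡ b
  relabel-same a b = cong (if_then b else a) (dec-true (a ≟ᴷ a) refl)

  relabel-other : ∀ {a x} b → a ≢ x → relabel a b x ≡ x
  relabel-other {a} {x} b a≢x = cong (if_then b else x) (dec-false (a ≟ᴷ x) a≢x)

  -- A step may be void: it may rename a part, move an empty one, or have `a` equal to `b`. Chains
  -- can thus be written down without knowing which labels occur.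
  data Chain (d : ℕ) (κ κ′ : Labelling) : Set where
    stop : κ ≗ κ′ → Chain d κ κ′
    next : ∀ a b κ₁ → κ₁ ≗ relabel a b ∘ κ → Narrow d κ₁ → Chain d κ₁ κ′ → Chain d κ κ′

  SameKernel : ∀ {p} → (V G → Fin p) → Labelling → Set
  SameKernel lab κ = ∀ x y → lab x ≡ lab y ⇔ κ x ≡ κ y

  Onto : ∀ {p} → (V G → Fin p) → Set
  Onto lab = ∀ c → ∃ λ x → lab x ≡ c

  narrow⇒redDeg : ∀ {d κ p} {lab : V G → Fin p} → SameKernel lab κ → Onto lab → Narrow d κ →
    ∀ U → redDeg G lab U ≤ d
  narrow⇒redDeg {d} {κ} {p} {lab} ker onto narrow U = ≤-trans (FinP.injective⇒≤ {f = place} place-injective) short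
    where
    rep : Fin p → V G
    rep c = proj₁ (onto c)
    lab-rep : ∀ c → lab (rep c) ≡ c
    lab-rep c = proj₂ (onto c)
    l = proj₁ (narrow (κ (rep U)))
    short = proj₁ (proj₂ (narrow (κ (rep U))))
    to-κ : ∀ c x → lab x ≡ c → κ x ≡ κ (rep c)
    to-κ c x eq = Equivalence.to (ker x (rep c)) (trans eq (≡-sym (lab-rep c)))
    red⇒∈ : ∀ W → Red G lab U W → κ (rep W) ∈ l
    red⇒∈ W (U≢W , (u , w , u∈ , w∈ , adj-uw) , (u′ , w′ , u′∈ , w′∈ , adj-uw′)) =
      proj₂ (proj₂ (narrow (κ (rep U)))) (κ (rep W))
        ( (λ eq → U≢W (trans (≡-sym (lab-rep U)) (trans (Equivalence.from (ker (rep U) (rep W)) eq) (lab-rep W))))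
        , (u , w , to-κ U u u∈ , to-κ W w w∈ , adj-uw)
        , (u′ , w′ , to-κ U u′ u′∈ , to-κ W w′ w′∈ , adj-uw′))
    reds = filter (red? G lab U) (allFin p)
    unique : Unique reds
    unique = UniqueP.filter⁺ (red? G lab U) (UniqueP.allFin⁺ p)
    red-at : ∀ i → κ (rep (List.lookup reds i)) ∈ l
    red-at i = red⇒∈ _ (proj₂ (∈-filter⁻ (red? G lab U) {xs = allFin p} (∈-lookup i)))
    place : Fin (length reds) → Fin (length l)
    place i = Any.index (red-at i)
    place-injective : ∀ {i j} → place i ≡ place j → i ≡ j
    place-injective {i} {j} eq = lookup-injective unique i j (trans (≡-sym (lab-rep _)) (trans
      (Equivalence.from (ker _ _) (trans (AnyP.lookup-index (red-at i))
        (trans (cong (List.lookup l) eq) (≡-sym (AnyP.lookup-index (red-at j))))))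
      (lab-rep _)))

  module _ {p : ℕ} (A B : Fin (suc (suc p))) (A≢B : A ≢ B) where

    -- Removes `A` from the numbering and gives its part the number of `B`.
    merge₂ : Fin (suc (suc p)) → Fin (suc p)
    merge₂ c with A FinP.≟ c
    ... | yes _   = punchOut A≢B
    ... | no  A≢c = punchOut A≢c

    merge₂-onto : ∀ e → merge₂ (punchIn A e) ≡ e
    merge₂-onto e with A FinP.≟ punchIn A e
    ... | yes eq  = contradiction (≡-sym eq) (FinP.punchInᵢ≢i A e)
    ... | no  A≢c = trans (FinP.punchOut-cong A refl) (FinP.punchOut-punchIn A)

    Merged : Fin (suc (suc p)) → Fin (suc (suc p)) → Set
    Merged c d = c ≡ d ⊎ (c ≡ A × d ≡ B) ⊎ (c ≡ B × d ≡ A)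

    merge₂-kernel : ∀ c d → merge₂ c ≡ merge₂ d ⇔ Merged c d
    merge₂-kernel c d = mk⇔ (to c d) (from c d)
      where
      to : ∀ c d → merge₂ c ≡ merge₂ d → Merged c d
      to c d eq with A FinP.≟ c | A FinP.≟ d
      ... | yes p | yes q = inj₁ (trans (≡-sym p) q)
      ... | yes p | no  q = inj₂ (inj₁ (≡-sym p , ≡-sym (FinP.punchOut-injective A≢B q eq)))
      ... | no  p | yes q = inj₂ (inj₂ (FinP.punchOut-injective p A≢B eq , ≡-sym q))
      ... | no  p | no  q = inj₁ (FinP.punchOut-injective p q eq)
      AB : merge₂ A ≡ merge₂ B
      AB with A FinP.≟ A | A FinP.≟ B
      ... | yes _ | yes q = contradiction q A≢B
      ... | yes _ | no  q = FinP.punchOut-cong A refl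
      ... | no  p | _     = contradiction refl p
      from : ∀ c d → Merged c d → merge₂ c ≡ merge₂ d
      from c d (inj₁ refl) = refl
      from c d (inj₂ (inj₁ (refl , refl))) = AB
      from c d (inj₂ (inj₂ (refl , refl))) = ≡-sym AB

  -- A partition sequence from `lab` down to one part, indexed by the number of parts and not by the
  -- steps of a chain, some of which may be void.
  record Prefix (d p : ℕ) (lab : V G → Fin (suc p)) : Set where
    field
      parts : (i : ℕ) → V G → Fin (suc i)
      onto  : ∀ i → i ≤ p → Onto (parts i)
      step  : ∀ i → i < p → MergeOf G (parts (suc i)) (parts i)
      width : ∀ i → i ≤ p → ∀ U → redDeg G (parts i) U ≤ d
      last  : parts p ≡ lab

  trivial-prefix : ∀ {d lab} → Onto lab → (∀ U → redDeg G lab U ≤ d) → Prefix d zero lab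
  trivial-prefix {d} {lab} onto width = record
    { parts = λ { zero → lab ; (suc i) _ → zero }
    ; onto  = λ { zero _ → onto }
    ; step  = λ _ ()
    ; width = λ { zero _ → width }
    ; last  = refl
    }

  extend-prefix : ∀ {d p lab lab′} → Onto lab′ → (∀ U → redDeg G lab′ U ≤ d) → MergeOf G lab′ lab →
    Prefix d p lab → Prefix d (suc p) lab′
  extend-prefix {d} {p} {lab} {lab′} onto′ width′ merge pre = record
    { parts = parts′
    ; onto  = onto″
    ; step  = step″
    ; width = width″
    ; last  = parts-top
    }
    where
    open Prefix pre
    parts′ : (i : ℕ) → V G → Fin (suc i)
    parts′ i with i ≟ suc p
    ... | yes refl = lab′
    ... | no  _    = parts i
    parts-top : parts′ (suc p) ≡ lab′
    parts-top with suc p ≟ suc p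
    ... | yes refl = refl
    ... | no  ne   = contradiction refl ne
    parts-below : ∀ i → i ≤ p → parts′ i ≡ parts i
    parts-below i i≤p with i ≟ suc p
    ... | yes refl = contradiction i≤p 1+n≰n
    ... | no  _    = refl
    onto″ : ∀ i → i ≤ suc p → Onto (parts′ i)
    onto″ i i≤ with m≤n⇒m<n∨m≡n i≤
    ... | inj₁ (s≤s i≤p) = subst Onto (≡-sym (parts-below i i≤p)) (onto i i≤p)
    ... | inj₂ refl      = subst Onto (≡-sym parts-top) onto′
    width″ : ∀ i → i ≤ suc p → ∀ U → redDeg G (parts′ i) U ≤ d
    width″ i i≤ with m≤n⇒m<n∨m≡n i≤
    ... | inj₁ (s≤s i≤p) = subst (λ f → ∀ U → redDeg G f U ≤ d) (≡-sym (parts-below i i≤p)) (width i i≤p)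
    ... | inj₂ refl      = subst (λ f → ∀ U → redDeg G f U ≤ d) (≡-sym parts-top) width′
    step″ : ∀ i → i < suc p → MergeOf G (parts′ (suc i)) (parts′ i)
    step″ i (s≤s i≤p) with m≤n⇒m<n∨m≡n i≤p
    ... | inj₁ i<p  = subst₂ (MergeOf G) (≡-sym (parts-below (suc i) i<p)) (≡-sym (parts-below i i≤p)) (step i i<p)
    ... | inj₂ refl = subst₂ (MergeOf G) (≡-sym parts-top) (≡-sym (trans (parts-below p ≤-refl) last)) merge

  relabel-kernel : ∀ a b x y → relabel a b x ≡ relabel a b y → x ≡ y ⊎ (x ≡ a × y ≡ b) ⊎ (x ≡ b × y ≡ a)
  relabel-kernel a b x y eq with a ≟ᴷ x | a ≟ᴷ y
  ... | yes refl | yes refl = inj₁ refl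
  ... | yes refl | no  _    = inj₂ (inj₁ (refl , ≡-sym eq))
  ... | no  _    | yes refl = inj₂ (inj₂ (eq , refl))
  ... | no  _    | no  _    = inj₁ eq

  relabel-merges : ∀ a b → relabel a b a ≡ relabel a b b
  relabel-merges a b with a ≟ᴷ b
  ... | yes refl = relabel-same a b
  ... | no  _    = relabel-same a b

  -- Recursion on the chain. A void step leaves the kernel, and with it the numbering `lab`, as it
  -- is; a genuine merge lowers `p` by one. At the end a constant labelling admits only one part.
  build : ∀ {d κ κ′} p (lab : V G → Fin (suc p)) → SameKernel lab κ → Onto lab → Narrow d κ →
    (∀ x y → κ′ x ≡ κ′ y) → Chain d κ κ′ → Prefix d p lab
  build zero lab ker onto narrow const (stop eq) = trivial-prefix onto (narrow⇒redDeg ker onto narrow)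
  build (suc p) lab ker onto narrow const (stop eq) = contradiction
    (trans (≡-sym (proj₂ (onto zero))) (trans (Equivalence.from (ker x₀ x₁)
      (trans (eq x₀) (trans (const x₀ x₁) (≡-sym (eq x₁))))) (proj₂ (onto (suc zero))))) λ ()
    where
    x₀ = proj₁ (onto zero)
    x₁ = proj₁ (onto (suc zero))
  build {d} {κ} {κ′} p lab ker onto narrow const (next a b κ₁ eq narrow₁ chain)
    with FinP.any? (λ x → κ x ≟ᴷ a) | FinP.any? (λ x → κ x ≟ᴷ b)
  ... | no ¬a | _ = build p lab ker₁ onto narrow₁ const chain
    where
    κ₁≗κ : κ₁ ≗ κ
    κ₁≗κ x = trans (eq x) (relabel-other b (λ e → ¬a (x , ≡-sym e)))
    ker₁ : SameKernel lab κ₁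
    ker₁ x y = mk⇔ (λ e → trans (κ₁≗κ x) (trans (Equivalence.to (ker x y) e) (≡-sym (κ₁≗κ y))))
                   (λ e → Equivalence.from (ker x y) (trans (≡-sym (κ₁≗κ x)) (trans e (κ₁≗κ y))))
  ... | yes _ | no ¬b = build p lab ker₁ onto narrow₁ const chain
    where
    ker₁ : SameKernel lab κ₁
    ker₁ x y = mk⇔ (λ e → trans (eq x) (trans (cong (relabel a b) (Equivalence.to (ker x y) e)) (≡-sym (eq y)))) from
      where
      from : κ₁ x ≡ κ₁ y → lab x ≡ lab y
      from e with relabel-kernel a b (κ x) (κ y) (trans (≡-sym (eq x)) (trans e (eq y)))
      ... | inj₁ e′              = Equivalence.from (ker x y) e′
      ... | inj₂ (inj₁ (_ , e′)) = contradiction (y , e′) ¬b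
      ... | inj₂ (inj₂ (e′ , _)) = contradiction (x , e′) ¬b
  ... | yes (xa , ea) | yes (xb , eb) = go p lab ker onto (lab xa FinP.≟ lab xb)
    where
    go : ∀ p (lab : V G → Fin (suc p)) → SameKernel lab κ → Onto lab → Dec (lab xa ≡ lab xb) → Prefix d p lab
    go p lab ker onto (yes same) = build p lab ker₁ onto narrow₁ const chain
      where
      a≡b : a ≡ b
      a≡b = trans (≡-sym ea) (trans (Equivalence.to (ker xa xb) same) eb)
      ker₁ : SameKernel lab κ₁
      ker₁ x y = mk⇔ (λ e → trans (eq x) (trans (cong (relabel a b) (Equivalence.to (ker x y) e)) (≡-sym (eq y)))) from
        where
        from : κ₁ x ≡ κ₁ y → lab x ≡ lab y
        from e with relabel-kernel a b (κ x) (κ y) (trans (≡-sym (eq x)) (trans e (eq y)))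
        ... | inj₁ e′              = Equivalence.from (ker x y) e′
        ... | inj₂ (inj₁ (e₁ , e₂)) = Equivalence.from (ker x y) (trans e₁ (trans a≡b (≡-sym e₂)))
        ... | inj₂ (inj₂ (e₁ , e₂)) = Equivalence.from (ker x y) (trans e₁ (trans (≡-sym a≡b) (≡-sym e₂)))
    go zero lab ker onto (no diff) = contradiction (single (lab xa) (lab xb)) diff
      where
      single : (c d : Fin 1) → c ≡ d
      single zero zero = refl
    go (suc p) lab ker onto (no diff) = extend-prefix onto (narrow⇒redDeg ker onto narrow)
        (A , B , diff , λ x y → merge₂-kernel A B diff (lab x) (lab y))
        (build p lab₁ ker₁ onto₁ narrow₁ const chain)
      where
      A = lab xa
      B = lab xb
      lab₁ : V G → Fin (suc p)
      lab₁ = merge₂ A B diff ∘ lab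
      onto₁ : Onto lab₁
      onto₁ c = let x , e = onto (punchIn A c) in x , trans (cong (merge₂ A B diff) e) (merge₂-onto A B diff c)
      lab⇒κ : ∀ {x y c} → lab x ≡ lab y → κ y ≡ c → κ x ≡ c
      lab⇒κ e e′ = trans (Equivalence.to (ker _ _) e) e′
      κ⇒lab : ∀ {x y c} → κ x ≡ c → κ y ≡ c → lab x ≡ lab y
      κ⇒lab e e′ = Equivalence.from (ker _ _) (trans e (≡-sym e′))
      ker₁ : SameKernel lab₁ κ₁
      ker₁ x y = mk⇔ to from
        where
        to : lab₁ x ≡ lab₁ y → κ₁ x ≡ κ₁ y
        to e with Equivalence.to (merge₂-kernel A B diff (lab x) (lab y)) e
        ... | inj₁ e′ = trans (eq x) (trans (cong (relabel a b) (Equivalence.to (ker x y) e′)) (≡-sym (eq y)))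
        ... | inj₂ (inj₁ (e₁ , e₂)) = trans (eq x) (trans (cong (relabel a b) (lab⇒κ e₁ ea))
                (trans (relabel-merges a b) (trans (cong (relabel a b) (≡-sym (lab⇒κ e₂ eb))) (≡-sym (eq y)))))
        ... | inj₂ (inj₂ (e₁ , e₂)) = trans (eq x) (trans (cong (relabel a b) (lab⇒κ e₁ eb))
                (trans (≡-sym (relabel-merges a b)) (trans (cong (relabel a b) (≡-sym (lab⇒κ e₂ ea))) (≡-sym (eq y)))))
        from : κ₁ x ≡ κ₁ y → lab₁ x ≡ lab₁ y
        from e = Equivalence.from (merge₂-kernel A B diff (lab x) (lab y))
          (case-kernel (relabel-kernel a b (κ x) (κ y) (trans (≡-sym (eq x)) (trans e (eq y)))))
          where
          case-kernel : κ x ≡ κ y ⊎ (κ x ≡ a × κ y ≡ b) ⊎ (κ x ≡ b × κ y ≡ a) → Merged A B diff (lab x) (lab y)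
          case-kernel (inj₁ e′)               = inj₁ (Equivalence.from (ker x y) e′)
          case-kernel (inj₂ (inj₁ (e₁ , e₂))) = inj₂ (inj₁ (κ⇒lab e₁ ea , κ⇒lab e₂ eb))
          case-kernel (inj₂ (inj₂ (e₁ , e₂))) = inj₂ (inj₂ (κ⇒lab e₁ eb , κ⇒lab e₂ ea))

  contract : ∀ {d p} {κ κ′ : Labelling} → n G ≡ suc p → (∀ {x y} → κ x ≡ κ y → x ≡ y) → Narrow d κ →
    (∀ x y → κ′ x ≡ κ′ y) → Chain d κ κ′ → TwinWidthAtMost G d
  contract {d} {p} {κ} {κ′} size inj narrow const chain = S , λ i i<n → width i (below i<n)
    where
    lab : V G → Fin (suc p)
    lab = Fin.cast size
    cast-injective : ∀ {x y} → lab x ≡ lab y → x ≡ y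
    cast-injective {x} {y} e = trans (≡-sym (FinP.cast-involutive (≡-sym size) size x))
      (trans (cong (Fin.cast (≡-sym size)) e) (FinP.cast-involutive (≡-sym size) size y))
    open Prefix (build {d} {κ} {κ′} p lab (λ x y → mk⇔ (cong κ ∘ cast-injective) (cong lab ∘ inj))
      (λ c → Fin.cast (≡-sym size) c , FinP.cast-involutive size (≡-sym size) c) narrow const chain)
    below : ∀ {i} → i < n G → i ≤ p
    below i<n = s≤s⁻¹ (subst (_ <_) size i<n)
    S : PartitionSequence G
    S = record
      { seq        = parts
      ; surjective = λ i i<n c → let x , e = onto i (below i<n) c in x , λ { refl → e }
      ; singletons = λ i i≡ → λ {x} {y} → single i (suc-injective (trans i≡ size)) {x} {y}
      ; merge      = λ i i<n → step i (s≤s⁻¹ (subst (suc i <_) size i<n))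
      }
      where
      single : ∀ i → i ≡ p → ∀ {x y} → parts i x ≡ parts i y → x ≡ y
      single i refl {x} {y} e = cast-injective (trans (cong (λ f → f x) (≡-sym last)) (trans e (cong (λ f → f y) last)))

  _++ᶜ_ : ∀ {d κ κ′ κ″} → Chain d κ κ′ → Chain d κ′ κ″ → Chain d κ κ″
  stop eq ++ᶜ stop eq′ = stop λ x → trans (eq x) (eq′ x)
  stop eq ++ᶜ next a b κ₁ eq′ nar c = next a b κ₁ (λ x → trans (eq′ x) (cong (relabel a b) (≡-sym (eq x)))) nar c
  next a b κ₁ eq nar c ++ᶜ c′ = next a b κ₁ eq nar (c ++ᶜ c′)

  -- Passes that move many labels

  shift : (K → K) → (K → Bool) → K → K
  shift φ P k = if P k then φ k else k

  elem : List K → K → Bool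
  elem []       k = false
  elem (a ∷ as) k = does (a ≟ᴷ k) ∨ elem as k

  elem-complete : ∀ {as k} → k ∈ as → elem as k ≡ true
  elem-complete {a ∷ as} {k} (here refl) = cong (_∨ elem as k) (dec-true (a ≟ᴷ k) refl)
  elem-complete {a ∷ as} {k} (there k∈) = trans (cong (does (a ≟ᴷ k) ∨_) (elem-complete k∈)) (BoolP.∨-zeroʳ _)

  elem-sound : ∀ as k → elem as k ≡ true → k ∈ as
  elem-sound (a ∷ as) k eq with a ≟ᴷ k
  ... | yes refl = here refl
  ... | no  _    = there (elem-sound as k eq)

  -- A pass applies `φ` to the labels in `m` one at a time in arbitrary order, so narrowness is
  -- demanded for every subset `P` of `m`. Because `φ` leads out of `m`, no label moves twice.
  module _ {d} (κ : Labelling) (φ : K → K) (m : K → Bool)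
    (leaves : ∀ k → m k ≡ true → m (φ k) ≡ false)
    (narrow : ∀ P → (∀ k → P k ≡ true → m k ≡ true) → Narrow d (shift φ P ∘ κ)) where

    shift-cons : ∀ a as → (∀ k → k ∈ a ∷ as → m k ≡ true) → ∀ k →
      shift φ (elem (a ∷ as)) k ≡ relabel a (φ a) (shift φ (elem as) k)
    shift-cons a as sel k with a ≟ᴷ k
    ... | yes refl with elem as k
    ...   | true  = ≡-sym (relabel-other (φ k) λ e →
              contradiction (trans (≡-sym (sel k (here refl))) (trans (cong m e) (leaves k (sel k (here refl))))) λ ())
    ...   | false = ≡-sym (relabel-same k (φ k))
    shift-cons a as sel k | no a≢k with elem as k in eq
    ...   | true  = ≡-sym (relabel-other (φ a) λ e → contradiction (trans (≡-sym (sel a (here refl)))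
              (trans (cong m e) (leaves k (sel k (there (elem-sound as k eq)))))) λ ())
    ...   | false = ≡-sym (relabel-other (φ a) a≢k)

    pass-list : ∀ as → (∀ k → k ∈ as → m k ≡ true) → Chain d κ (shift φ (elem as) ∘ κ)
    pass-list []       sel = stop λ _ → refl
    pass-list (a ∷ as) sel = pass-list as (λ k k∈ → sel k (there k∈)) ++ᶜ
      next a (φ a) _ (λ x → shift-cons a as sel (κ x))
        (narrow (elem (a ∷ as)) (λ k e → sel k (elem-sound (a ∷ as) k e))) (stop λ _ → refl)

    pass : Chain d κ (shift φ m ∘ κ)
    pass = pass-list labels selected ++ᶜ stop λ x → cong (if_then φ (κ x) else κ x) (elem-labels x)
      where
      sel? = λ k → m k BoolP.≟ true
      labels = filter sel? (List.tabulate κ)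
      selected : ∀ k → k ∈ labels → m k ≡ true
      selected k k∈ = proj₂ (∈-filter⁻ sel? {xs = List.tabulate κ} k∈)
      elem-labels : ∀ x → elem labels (κ x) ≡ m (κ x)
      elem-labels x with m (κ x) in eq
      ... | true  = elem-complete (∈-filter⁺ sel? (∈-tabulate⁺ x) eq)
      ... | false with elem labels (κ x) in e
      ...   | false = refl
      ...   | true  = trans (≡-sym (selected (κ x) (elem-sound labels (κ x) e))) eq

-- Folding onto a binary tree

if-yes : ∀ {A B : Set} (a? : Dec A) {x y : B} → A → (if does a? then x else y) ≡ x
if-yes (yes _) a = refl
if-yes (no ¬a) a = contradiction a ¬a

if-no : ∀ {A B : Set} (a? : Dec A) {x y : B} → ¬ A → (if does a? then x else y) ≡ y
if-no (yes a) ¬a = contradiction a ¬a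
if-no (no _)  ¬a = refl

-- Saturates at the last position as `Fin.pred` does at the first; `Beside` excludes both cases.
successor : ∀ {n} → Fin (suc n) → Fin (suc n)
successor {zero}  p       = p
successor {suc n} zero    = suc zero
successor {suc n} (suc p) = suc (successor p)

successor-unique : ∀ {n} (p p′ : Fin (suc n)) → suc (toℕ p) ≡ toℕ p′ → successor p ≡ p′
successor-unique {suc n} zero    (suc zero) eq = refl
successor-unique {suc n} (suc p) (suc p′)   eq = cong suc (successor-unique p p′ (suc-injective eq))

pred-unique : ∀ {n} (p p′ : Fin (suc n)) → suc (toℕ p′) ≡ toℕ p → Fin.pred p ≡ p′
pred-unique (suc p) p′ eq = FinP.toℕ-injective (trans (FinP.toℕ-inject₁ p) (≡-sym (suc-injective eq)))

halves : ℕ → ℕ → ℕ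
halves zero    x = x
halves (suc k) x = ⌊ halves k x /2⌋

⌊/2⌋-cases : ∀ y → y ≡ 2 * ⌊ y /2⌋ ⊎ y ≡ suc (2 * ⌊ y /2⌋)
⌊/2⌋-cases zero          = inj₁ refl
⌊/2⌋-cases (suc zero)    = inj₂ refl
⌊/2⌋-cases (suc (suc y)) with ⌊/2⌋-cases y
... | inj₁ e = inj₁ (cong suc (trans (cong suc e) (≡-sym (+-suc ⌊ y /2⌋ _))))
... | inj₂ e = inj₂ (cong suc (trans (cong suc e) (cong suc (≡-sym (+-suc ⌊ y /2⌋ _)))))

⌊/2⌋-< : ∀ x m → x < 2 * m → ⌊ x /2⌋ < m
⌊/2⌋-< x m x<2m = *-cancelˡ-< 2 ⌊ x /2⌋ m (≤-trans (s≤s (twice≤ x)) x<2m)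
  where
  twice≤ : ∀ x → 2 * ⌊ x /2⌋ ≤ x
  twice≤ x with ⌊/2⌋-cases x
  ... | inj₁ e = ≤-reflexive (≡-sym e)
  ... | inj₂ e = ≤-trans (n≤1+n _) (≤-reflexive (≡-sym e))

halves-< : ∀ k L x → x < 2 ^ (k + L) → halves k x < 2 ^ L
halves-< zero    L x x< = x<
halves-< (suc k) L x x< = ⌊/2⌋-< (halves k x) (2 ^ L)
  (halves-< k (suc L) x (subst (λ z → x < 2 ^ z) (≡-sym (+-suc k L)) x<))

halves-top : ∀ L x → x < 2 ^ L → halves L x ≡ 0
halves-top L x x< = n<1⇒n≡0 (halves-< L 0 x (subst (λ z → x < 2 ^ z) (≡-sym (+-identityʳ L)) x<))

module TwinWidth (N P₃ L : ℕ) (P≡ : 3 + P₃ ≡ L + L) (ρ : Fin 3 → Permutation′ N)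
  (N-small : 2 * N ≤ 2 ^ L) (tw : Bool × Fin N → Bool) where

  open CFI N (3 + P₃) ρ
  open Rigidity N P₃ ρ using (end; toℕ-end; port; attach; endpos-injective)

  P : ℕ
  P = 3 + P₃

  -- Labels of parts: single vertices, half gadgets, single path vertices, path vertex
  -- pairs, and nodes (level, index) of the binary tree onto which the graph is folded.
  data K : Set where
    sv   : Node → Bool → Bool → K
    half : Node → Bool → K
    pv   : Edge → Fin P → Bool → K
    pp   : Edge → Fin P → K
    tr   : ℕ → ℕ → K

  _≟ᴷ_ : DecidableEquality K
  x ≟ᴷ y = map′ (λ eq → trans (≡-sym (retract x)) (trans (cong decode eq) (retract y))) (cong code) (code x ≟ᶜ code y)
    where
    Code : Set
    Code = (Node × Bool × Bool) ⊎ (Node × Bool) ⊎ (Edge × Fin P × Bool) ⊎ (Edge × Fin P) ⊎ (ℕ × ℕ)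
    _≟ᶜ_ : DecidableEquality Code
    _≟ᶜ_ = SumP.≡-dec (ProdP.≡-dec _≟ᴺ_ (ProdP.≡-dec BoolP._≟_ BoolP._≟_))
      (SumP.≡-dec (ProdP.≡-dec _≟ᴺ_ BoolP._≟_)
      (SumP.≡-dec (ProdP.≡-dec _≟ᴱ_ (ProdP.≡-dec FinP._≟_ BoolP._≟_))
      (SumP.≡-dec (ProdP.≡-dec _≟ᴱ_ FinP._≟_) (ProdP.≡-dec _≟_ _≟_))))
    code : K → Code
    code (sv u a b) = inj₁ (u , a , b)
    code (half u a) = inj₂ (inj₁ (u , a))
    code (pv e p c) = inj₂ (inj₂ (inj₁ (e , p , c)))
    code (pp e p)   = inj₂ (inj₂ (inj₂ (inj₁ (e , p))))
    code (tr k x)   = inj₂ (inj₂ (inj₂ (inj₂ (k , x))))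
    decode : Code → K
    decode (inj₁ (u , a , b))                 = sv u a b
    decode (inj₂ (inj₁ (u , a)))              = half u a
    decode (inj₂ (inj₂ (inj₁ (e , p , c))))   = pv e p c
    decode (inj₂ (inj₂ (inj₂ (inj₁ (e , p))))) = pp e p
    decode (inj₂ (inj₂ (inj₂ (inj₂ (k , x))))) = tr k x
    retract : ∀ x → decode (code x) ≡ x
    retract (sv u a b) = refl
    retract (half u a) = refl
    retract (pv e p c) = refl
    retract (pp e p)   = refl
    retract (tr k x)   = refl

  open Contraction (cfi tw) _≟ᴷ_

  -- Local criteria for red degree at most four

  Colouring : Set
  Colouring = Vtx → K

  -- The non-adjacent pair is passed on as a hypothesis for `half-class`, where a black edge has to
  -- be excluded.
  NarrowAt : Colouring → K → Set
  NarrowAt κ U = ∃ λ l → length l ≤ 4 × (∀ y x → κ x ≡ U → U ≢ κ y → Adj tw x y →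
    (∃ λ x′ → ∃ λ y′ → κ x′ ≡ U × κ y′ ≡ κ y × ¬ Adj tw x′ y′) → κ y ∈ l)

  NarrowAt⇒Narrow : ∀ κ → (∀ U → NarrowAt κ U) → Narrow 4 (κ ∘ dec)
  NarrowAt⇒Narrow κ nar U = let l , short , covers = nar U in l , short ,
    λ { W (U≢W , (u , w , u∈ , refl , a) , (u′ , w′ , u′∈ , w′∈ , a′)) →
      covers (dec w) (dec u) u∈ U≢W (does⇒ (Adj? tw (dec u) (dec w)) a)
        (dec u′ , dec w′ , u′∈ , w′∈ , ¬does⇒ (Adj? tw (dec u′) (dec w′)) a′) }
    where
    does⇒ : ∀ {A : Set} (a? : Dec A) → does a? ≡ true → A
    does⇒ (yes a) _ = a
    ¬does⇒ : ∀ {A : Set} (a? : Dec A) → does a? ≡ false → ¬ A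
    ¬does⇒ (no ¬a) _ = ¬a

  empty-class : ∀ {κ U} → (∀ x → κ x ≢ U) → NarrowAt κ U
  empty-class none = [] , z≤n , λ y x κx → contradiction κx (none x)

  pairs : (Bool → K) → (Bool → K) → List K
  pairs f g = f false ∷ f true ∷ g false ∷ g true ∷ []

  ∈-pairs₁ : ∀ f g b → f b ∈ pairs f g
  ∈-pairs₁ f g false = here refl
  ∈-pairs₁ f g true  = there (here refl)

  ∈-pairs₂ : ∀ f g b → g b ∈ pairs f g
  ∈-pairs₂ f g false = there (there (here refl))
  ∈-pairs₂ f g true  = there (there (there (here refl)))

  portV : Node → Fin 3 → Bool → Vtx
  portV u i c = pt (edgeAt u i) (end (proj₁ u)) c

  st-neighbours : ∀ {u a b y} → Adj tw (st u a b) y → ∃ λ i → y ≡ portV u i (val tw u i a b)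
  st-neighbours {u} {a} {b} {pt e p c} (inc@(_ , pos) , v) = proj₁ e ,
    trans (cong₂ (λ e′ p′ → pt e′ p′ c) (≡-sym (Inc⇒edgeAt u e p inc)) (FinP.toℕ-injective (trans pos (≡-sym (toℕ-end (proj₁ u))))))
      (cong (λ c → portV u (proj₁ e) c) (≡-sym v))

  last : ℕ
  last = 2 + P₃

  AtEnd : Edge → Bool → Bool → Vtx → Set
  AtEnd e s c y = ∃ λ a → ∃ λ b → y ≡ st (endnode e s) a b × val tw (endnode e s) (proj₁ e) a b ≡ c

  data Beside (e : Edge) (p : Fin P) (c : Bool) (y : Vtx) : Set where
    first-end : toℕ p ≡ 0 → AtEnd e false c y → Beside e p c y
    before    : toℕ p ≢ 0 → suc (toℕ (Fin.pred p)) ≡ toℕ p → y ≡ pt e (Fin.pred p) c → Beside e p c y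
    last-end  : toℕ p ≡ last → AtEnd e true c y → Beside e p c y
    after     : toℕ p ≢ last → suc (toℕ p) ≡ toℕ (successor p) → y ≡ pt e (successor p) c → Beside e p c y

  pt-neighbours : ∀ {e p c y} → Adj tw (pt e p c) y → Beside e p c y
  pt-neighbours {e} {p} {c} {st (false , x) a b} ((refl , pos) , v) = first-end pos (a , b , refl , v)
  pt-neighbours {e} {p} {c} {st (true  , x) a b} ((refl , pos) , v) = last-end pos (a , b , refl , v)
  pt-neighbours {e} {p} {c} {pt e′ p′ c′} (refl , refl , inj₁ q) with successor-unique p p′ q
  ... | refl = after (λ eq → <⇒≢ (FinP.toℕ<n p′) (trans (≡-sym q) (cong suc eq))) q refl
  pt-neighbours {e} {p} {c} {pt e′ p′ c′} (refl , refl , inj₂ q) with pred-unique p p′ q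
  ... | refl = before (λ eq → contradiction (trans q eq) λ ()) q refl

  StUniform : Colouring → Set
  StUniform κ = ∀ u a b → κ (st u a b) ≡ κ (st u a false)

  -- On either side there are at most two labels: the two copies of the next path vertex, or the two
  -- halves of a gadget, to which `StUniform` reduces its four states.
  path-class : ∀ {κ U} e p → StUniform κ → (∀ x → κ x ≡ U → ∃ λ c → x ≡ pt e p c) → NarrowAt κ U
  path-class {κ} {U} e p uniform class = pairs left right , ≤-refl , covers
    where
    left right : Bool → K
    left  b = if does (toℕ p ≟ 0) then κ (st (endnode e false) b false) else κ (pt e (Fin.pred p) b)
    right b = if does (toℕ p ≟ last) then κ (st (endnode e true) b false) else κ (pt e (successor p) b)
    beside : ∀ {c y} → Beside e p c y → (∃ λ b → left b ≡ κ y) ⊎ (∃ λ b → right b ≡ κ y)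
    beside (first-end p≡ (a , b , refl , _)) = inj₁ (a , trans (if-yes (toℕ p ≟ 0) p≡) (≡-sym (uniform _ a b)))
    beside {c} (before p≢ _ refl)            = inj₁ (c , if-no (toℕ p ≟ 0) p≢)
    beside (last-end p≡ (a , b , refl , _))  = inj₂ (a , trans (if-yes (toℕ p ≟ last) p≡) (≡-sym (uniform _ a b)))
    beside {c} (after p≢ _ refl)             = inj₂ (c , if-no (toℕ p ≟ last) p≢)
    covers : ∀ y x → κ x ≡ U → U ≢ κ y → Adj tw x y → _ → κ y ∈ pairs left right
    covers y x κx _ adj _ with class x κx
    ... | c , refl with beside (pt-neighbours adj)
    ...   | inj₁ (b , eq) = subst (_∈ pairs left right) eq (∈-pairs₁ left right b)
    ...   | inj₂ (b , eq) = subst (_∈ pairs left right) eq (∈-pairs₂ left right b)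

  -- The two states reading `c` at port `i`, told apart by `x`; at port 2 the second bit is solved
  -- from the parity equation.
  stateWith : Node → Fin 3 → Bool → Bool → Vtx
  stateWith u zero             c x = st u c x
  stateWith u (suc zero)       c x = st u x c
  stateWith u (suc (suc zero)) c x = st u x (x xor (c xor tw u))

  stateWith-complete : ∀ u i a b → ∃ λ x → stateWith u i (val tw u i a b) x ≡ st u a b
  stateWith-complete u zero             a b = b , refl
  stateWith-complete u (suc zero)       a b = a , refl
  stateWith-complete u (suc (suc zero)) a b = a , cong (st u a)
    (trans (cong (a xor_) (xor-cancelʳ (a xor b) (tw u))) (trans (≡-sym (BoolP.xor-assoc a a b)) (cong (_xor b) (BoolP.xor-same a))))

  -- One copy meets only two of the four states at a gadget, so two labels per side suffice even
  -- while the gadgets are still unmerged.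
  single-path-class : ∀ {κ U} e p c → (∀ x → κ x ≡ U → x ≡ pt e p c) → NarrowAt κ U
  single-path-class {κ} {U} e p c class = pairs left right , ≤-refl , covers
    where
    left right : Bool → K
    left  b = if does (toℕ p ≟ 0) then κ (stateWith (endnode e false) (proj₁ e) c b) else κ (pt e (Fin.pred p) c)
    right b = if does (toℕ p ≟ last) then κ (stateWith (endnode e true) (proj₁ e) c b) else κ (pt e (successor p) c)
    beside : ∀ {y} → Beside e p c y → (∃ λ b → left b ≡ κ y) ⊎ (∃ λ b → right b ≡ κ y)
    beside (first-end p≡ (a , b , refl , refl)) = let x , eq = stateWith-complete (endnode e false) (proj₁ e) a b in
      inj₁ (x , trans (if-yes (toℕ p ≟ 0) p≡) (cong κ eq))
    beside (before p≢ _ refl)                   = inj₁ (false , if-no (toℕ p ≟ 0) p≢)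
    beside (last-end p≡ (a , b , refl , refl))  = let x , eq = stateWith-complete (endnode e true) (proj₁ e) a b in
      inj₂ (x , trans (if-yes (toℕ p ≟ last) p≡) (cong κ eq))
    beside (after p≢ _ refl)                    = inj₂ (false , if-no (toℕ p ≟ last) p≢)
    covers : ∀ y x → κ x ≡ U → U ≢ κ y → Adj tw x y → _ → κ y ∈ pairs left right
    covers y x κx _ adj _ with class x κx
    ... | refl with beside (pt-neighbours adj)
    ...   | inj₁ (b , eq) = subst (_∈ pairs left right) eq (∈-pairs₁ left right b)
    ...   | inj₂ (b , eq) = subst (_∈ pairs left right) eq (∈-pairs₂ left right b)

  single-state-class : ∀ {κ U} u a b → (∀ x → κ x ≡ U → x ≡ st u a b) → NarrowAt κ U
  single-state-class {κ} {U} u a b class = at zero ∷ at (suc zero) ∷ at (suc (suc zero)) ∷ [] , n≤1+n 3 , covers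
    where
    at : Fin 3 → K
    at i = κ (portV u i (val tw u i a b))
    covers : ∀ y x → κ x ≡ U → U ≢ κ y → Adj tw x y → _ → κ y ∈ _
    covers y x κx _ adj _ with class x κx
    ... | refl with st-neighbours {y = y} adj
    ...   | zero           , refl = here refl
    ...   | suc zero       , refl = there (here refl)
    ...   | suc (suc zero) , refl = there (there (here refl))

  -- Both states of a half gadget agree at port 0, so the edges to that port are black.
  half-class : ∀ {κ U} u c → (∀ x → κ x ≡ U → ∃ λ b → x ≡ st u c b) →
    (∀ x → κ x ≡ κ (portV u zero c) → x ≡ portV u zero c) → NarrowAt κ U
  half-class {κ} {U} u c class single = pairs (at (suc zero)) (at (suc (suc zero))) , ≤-refl , covers
    where
    at : Fin 3 → Bool → K
    at i d = κ (portV u i d)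
    covers : ∀ y x → κ x ≡ U → U ≢ κ y → Adj tw x y →
      (∃ λ x′ → ∃ λ y′ → κ x′ ≡ U × κ y′ ≡ κ y × ¬ Adj tw x′ y′) → κ y ∈ pairs (at (suc zero)) (at (suc (suc zero)))
    covers y x κx _ adj (x′ , y′ , κx′ , κy′ , ¬adj) with class x κx | class x′ κx′
    ... | b , refl | b′ , refl with st-neighbours {y = y} adj
    ...   | suc zero       , refl = ∈-pairs₁ (at (suc zero)) (at (suc (suc zero))) b
    ...   | suc (suc zero) , refl = ∈-pairs₂ (at (suc zero)) (at (suc (suc zero))) _
    ...   | zero           , refl = contradiction
              (subst (Adj tw (st u c b′)) (≡-sym (single y′ κy′)) (attach tw u zero c b′)) ¬adj

  -- Two copies at port 0 and one pair at each other port make four. This is why ports 1 and 2 are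
  -- collapsed before the halves of a gadget are merged.
  gadget-class : ∀ {κ U} u → (∀ x → κ x ≡ U → ∃ λ a → ∃ λ b → x ≡ st u a b) →
    (∀ i c → κ (portV u (suc i) c) ≡ κ (portV u (suc i) false)) → NarrowAt κ U
  gadget-class {κ} {U} u class collapsed =
    at zero false ∷ at zero true ∷ at (suc zero) false ∷ at (suc (suc zero)) false ∷ [] , ≤-refl , covers
    where
    at : Fin 3 → Bool → K
    at i d = κ (portV u i d)
    covers : ∀ y x → κ x ≡ U → U ≢ κ y → Adj tw x y → _ → κ y ∈ _
    covers y x κx _ adj _ with class x κx
    ... | a , b , refl with st-neighbours {y = y} adj
    ...   | suc zero       , refl = there (there (here (collapsed zero b)))
    ...   | suc (suc zero) , refl = there (there (there (here (collapsed (suc zero) _))))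
    covers y x κx _ adj _ | false , b , refl | zero , refl = here refl
    covers y x κx _ adj _ | true  , b , refl | zero , refl = there (here refl)

  num : Node → ℕ
  num (false , x) = toℕ x
  num (true  , x) = N + toℕ x

  num-injective : ∀ u v → num u ≡ num v → u ≡ v
  num-injective (false , x) (false , y) eq = cong (false ,_) (FinP.toℕ-injective eq)
  num-injective (true  , x) (true  , y) eq = cong (true ,_) (FinP.toℕ-injective (+-cancelˡ-≡ N _ _ eq))
  num-injective (false , x) (true  , y) eq = contradiction (≤-trans (FinP.toℕ<n x) (m≤m+n N _)) (<-irrefl eq)
  num-injective (true  , x) (false , y) eq = contradiction (≤-trans (FinP.toℕ<n y) (m≤m+n N _)) (<-irrefl (≡-sym eq))

  num-< : ∀ u → num u < 2 ^ L
  num-< (false , x) = ≤-trans (≤-trans (FinP.toℕ<n x) (m≤m+n N _)) N-small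
  num-< (true  , x) = ≤-trans (≤-trans (+-monoʳ-< N (FinP.toℕ<n x)) (≤-reflexive (cong (N +_) (≡-sym (+-identityʳ N))))) N-small

  node? : ∀ x → Dec (∃ λ u → num u ≡ x)
  node? x with FinP.any? (λ y → toℕ {N} y ≟ x) | FinP.any? (λ y → N + toℕ {N} y ≟ x)
  ... | yes (y , eq) | _            = yes ((false , y) , eq)
  ... | no  _        | yes (y , eq) = yes ((true , y) , eq)
  ... | no  ¬l       | no ¬r        = no λ { ((false , y) , eq) → ¬l (y , eq) ; ((true , y) , eq) → ¬r (y , eq) }

  shift-case : ∀ φ Q k → shift φ Q k ≡ φ k ⊎ shift φ Q k ≡ k
  shift-case φ Q k with Q k
  ... | true  = inj₁ refl
  ... | false = inj₂ refl

  Within : (K → Bool) → (K → Bool) → Set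
  Within Q m = ∀ k → Q k ≡ true → m k ≡ true

  shift-out : ∀ φ {Q m} k → Within Q m → m k ≡ false → shift φ Q k ≡ k
  shift-out φ {Q} k Q⊆m mk with Q k in eq
  ... | true  = contradiction (trans (≡-sym (Q⊆m k eq)) mk) λ ()
  ... | false = refl

  -- The contraction to the base graph: first merge the two states of each gadget that
  -- agree at port 0, then the two copies of every path off port 0, then the two halves of
  -- each gadget, and last the two copies of the paths at port 0.
  κ₀ κA κB κC κD : Colouring
  κ₀ (st u a b) = sv u a b
  κ₀ (pt e p c) = pv e p c
  κA (st u a b) = half u a
  κA (pt e p c) = pv e p c
  κB (st u a b) = half u a
  κB (pt (zero  , x) p c) = pv (zero , x) p c
  κB (pt (suc i , x) p c) = pp (suc i , x) p
  κC (st u a b) = tr 0 (num u)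
  κC (pt e p c) = κB (pt e p c)
  κD (st u a b) = tr 0 (num u)
  κD (pt e p c) = pp e p

  φA φP φC : K → K
  φA (sv u a b) = half u a
  φA k          = k
  φP (pv e p c) = pp e p
  φP k          = k
  φC (half u a) = tr 0 (num u)
  φC k          = k

  mA mB mC mD : K → Bool
  mA (sv u a b) = true
  mA _          = false
  mB (pv (suc i , x) p c) = true
  mB _          = false
  mC (half u a) = true
  mC _          = false
  mD (pv e p c) = true
  mD _          = false

  run : ∀ κ κ′ φ m → (∀ k → m k ≡ true → m (φ k) ≡ false) →
    (∀ Q → Within Q m → ∀ U → NarrowAt (shift φ Q ∘ κ) U) →
    (∀ x → shift φ m (κ x) ≡ κ′ x) → Chain 4 (κ ∘ dec) (κ′ ∘ dec)
  run κ κ′ φ m leaves nar agree =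
    pass (κ ∘ dec) φ m leaves (λ Q Q⊆m → NarrowAt⇒Narrow (shift φ Q ∘ κ) (nar Q Q⊆m))
      ++ᶜ stop λ v → agree (dec v)

  narrow₀ : ∀ U → NarrowAt κ₀ U
  narrow₀ (sv u a b) = single-state-class u a b λ { (st _ _ _) refl → refl }
  narrow₀ (half u a) = empty-class λ { (st _ _ _) () ; (pt _ _ _) () }
  narrow₀ (pv e p c) = single-path-class e p c λ { (pt _ _ _) refl → refl }
  narrow₀ (pp e p)   = empty-class λ { (st _ _ _) () ; (pt _ _ _) () }
  narrow₀ (tr k x)   = empty-class λ { (st _ _ _) () ; (pt _ _ _) () }

  chainA : Chain 4 (κ₀ ∘ dec) (κA ∘ dec)
  chainA = run κ₀ κA φA mA (λ { (sv u a b) _ → refl }) nar λ { (st u a b) → refl ; (pt e p c) → refl }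
    where
    module _ (Q : K → Bool) (Q⊆m : Within Q mA) where
      κ = shift φA Q ∘ κ₀
      at-pt : ∀ e p c → κ (pt e p c) ≡ pv e p c
      at-pt e p c = shift-out φA (pv e p c) Q⊆m refl
      at-st : ∀ u a b → κ (st u a b) ≡ half u a ⊎ κ (st u a b) ≡ sv u a b
      at-st u a b = shift-case φA Q (sv u a b)
      pt≡ : ∀ {e p c k} → κ (pt e p c) ≡ k → pv e p c ≡ k
      pt≡ = trans (≡-sym (at-pt _ _ _))
      st≡ : ∀ {u a b k} → κ (st u a b) ≡ k → half u a ≡ k ⊎ sv u a b ≡ k
      st≡ {u} {a} {b} eq with at-st u a b
      ... | inj₁ e = inj₁ (trans (≡-sym e) eq)
      ... | inj₂ e = inj₂ (trans (≡-sym e) eq)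
      single : ∀ {e p c} x → κ x ≡ pv e p c → x ≡ pt e p c
      single (st u a b) eq with st≡ {u} {a} {b} eq
      ... | inj₁ ()
      ... | inj₂ ()
      single (pt e p c) eq with pt≡ {e} {p} {c} eq
      ... | refl = refl
      nar : ∀ U → NarrowAt κ U
      nar (sv u a b) = single-state-class u a b λ
        { (st u′ a′ b′) eq → only (st≡ {u′} {a′} {b′} eq) ; (pt e p c) eq → contradiction (pt≡ {e} {p} {c} eq) λ () }
        where
        only : ∀ {u′ a′ b′} → half u′ a′ ≡ sv u a b ⊎ sv u′ a′ b′ ≡ sv u a b → st u′ a′ b′ ≡ st u a b
        only (inj₂ refl) = refl
      nar (half u a) = half-class u a (λ
        { (st u′ a′ b′) eq → only (st≡ {u′} {a′} {b′} eq) ; (pt e p c) eq → contradiction (pt≡ {e} {p} {c} eq) λ () })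
        λ x eq → single x (trans eq (at-pt _ _ _))
        where
        only : ∀ {u′ a′ b′} → half u′ a′ ≡ half u a ⊎ sv u′ a′ b′ ≡ half u a → ∃ λ b → st u′ a′ b′ ≡ st u a b
        only (inj₁ refl) = _ , refl
      nar (pv e p c) = single-path-class e p c single
      nar (pp e p) = empty-class λ { (st u a b) eq → no-st (st≡ {u} {a} {b} eq) ; (pt e p c) eq → contradiction (pt≡ {e} {p} {c} eq) λ () }
        where
        no-st : ∀ {u a b e p} → half u a ≡ pp e p ⊎ sv u a b ≡ pp e p → ⊥
        no-st (inj₁ ())
        no-st (inj₂ ())
      nar (tr k x) = empty-class λ { (st u a b) eq → no-st (st≡ {u} {a} {b} eq) ; (pt e p c) eq → contradiction (pt≡ {e} {p} {c} eq) λ () }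
        where
        no-st : ∀ {u a b k x} → half u a ≡ tr k x ⊎ sv u a b ≡ tr k x → ⊥
        no-st (inj₁ ())
        no-st (inj₂ ())

  -- Common to the passes from `κA` to `κD`. The two alternatives encode their order: while a half
  -- exists, port 0 is uncollapsed, and once a merged gadget exists, the other ports are collapsed.
  record Shaped (κ : Colouring) : Set where
    field
      at-st   : ∀ u a b → κ (st u a b) ≡ half u a ⊎ κ (st u a b) ≡ tr 0 (num u)
      at-pt   : ∀ e p c → κ (pt e p c) ≡ pv e p c ⊎ κ (pt e p c) ≡ pp e p
      uniform : StUniform κ
      port₀   : (∀ u a b → κ (st u a b) ≡ tr 0 (num u)) ⊎ (∀ u c → κ (portV u zero c) ≡ pv (edgeAt u zero) (end (proj₁ u)) c)
      ports   : (∀ u a b → κ (st u a b) ≡ half u a) ⊎ (∀ u i c → κ (portV u (suc i) c) ≡ pp (edgeAt u (suc i)) (end (proj₁ u)))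

  shaped-narrow : ∀ {κ} → Shaped κ → ∀ U → NarrowAt κ U
  shaped-narrow {κ} shaped = nar
    where
    open Shaped shaped
    st≡ : ∀ {u a b k} → κ (st u a b) ≡ k → half u a ≡ k ⊎ tr 0 (num u) ≡ k
    st≡ {u} {a} {b} eq with at-st u a b
    ... | inj₁ e = inj₁ (trans (≡-sym e) eq)
    ... | inj₂ e = inj₂ (trans (≡-sym e) eq)
    pt≡ : ∀ {e p c k} → κ (pt e p c) ≡ k → pv e p c ≡ k ⊎ pp e p ≡ k
    pt≡ {e} {p} {c} eq with at-pt e p c
    ... | inj₁ q = inj₁ (trans (≡-sym q) eq)
    ... | inj₂ q = inj₂ (trans (≡-sym q) eq)
    single : ∀ {e p c} x → κ x ≡ pv e p c → x ≡ pt e p c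
    single (st u a b) eq with st≡ {u} {a} {b} eq
    ... | inj₁ ()
    ... | inj₂ ()
    single (pt e p c) eq with pt≡ {e} {p} {c} eq
    ... | inj₁ refl = refl
    half-states : ∀ {u c} x → κ x ≡ half u c → ∃ λ b → x ≡ st u c b
    half-states (st u a b) eq with st≡ {u} {a} {b} eq
    ... | inj₁ refl = b , refl
    half-states (pt e p c) eq with pt≡ {e} {p} {c} eq
    ... | inj₁ ()
    ... | inj₂ ()
    tree-states : ∀ {k y} x → κ x ≡ tr k y → ∃ λ u → ∃ λ a → ∃ λ b → x ≡ st u a b × tr 0 (num u) ≡ tr k y
    tree-states (st u a b) eq with st≡ {u} {a} {b} eq
    ... | inj₂ e = u , a , b , refl , e
    tree-states (pt e p c) eq with pt≡ {e} {p} {c} eq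
    ... | inj₁ ()
    ... | inj₂ ()
    pairs-only : ∀ {e p} x → κ x ≡ pp e p → ∃ λ c → x ≡ pt e p c
    pairs-only (st u a b) eq with st≡ {u} {a} {b} eq
    ... | inj₁ ()
    ... | inj₂ ()
    pairs-only (pt e p c) eq with pt≡ {e} {p} {c} eq
    ... | inj₂ refl = c , refl
    nar : ∀ U → NarrowAt κ U
    nar (sv u a b) = empty-class λ
      { (st u a b) eq → no-st (st≡ {u} {a} {b} eq) ; (pt e p c) eq → no-pt (pt≡ {e} {p} {c} eq) }
      where
      no-st : ∀ {u a u′ a′ b′} → half u a ≡ sv u′ a′ b′ ⊎ tr 0 (num u) ≡ sv u′ a′ b′ → ⊥
      no-st (inj₁ ())
      no-st (inj₂ ())
      no-pt : ∀ {e p c u′ a′ b′} → pv e p c ≡ sv u′ a′ b′ ⊎ pp e p ≡ sv u′ a′ b′ → ⊥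
      no-pt (inj₁ ())
      no-pt (inj₂ ())
    nar (half u a) with port₀
    ... | inj₁ all-tree = empty-class λ x eq → let b , x≡ = half-states x eq in
            contradiction (trans (≡-sym (all-tree u a b)) (trans (cong κ (≡-sym x≡)) eq)) λ ()
    ... | inj₂ port₀′ = half-class u a half-states λ x eq → single x (trans eq (port₀′ u a))
    nar (pv e p c) = path-class e p uniform λ x eq → c , single x eq
    nar (pp e p)   = path-class e p uniform pairs-only
    nar (tr zero x) with ports | node? x
    ... | inj₁ all-half | _ = empty-class λ y eq → let u , a , b , y≡ , _ = tree-states y eq in
            contradiction (trans (≡-sym (all-half u a b)) (trans (cong κ (≡-sym y≡)) eq)) λ ()
    ... | inj₂ ports′ | no ¬node = empty-class λ y eq → let u , _ , _ , _ , e = tree-states y eq in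
            ¬node (u , index-injective e)
      where
      index-injective : ∀ {x y} → tr 0 x ≡ tr 0 y → x ≡ y
      index-injective refl = refl
    ... | inj₂ ports′ | yes (u , refl) = gadget-class u
            (λ y eq → let u′ , a , b , y≡ , e = tree-states y eq in
              a , b , trans y≡ (cong (λ u → st u a b) (num-injective u′ u (index-injective e))))
            (λ i c → trans (ports′ u i c) (≡-sym (ports′ u i false)))
      where
      index-injective : ∀ {x y} → tr 0 x ≡ tr 0 y → x ≡ y
      index-injective refl = refl
    nar (tr (suc k) x) = empty-class λ y eq → let u , _ , _ , _ , e = tree-states y eq in contradiction e λ ()

  κB-port₀ : ∀ u c → κB (portV u zero c) ≡ pv (edgeAt u zero) (end (proj₁ u)) c
  κB-port₀ (false , _) c = refl
  κB-port₀ (true  , _) c = refl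

  κB-ports : ∀ u i c → κB (portV u (suc i) c) ≡ pp (edgeAt u (suc i)) (end (proj₁ u))
  κB-ports (false , _) i c = refl
  κB-ports (true  , _) i c = refl

  κB-shape : ∀ e p c → κB (pt e p c) ≡ pv e p c ⊎ κB (pt e p c) ≡ pp e p
  κB-shape (zero  , _) p c = inj₁ refl
  κB-shape (suc _ , _) p c = inj₂ refl

  chainB : Chain 4 (κA ∘ dec) (κB ∘ dec)
  chainB = run κA κB φP mB (λ { (pv (suc i , x) p c) _ → refl }) (λ Q Q⊆m → shaped-narrow (shaped Q Q⊆m))
    λ { (st u a b) → refl ; (pt (zero , x) p c) → refl ; (pt (suc i , x) p c) → refl }
    where
    mB-port₀ : ∀ u c → mB (κA (portV u zero c)) ≡ false
    mB-port₀ (false , _) c = refl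
    mB-port₀ (true  , _) c = refl
    shaped : ∀ Q → Within Q mB → Shaped (shift φP Q ∘ κA)
    shaped Q Q⊆m = record
      { at-st   = λ u a b → inj₁ (shift-out φP (half u a) Q⊆m refl)
      ; at-pt   = λ e p c → Sum.swap (shift-case φP Q (pv e p c))
      ; uniform = λ u a b → refl
      ; port₀   = inj₂ λ u c → shift-out φP _ Q⊆m (mB-port₀ u c)
      ; ports   = inj₁ λ u a b → shift-out φP (half u a) Q⊆m refl
      }

  chainC : Chain 4 (κB ∘ dec) (κC ∘ dec)
  chainC = run κB κC φC mC (λ { (half u a) _ → refl }) (λ Q Q⊆m → shaped-narrow (shaped Q Q⊆m))
    λ { (st u a b) → refl ; (pt (zero , x) p c) → refl ; (pt (suc i , x) p c) → refl }
    where
    mC-pt : ∀ e p c → mC (κB (pt e p c)) ≡ false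
    mC-pt (zero  , _) p c = refl
    mC-pt (suc _ , _) p c = refl
    shaped : ∀ Q → Within Q mC → Shaped (shift φC Q ∘ κB)
    shaped Q Q⊆m = record
      { at-st   = λ u a b → Sum.swap (shift-case φC Q (half u a))
      ; at-pt   = λ e p c → subst (λ k → k ≡ pv e p c ⊎ k ≡ pp e p) (≡-sym (fixed e p c)) (κB-shape e p c)
      ; uniform = λ u a b → refl
      ; port₀   = inj₂ λ u c → trans (fixed (edgeAt u zero) _ c) (κB-port₀ u c)
      ; ports   = inj₂ λ u i c → trans (fixed (edgeAt u (suc i)) _ c) (κB-ports u i c)
      }
      where
      fixed : ∀ e p c → shift φC Q (κB (pt e p c)) ≡ κB (pt e p c)
      fixed e p c = shift-out φC _ Q⊆m (mC-pt e p c)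

  chainD : Chain 4 (κC ∘ dec) (κD ∘ dec)
  chainD = run κC κD φP mD (λ { (pv e p c) _ → refl }) (λ Q Q⊆m → shaped-narrow (shaped Q Q⊆m))
    λ { (st u a b) → refl ; (pt (zero , x) p c) → refl ; (pt (suc i , x) p c) → refl }
    where
    shaped : ∀ Q → Within Q mD → Shaped (shift φP Q ∘ κC)
    shaped Q Q⊆m = record
      { at-st   = λ u a b → inj₂ (shift-out φP (tr 0 (num u)) Q⊆m refl)
      ; at-pt   = at-pt
      ; uniform = λ u a b → refl
      ; port₀   = inj₁ λ u a b → shift-out φP (tr 0 (num u)) Q⊆m refl
      ; ports   = inj₂ λ u i c → trans (cong (shift φP Q) (κB-ports u i c)) (shift-out φP _ Q⊆m refl)
      }
      where
      at-pt : ∀ e p c → shift φP Q (κC (pt e p c)) ≡ pv e p c ⊎ shift φP Q (κC (pt e p c)) ≡ pp e p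
      at-pt (zero  , x) p c = Sum.swap (shift-case φP Q (pv (zero , x) p c))
      at-pt (suc i , x) p c = inj₂ (shift-out φP (pp (suc i , x) p) Q⊆m refl)

  -- Folding the paths onto the tree

  anc : ℕ → ℕ → K
  anc k x = tr k (halves k x)

  -- A path of length 2L climbs from its first end to the root and descends to its second.
  up : Edge → Fin P → K
  up e p = if does (toℕ p <? L) then anc (suc (toℕ p)) (num (endnode e false)) else anc (P ∸ toℕ p) (num (endnode e true))

  parent : K → K
  parent (tr k x) = tr (suc k) ⌊ x /2⌋
  parent k        = k

  Close : K → K → Set
  Close U W = U ≡ W ⊎ parent U ≡ W ⊎ parent W ≡ U

  Close-sym : ∀ {U W} → Close U W → Close W U
  Close-sym (inj₁ e)        = inj₁ (≡-sym e)
  Close-sym (inj₂ (inj₁ e)) = inj₂ (inj₂ e)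
  Close-sym (inj₂ (inj₂ e)) = inj₂ (inj₁ e)

  nearby : ℕ → ℕ → List K
  nearby zero    x = tr 1 ⌊ x /2⌋ ∷ []
  nearby (suc k) x = tr (suc (suc k)) ⌊ x /2⌋ ∷ tr k (2 * x) ∷ tr k (suc (2 * x)) ∷ []

  length-nearby : ∀ k x → length (nearby k x) ≤ 3
  length-nearby zero    x = s≤s z≤n
  length-nearby (suc k) x = ≤-refl

  close⇒nearby : ∀ {k x W} → Close (tr k x) W → tr k x ≢ W → W ∈ nearby k x
  close⇒nearby (inj₁ e) ne = contradiction e ne
  close⇒nearby {zero}  (inj₂ (inj₁ refl)) ne = here refl
  close⇒nearby {suc k} (inj₂ (inj₁ refl)) ne = here refl
  close⇒nearby {W = tr k y} (inj₂ (inj₂ refl)) ne with ⌊/2⌋-cases y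
  ... | inj₁ e = there (here (cong (tr k) e))
  ... | inj₂ e = there (there (here (cong (tr k) e)))

  L≤last : L ≤ last
  L≤last = +-cancelˡ-≤ 1 _ _ (≤-trans (+-monoˡ-≤ L L≥1) (≤-reflexive (≡-sym P≡)))
    where
    positive : ∀ l → 3 + P₃ ≡ l + l → 1 ≤ l
    positive (suc l) _ = s≤s z≤n
    L≥1 : 1 ≤ L
    L≥1 = positive L P≡

  0<L : 0 < L
  0<L = n≢0⇒n>0 λ { refl → contradiction P≡ λ () }

  anc-top : ∀ u → anc L (num u) ≡ tr L 0
  anc-top u = cong (tr L) (halves-top L (num u) (num-< u))

  up-low : ∀ e p → toℕ p < L → up e p ≡ anc (suc (toℕ p)) (num (endnode e false))
  up-low e p = if-yes (toℕ p <? L)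

  up-high : ∀ e p → ¬ toℕ p < L → up e p ≡ anc (P ∸ toℕ p) (num (endnode e true))
  up-high e p = if-no (toℕ p <? L)

  up-first : ∀ e p → toℕ p ≡ 0 → Close (up e p) (tr 0 (num (endnode e false)))
  up-first e p p≡0 = inj₂ (inj₂ (≡-sym (trans (up-low e p (subst (_< L) (≡-sym p≡0) 0<L))
    (cong (λ k → anc (suc k) (num (endnode e false))) p≡0))))

  up-last : ∀ e p → toℕ p ≡ last → Close (up e p) (tr 0 (num (endnode e true)))
  up-last e p p≡ = inj₂ (inj₂ (≡-sym (trans (up-high e p (≤⇒≯ (subst (L ≤_) (≡-sym p≡) L≤last)))
    (cong (λ k → anc k (num (endnode e true))) (trans (cong (P ∸_) p≡) (m+n∸n≡m 1 last))))))

  -- Within either half, consecutive vertices fold to a child and its parent. The two middle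
  -- vertices both fold to the root, because the path has exactly 2L vertices.
  up-step : ∀ e p p′ → suc (toℕ p) ≡ toℕ p′ → Close (up e p) (up e p′)
  up-step e p p′ q = cases (toℕ p <? L) (toℕ p′ <? L)
    where
    open ≡-Reasoning
    cases : Dec (toℕ p < L) → Dec (toℕ p′ < L) → Close (up e p) (up e p′)
    cases (yes p<L) (yes p′<L) = subst₂ Close (≡-sym (up-low e p p<L)) (≡-sym (up-low e p′ p′<L))
      (inj₂ (inj₁ (cong (λ k → anc (suc k) (num (endnode e false))) q)))
    cases (no p≮L) (yes p′<L) = contradiction (≤-trans (n≤1+n _) (subst (_< L) (≡-sym q) p′<L)) p≮L
    cases (no p≮L) (no p′≮L) = subst₂ Close (≡-sym (up-high e p p≮L)) (≡-sym (up-high e p′ p′≮L))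
      (inj₂ (inj₂ (cong (λ k → anc k (num (endnode e true))) (begin
        suc (P ∸ toℕ p′)      ≡⟨ cong (λ z → suc (P ∸ z)) q ⟨
        suc (P ∸ suc (toℕ p)) ≡⟨ +-∸-assoc 1 (FinP.toℕ<n p) ⟨
        P ∸ toℕ p             ∎))))
    cases (yes p<L) (no p′≮L) = inj₁ (begin
      up e p                                        ≡⟨ up-low e p p<L ⟩
      anc (suc (toℕ p)) (num (endnode e false))     ≡⟨ cong (λ k → anc k (num (endnode e false))) p≡ ⟩
      anc L (num (endnode e false))                 ≡⟨ anc-top (endnode e false) ⟩
      tr L 0                                        ≡⟨ anc-top (endnode e true) ⟨
      anc L (num (endnode e true))                  ≡⟨ cong (λ k → anc k (num (endnode e true))) p′≡ ⟨
      anc (P ∸ toℕ p′) (num (endnode e true))       ≡⟨ up-high e p′ p′≮L ⟨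
      up e p′                                       ∎)
      where
      p≡ : suc (toℕ p) ≡ L
      p≡ = ≤-antisym p<L (≤-trans (≮⇒≥ p′≮L) (≤-reflexive (≡-sym q)))
      p′≡ : P ∸ toℕ p′ ≡ L
      p′≡ = trans (cong₂ _∸_ P≡ (trans (≡-sym q) p≡)) (m+n∸n≡m L L)

  -- Path vertices fold to levels 1 up to L, which leaves level 0 to the gadgets.
  up-form : ∀ e p → ∃ λ k → ∃ λ u → suc k ≤ L × up e p ≡ anc (suc k) (num u)
  up-form e p = cases (toℕ p <? L)
    where
    cases : Dec (toℕ p < L) → ∃ λ k → ∃ λ u → suc k ≤ L × up e p ≡ anc (suc k) (num u)
    cases (yes p<L) = toℕ p , endnode e false , p<L , up-low e p p<L
    cases (no p≮L)  = P ∸ suc (toℕ p) , endnode e true , subst (_≤ L) flip≡ low ,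
      trans (up-high e p p≮L) (cong (λ k → anc k (num (endnode e true))) flip≡)
      where
      flip≡ : P ∸ toℕ p ≡ suc (P ∸ suc (toℕ p))
      flip≡ = +-∸-assoc 1 (FinP.toℕ<n p)
      low : P ∸ toℕ p ≤ L
      low = ≤-trans (∸-monoʳ-≤ P (≮⇒≥ p≮L)) (≤-reflexive (trans (cong (_∸ L) P≡) (m+n∸n≡m L L)))

  total : ℕ
  total = 3 * N * P

  slot : Edge → Fin P → Fin total
  slot (i , x) p = combine (combine i x) p

  index : Edge → Fin P → ℕ
  index e p = toℕ (slot e p)

  pairAt : Fin total → Edge × Fin P
  pairAt f = let ix , p = remQuot P f in remQuot N ix , p

  pairAt-slot : ∀ e p → pairAt (slot e p) ≡ (e , p)
  pairAt-slot (i , x) p = trans (cong (λ (ix , p) → remQuot N ix , p) (FinP.remQuot-combine (combine i x) p))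
    (cong (_, p) (FinP.remQuot-combine i x))

  index-suc : ∀ e p p′ → suc (toℕ p) ≡ toℕ p′ → index e p′ ≡ suc (index e p)
  index-suc (i , x) p p′ q = begin
    toℕ (combine (combine i x) p′)        ≡⟨ FinP.toℕ-combine (combine i x) p′ ⟩
    P * toℕ (combine i x) + toℕ p′        ≡⟨ cong (P * toℕ (combine i x) +_) q ⟨
    P * toℕ (combine i x) + suc (toℕ p)   ≡⟨ +-suc (P * toℕ (combine i x)) (toℕ p) ⟩
    suc (P * toℕ (combine i x) + toℕ p)   ≡⟨ cong suc (FinP.toℕ-combine (combine i x) p) ⟨
    suc (toℕ (combine (combine i x) p))   ∎
    where open ≡-Reasoning

  -- Path vertices are folded in the order of their index, one path after the other, so that
  -- the folded part has a single neighbour outside the tree.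
  folded : ℕ → Edge → Fin P → K
  folded j e p = if does (index e p <? j) then up e p else pp e p

  κF : ℕ → Colouring
  κF j (st u a b) = tr 0 (num u)
  κF j (pt e p c) = folded j e p

  folded-yes : ∀ j e p → index e p < j → folded j e p ≡ up e p
  folded-yes j e p = if-yes (index e p <? j)

  folded-no : ∀ j e p → ¬ index e p < j → folded j e p ≡ pp e p
  folded-no j e p = if-no (index e p <? j)

  folded-case : ∀ j e p → (index e p < j × folded j e p ≡ up e p) ⊎ (¬ index e p < j × folded j e p ≡ pp e p)
  folded-case j e p = cases (index e p <? j)
    where
    cases : Dec (index e p < j) → (index e p < j × folded j e p ≡ up e p) ⊎ (¬ index e p < j × folded j e p ≡ pp e p)
    cases (yes i<j) = inj₁ (i<j , folded-yes j e p i<j)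
    cases (no i≮j)  = inj₂ (i≮j , folded-no j e p i≮j)

  -- The next pair to be folded, the only unfolded one that can follow a folded vertex on its path.
  -- When all pairs are folded, `tr 0 0` just fills the list.
  frontier : ℕ → K
  frontier j with j <? total
  ... | yes j<t = let e , p = pairAt (fromℕ< j<t) in pp e p
  ... | no  _   = tr 0 0

  frontier-index : ∀ e p j → index e p ≡ j → frontier j ≡ pp e p
  frontier-index e p j refl with index e p <? total
  ... | yes j<t = cong (λ (e , p) → pp e p) (trans (cong pairAt (FinP.fromℕ<-toℕ (slot e p) j<t)) (pairAt-slot e p))
  ... | no j≮t  = contradiction (FinP.toℕ<n (slot e p)) j≮t

  up-tree : ∀ e p {k} → up e p ≡ k → ∃ λ l → ∃ λ x → tr (suc l) x ≡ k
  up-tree e p eq = let l , u , _ , eq′ = up-form e p in l , halves (suc l) (num u) , trans (≡-sym eq′) eq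

  -- A leaf holds only a gadget and sees its three ports. A higher tree node sees at most three tree
  -- neighbours and the frontier.
  narrowF : ∀ j U → NarrowAt (κF j) U
  narrowF j = nar
    where
    pt≡ : ∀ {e p k} → folded j e p ≡ k → (∃ λ l → ∃ λ x → tr (suc l) x ≡ k) ⊎ pp e p ≡ k
    pt≡ {e} {p} eq with folded-case j e p
    ... | inj₁ (_ , eq′) = inj₁ (up-tree e p (trans (≡-sym eq′) eq))
    ... | inj₂ (_ , eq′) = inj₂ (trans (≡-sym eq′) eq)
    nar : ∀ U → NarrowAt (κF j) U
    nar (sv u a b) = empty-class λ { (st _ _ _) () ; (pt e p c) eq → no-pt (pt≡ {e} {p} eq) }
      where
      no-pt : ∀ {e p u a b} → (∃ λ l → ∃ λ x → tr (suc l) x ≡ sv u a b) ⊎ pp e p ≡ sv u a b → ⊥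
      no-pt (inj₁ ())
      no-pt (inj₂ ())
    nar (half u a) = empty-class λ { (st _ _ _) () ; (pt e p c) eq → no-pt (pt≡ {e} {p} eq) }
      where
      no-pt : ∀ {e p u a} → (∃ λ l → ∃ λ x → tr (suc l) x ≡ half u a) ⊎ pp e p ≡ half u a → ⊥
      no-pt (inj₁ ())
      no-pt (inj₂ ())
    nar (pv e p c) = empty-class λ { (st _ _ _) () ; (pt e p c) eq → no-pt (pt≡ {e} {p} eq) }
      where
      no-pt : ∀ {e p e′ p′ c} → (∃ λ l → ∃ λ x → tr (suc l) x ≡ pv e′ p′ c) ⊎ pp e p ≡ pv e′ p′ c → ⊥
      no-pt (inj₁ ())
      no-pt (inj₂ ())
    nar (pp e p) = path-class e p (λ _ _ _ → refl) λ { (st _ _ _) () ; (pt e′ p′ c) eq → c , only (pt≡ {e′} {p′} eq) }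
      where
      only : ∀ {e′ p′ c} → (∃ λ l → ∃ λ x → tr (suc l) x ≡ pp e p) ⊎ pp e′ p′ ≡ pp e p → pt e′ p′ c ≡ pt e p c
      only (inj₂ refl) = refl
    nar (tr zero x) with node? x
    ... | no ¬node = empty-class λ { (st u a b) refl → ¬node (u , refl) ; (pt e p c) eq → no-pt (pt≡ {e} {p} eq) }
      where
      no-pt : ∀ {e p x} → (∃ λ l → ∃ λ y → tr (suc l) y ≡ tr 0 x) ⊎ pp e p ≡ tr 0 x → ⊥
      no-pt (inj₁ ())
      no-pt (inj₂ ())
    ... | yes (u , refl) = gadget-class u (λ
            { (st u′ a b) eq → a , b , cong (λ u → st u a b) (num-injective u′ u (index-injective eq))
            ; (pt e p c) eq → contradiction (pt≡ {e} {p} eq) no-pt }) λ _ _ → refl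
      where
      index-injective : ∀ {x y} → tr 0 x ≡ tr 0 y → x ≡ y
      index-injective refl = refl
      no-pt : ∀ {e p x} → ¬ ((∃ λ l → ∃ λ y → tr (suc l) y ≡ tr 0 x) ⊎ pp e p ≡ tr 0 x)
      no-pt (inj₁ ())
      no-pt (inj₂ ())
    nar (tr (suc k) x) = frontier j ∷ nearby (suc k) x , ≤-refl , covers
      where
      covers : ∀ y z → κF j z ≡ tr (suc k) x → tr (suc k) x ≢ κF j y → Adj tw z y → _ → κF j y ∈ frontier j ∷ nearby (suc k) x
      covers y (pt e p c) κz ne adj _ with folded-case j e p
      ... | inj₂ (_ , eq) = contradiction (trans (≡-sym eq) κz) λ ()
      ... | inj₁ (i<j , eq) with pt-neighbours {e} {p} {c} {y} adj
      ...   | first-end p≡ (a , b , refl , _) = there (close⇒nearby (subst (λ U → Close U _) up≡ (up-first e p p≡)) ne)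
        where up≡ = trans (≡-sym eq) κz
      ...   | last-end p≡ (a , b , refl , _) = there (close⇒nearby (subst (λ U → Close U _) up≡ (up-last e p p≡)) ne)
        where up≡ = trans (≡-sym eq) κz
      ...   | before _ q refl = there (close⇒nearby
                (subst₂ Close (trans (≡-sym eq) κz) (≡-sym (folded-yes j e (Fin.pred p) lower)) (Close-sym (up-step e (Fin.pred p) p q))) ne)
        where
        lower : index e (Fin.pred p) < j
        lower = ≤-trans (≤-trans (≤-reflexive (≡-sym (index-suc e (Fin.pred p) p q))) (n≤1+n _)) i<j
      ...   | after _ q refl with folded-case j e (successor p)
      ...     | inj₁ (_ , eq′) = there (close⇒nearby
                  (subst₂ Close (trans (≡-sym eq) κz) (≡-sym eq′) (up-step e p (successor p) q)) ne)
      -- Here `p` is folded and its successor is not, so the index of the successor is exactly `j`.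
      ...     | inj₂ (i′≮j , eq′) = here (trans eq′ (≡-sym (frontier-index e (successor p) j
                  (≤-antisym (≤-trans (≤-reflexive (index-suc e p (successor p) q)) i<j) (≮⇒≥ i′≮j)))))

  fold-step : ∀ j → j < total → ∃ λ e → ∃ λ p → ∀ x → κF (suc j) x ≡ relabel (pp e p) (up e p) (κF j x)
  fold-step j j<t = e , p , agree
    where
    f = fromℕ< j<t
    e = proj₁ (pairAt f)
    p = proj₂ (pairAt f)
    slot≡ : slot e p ≡ f
    slot≡ = trans (cong (λ ix → combine ix p) (FinP.combine-remQuot {3} N (proj₁ (remQuot {3 * N} P f)))) (FinP.combine-remQuot {3 * N} P f)
    index≡ : index e p ≡ j
    index≡ = trans (cong toℕ slot≡) (FinP.toℕ-fromℕ< j<t)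
    agree : ∀ x → κF (suc j) x ≡ relabel (pp e p) (up e p) (κF j x)
    agree (st u a b) = ≡-sym (relabel-other {pp e p} {tr 0 (num u)} (up e p) λ ())
    agree (pt e′ p′ c) with <-cmp (index e′ p′) j
    ... | tri< i<j _ _ = trans (folded-yes (suc j) e′ p′ (m≤n⇒m≤1+n i<j)) (≡-sym (trans (cong (relabel (pp e p) (up e p)) (folded-yes j e′ p′ i<j))
            (relabel-other {pp e p} {up e′ p′} (up e p) λ eq → let _ , _ , t = up-tree e′ p′ (≡-sym eq) in contradiction t λ ())))
    ... | tri≈ i≮j i≡j _ = trans (folded-yes (suc j) e′ p′ (≤-reflexive (cong suc i≡j))) (≡-sym (trans (cong (relabel (pp e p) (up e p)) (folded-no j e′ p′ i≮j))
            (same (e′ , p′) (trans (≡-sym (pairAt-slot e′ p′)) (trans (cong pairAt (FinP.toℕ-injective (trans i≡j (≡-sym index≡)))) (pairAt-slot e p))))))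
      where
      same : ∀ ep → ep ≡ (e , p) → relabel (pp e p) (up e p) (pp (proj₁ ep) (proj₂ ep)) ≡ up (proj₁ ep) (proj₂ ep)
      same _ refl = relabel-same (pp e p) (up e p)
    ... | tri> i≮j i≢j j<i = trans (folded-no (suc j) e′ p′ (λ i<1+j → <⇒≱ j<i (s≤s⁻¹ i<1+j))) (≡-sym (trans (cong (relabel (pp e p) (up e p)) (folded-no j e′ p′ i≮j))
            (relabel-other {pp e p} {pp e′ p′} (up e p) λ eq → i≢j (trans (same eq) index≡))))
      where
      same : pp e p ≡ pp e′ p′ → index e′ p′ ≡ index e p
      same refl = refl

  chainF-from : ∀ r j → r + j ≡ total → Chain 4 (κF j ∘ dec) (κF total ∘ dec)
  chainF-from zero    j eq = stop λ v → cong (λ j → κF j (dec v)) eq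
  chainF-from (suc r) j eq =
    let e , p , agree = fold-step j (≤-trans (s≤s (m≤n+m j r)) (≤-reflexive eq)) in
    next (pp e p) (up e p) (κF (suc j) ∘ dec) (agree ∘ dec) (NarrowAt⇒Narrow (κF (suc j)) (narrowF (suc j)))
      (chainF-from r (suc j) (trans (+-suc r j) eq))

  chainF : Chain 4 (κD ∘ dec) (κF total ∘ dec)
  chainF = stop (λ v → unfolded (dec v)) ++ᶜ chainF-from total 0 (+-identityʳ total)
    where
    unfolded : ∀ x → κD x ≡ κF 0 x
    unfolded (st u a b) = refl
    unfolded (pt e p c) = ≡-sym (folded-no 0 e p λ ())

  -- Contracting the tree

  TreeLike : Colouring → Set
  TreeLike κ = ∀ x y → Adj tw x y → Close (κ x) (κ y)

  FromLevel : ℕ → Colouring → Set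
  FromLevel q κ = ∀ x → ∃ λ k → ∃ λ u → q ≤ k × k ≤ L × κ x ≡ anc k (num u)

  tree-narrow : ∀ κ → (∀ x → ∃ λ k → ∃ λ i → κ x ≡ tr k i) → TreeLike κ → ∀ U → NarrowAt κ U
  tree-narrow κ tree treeLike = nar
    where
    not-tree : ∀ {U} → (∀ k i → tr k i ≢ U) → NarrowAt κ U
    not-tree ne = empty-class λ x eq → let k , i , eq′ = tree x in ne k i (trans (≡-sym eq′) eq)
    nar : ∀ U → NarrowAt κ U
    nar (sv u a b) = not-tree λ _ _ ()
    nar (half u a) = not-tree λ _ _ ()
    nar (pv e p c) = not-tree λ _ _ ()
    nar (pp e p)   = not-tree λ _ _ ()
    nar (tr k i)   = nearby k i , ≤-trans (length-nearby k i) (n≤1+n 3) , λ y x κx ne adj _ →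
      close⇒nearby (subst (λ U → Close U (κ y)) κx (treeLike x y adj)) ne

  onLevel : ℕ → K → Bool
  onLevel q (tr k i) = does (k ≟ q)
  onLevel q _        = false

  level-leaves : ∀ q k → onLevel q k ≡ true → onLevel q (parent k) ≡ false
  level-leaves q (tr k i) eq = dec-false (suc k ≟ q) λ e →
    contradiction (trans (≡-sym eq) (dec-false (k ≟ q) λ e′ → 1+n≢n (trans e (≡-sym e′)))) λ ()

  -- All labels lie on level `q` or above. Moving any subset of level `q` to the parents keeps
  -- adjacent labels equal or parent and child, so three neighbours remain the maximum; after L
  -- levels only the root is left.
  chainT : ∀ r q κ → r + q ≡ L → FromLevel q κ → TreeLike κ →
    ∃ λ κ′ → Chain 4 (κ ∘ dec) (κ′ ∘ dec) × (∀ x → κ′ x ≡ tr L 0)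
  chainT zero q κ refl form treeLike = κ , stop (λ _ → refl) , top
    where
    top : ∀ x → κ x ≡ tr L 0
    top x with form x
    ... | k , u , q≤k , k≤L , eq = trans eq (trans (cong (λ k → anc k (num u)) (≤-antisym k≤L q≤k)) (anc-top u))
  chainT (suc r) q κ eq form treeLike =
    let κ″ , chain , top = chainT r (suc q) κ′ (trans (+-suc r q) eq) form′ (shifted-treeLike (onLevel q) λ _ e → e) in
    κ″ , run κ κ′ parent (onLevel q) (level-leaves q) narrow′ (λ _ → refl) ++ᶜ chain , top
    where
    κ′ = shift parent (onLevel q) ∘ κ
    form′ : FromLevel (suc q) κ′
    form′ x with form x
    ... | k , u , q≤k , k≤L , e with k ≟ q
    ...   | yes refl = suc k , u , ≤-refl , ≤-trans (s≤s (m≤n+m k r)) (≤-reflexive eq) ,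
              trans (cong (shift parent (onLevel q)) e) (if-yes (k ≟ k) refl)
    ...   | no k≢q   = k , u , ≤∧≢⇒< q≤k (k≢q ∘ ≡-sym) , k≤L ,
              trans (cong (shift parent (onLevel q)) e) (if-no (k ≟ q) k≢q)
    parent-stays : ∀ Q → Within Q (onLevel q) → ∀ x → shift parent Q (parent (κ x)) ≡ parent (κ x)
    parent-stays Q Q⊆ x with form x
    ... | k , u , q≤k , _ , e = shift-out parent _ Q⊆ (trans (cong (onLevel q ∘ parent) e)
            (dec-false (suc k ≟ q) λ { refl → contradiction q≤k 1+n≰n }))
    -- The parent lies above level `q` and does not move, so the label of `x` either joins it or
    -- stays its child.
    shift-up : ∀ Q → Within Q (onLevel q) → ∀ x y → parent (κ x) ≡ κ y →
      Close (shift parent Q (κ x)) (shift parent Q (κ y))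
    shift-up Q Q⊆ x y e with shift-case parent Q (κ x)
    ... | inj₁ up≡ = inj₁ (trans up≡ (trans (≡-sym (parent-stays Q Q⊆ x)) (cong (shift parent Q) e)))
    ... | inj₂ st≡ = inj₂ (inj₁ (trans (cong parent st≡) (trans (≡-sym (parent-stays Q Q⊆ x)) (cong (shift parent Q) e))))
    shifted-treeLike : ∀ Q → Within Q (onLevel q) → TreeLike (shift parent Q ∘ κ)
    shifted-treeLike Q Q⊆ x y adj with treeLike x y adj
    ... | inj₁ e        = inj₁ (cong (shift parent Q) e)
    ... | inj₂ (inj₁ e) = shift-up Q Q⊆ x y e
    ... | inj₂ (inj₂ e) = Close-sym (shift-up Q Q⊆ y x e)
    narrow′ : ∀ Q → Within Q (onLevel q) → ∀ U → NarrowAt (shift parent Q ∘ κ) U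
    narrow′ Q Q⊆ = tree-narrow (shift parent Q ∘ κ) tree (shifted-treeLike Q Q⊆)
      where
      tree : ∀ x → ∃ λ k → ∃ λ i → shift parent Q (κ x) ≡ tr k i
      tree x with form x | shift-case parent Q (κ x)
      ... | k , u , _ , _ , e | inj₁ up≡ = _ , _ , trans up≡ (cong parent e)
      ... | k , u , _ , _ , e | inj₂ st≡ = _ , _ , trans st≡ e

  κF-total : ∀ e p c → κF total (pt e p c) ≡ up e p
  κF-total e p c = folded-yes total e p (FinP.toℕ<n (slot e p))

  κF-fromLevel : FromLevel 0 (κF total)
  κF-fromLevel (st u a b) = 0 , u , z≤n , z≤n , refl
  κF-fromLevel (pt e p c) = let k , u , k≤ , eq = up-form e p in suc k , u , z≤n , k≤ , trans (κF-total e p c) eq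

  κF-treeLike : TreeLike (κF total)
  κF-treeLike (pt e p c) y adj = subst (λ U → Close U (κF total y)) (≡-sym (κF-total e p c)) (beside (pt-neighbours {e} {p} {c} {y} adj))
    where
    beside : Beside e p c y → Close (up e p) (κF total y)
    beside (first-end p≡ (a , b , refl , _)) = up-first e p p≡
    beside (last-end p≡ (a , b , refl , _))  = up-last e p p≡
    beside (before _ q refl) = subst (Close (up e p)) (≡-sym (κF-total e (Fin.pred p) c)) (Close-sym (up-step e (Fin.pred p) p q))
    beside (after _ q refl)  = subst (Close (up e p)) (≡-sym (κF-total e (successor p) c)) (up-step e p (successor p) q)
  κF-treeLike (st u a b) (pt e p c) adj = Close-sym (κF-treeLike (pt e p c) (st u a b) adj)

  κ₀-injective : ∀ {x y} → κ₀ x ≡ κ₀ y → x ≡ y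
  κ₀-injective {st _ _ _} {st _ _ _} refl = refl
  κ₀-injective {pt _ _ _} {pt _ _ _} refl = refl

  twinWidth≤4 : 0 < N → TwinWidthAtMost (cfi tw) 4
  twinWidth≤4 0<N =
    let κ′ , chain , top = chainT L 0 (κF total) (+-identityʳ L) κF-fromLevel κF-treeLike in
    contract {κ = κ₀ ∘ dec} {κ′ = κ′ ∘ dec} (≡-sym (suc-pred size {{>-nonZero size>0}})) (λ eq → dec-injective (κ₀-injective eq))
      (NarrowAt⇒Narrow κ₀ narrow₀) (λ x y → trans (top (dec x)) (≡-sym (top (dec y))))
      (chainA ++ᶜ (chainB ++ᶜ (chainC ++ᶜ (chainD ++ᶜ (chainF ++ᶜ chain)))))
    where
    dec-injective : ∀ {x y} → dec x ≡ dec y → x ≡ y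
    dec-injective {x} {y} eq = trans (≡-sym (enc-dec x)) (trans (cong enc eq) (enc-dec y))
    size>0 : 0 < size
    size>0 = ≤-trans (≤-trans (≤-trans 0<N (m≤m+n N _)) (m≤m*n (2 * N) 4)) (m≤m+n _ _)

-- Parameters

-- Induction along halving. The bound 2(k - 1), unlike 2k, survives rounding up, since ⌈k/2⌉ - 1 is
-- ⌊(k - 1)/2⌋.
⌈log₂⌉-bounds : ∀ k → 2 ≤ k → k ≤ 2 ^ ⌈log₂ k ⌉ × 2 ^ ⌈log₂ k ⌉ ≤ 2 * (k ∸ 1)
⌈log₂⌉-bounds = <-rec (λ k → 2 ≤ k → Bounds k) go
  where
  Bounds : ℕ → Set
  Bounds k = k ≤ 2 ^ ⌈log₂ k ⌉ × 2 ^ ⌈log₂ k ⌉ ≤ 2 * (k ∸ 1)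
  halve : ∀ k → 2 ≤ k → 2 ^ ⌈log₂ k ⌉ ≡ 2 * 2 ^ ⌈log₂ ⌈ k /2⌉ ⌉
  halve k 2≤k = cong (2 ^_) (begin
    ⌈log₂ k ⌉                    ≡⟨ m+[n∸m]≡n {1} (≤-trans (≤-reflexive (≡-sym (⌈log₂2^n⌉≡n 1))) (⌈log₂⌉-mono-≤ 2≤k)) ⟨
    suc (⌈log₂ k ⌉ ∸ 1)          ≡⟨ cong suc (⌈log₂⌈n/2⌉⌉≡⌈log₂n⌉∸1 k) ⟨
    suc ⌈log₂ ⌈ k /2⌉ ⌉          ∎)
    where open ≡-Reasoning
  double : ∀ m → m + m ≡ 2 * m
  double = solve-∀
  quadruple : ∀ m → 2 * (2 * m) ≡ 2 * (m + m)
  quadruple = solve-∀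
  k≤ : ∀ k → k ≤ 2 * ⌈ k /2⌉
  k≤ k = begin
    k                     ≡⟨ ⌊n/2⌋+⌈n/2⌉≡n k ⟨
    ⌊ k /2⌋ + ⌈ k /2⌉     ≤⟨ +-monoˡ-≤ ⌈ k /2⌉ (⌊n/2⌋≤⌈n/2⌉ k) ⟩
    ⌈ k /2⌉ + ⌈ k /2⌉     ≡⟨ double ⌈ k /2⌉ ⟩
    2 * ⌈ k /2⌉           ∎
    where open ≤-Reasoning
  go : ∀ k → (∀ {j} → j < k → 2 ≤ j → Bounds j) → 2 ≤ k → Bounds k
  go 1 rec (s≤s ())
  go 2 rec _ = ≤-reflexive eq , ≤-reflexive (≡-sym eq)
    where
    eq : 2 ≡ 2 ^ ⌈log₂ 2 ⌉
    eq = cong (2 ^_) (≡-sym (⌈log₂2^n⌉≡n 1))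
  go k@(suc (suc (suc k′))) rec 2≤k =
    ≤-trans (≤-trans (k≤ k) (*-monoʳ-≤ 2 lower)) (≤-reflexive (≡-sym (halve k 2≤k))) ,
    (begin
      2 ^ ⌈log₂ k ⌉               ≡⟨ halve k 2≤k ⟩
      2 * 2 ^ ⌈log₂ m ⌉           ≤⟨ *-monoʳ-≤ 2 upper ⟩
      2 * (2 * (m ∸ 1))           ≡⟨ quadruple (m ∸ 1) ⟩
      2 * (⌊ 2 + k′ /2⌋ + ⌊ 2 + k′ /2⌋) ≤⟨ *-monoʳ-≤ 2 (+-monoʳ-≤ ⌊ 2 + k′ /2⌋ (⌊n/2⌋≤⌈n/2⌉ (2 + k′))) ⟩
      2 * (⌊ 2 + k′ /2⌋ + ⌈ 2 + k′ /2⌉) ≡⟨ cong (2 *_) (⌊n/2⌋+⌈n/2⌉≡n (2 + k′)) ⟩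
      2 * (k ∸ 1)                 ∎)
    where
    open ≤-Reasoning
    m = ⌈ k /2⌉
    lower = proj₁ (rec (⌈n/2⌉<n (suc k′)) (s≤s (s≤s z≤n)))
    upper = proj₂ (rec (⌈n/2⌉<n (suc k′)) (s≤s (s≤s z≤n)))

HardPair : ℕ → ℕ → Set
HardPair k size = Σ Graph λ G → Σ Graph λ H →
  ¬ Isomorphic G H
  × TwinWidthAtMost G 4 × TwinWidthAtMost H 4
  × n G ≡ size × n H ≡ size
  × NotDistinguishedByWL k G H

-- There are 8Dq nodes with four states each, which must fit on the leaves of the tree, and 12Dq
-- edges with two copies of 2L path vertices.
pair-from-expander : ∀ k q D₁ P₃ L → suc k ≤ q → 3 + P₃ ≡ L + L → 8 * suc D₁ * q ≤ 2 ^ L →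
  (Σ (Fin (suc D₁) → Permutation′ (q + 3 * q)) λ π → ∀ A B → q ≤ card A → q ≤ card B → ∃ λ d → Hit A B (π d)) →
  HardPair k (q * (4 * suc D₁ * (8 + 12 * L)))
pair-from-expander k q D₁ P₃ L k<q P≡ small (π , linked) =
  cfi untwisted , cfi (twist h) , Rigidity.not-isomorphic M P₃ ρ (t₀ h) ,
  twinWidth untwisted , twinWidth (twist h) , size≡ , size≡ , not-distinguished h
  where
  M : ℕ
  M = (q + 3 * q) * suc D₁
  open BlockGraph (q + 3 * q) D₁ π (3 + P₃) using (ρ)
  open CFI M (3 + P₃) ρ using (cfi; untwisted)
  open Walks M (3 + P₃) ρ using (Haven; twist; t₀; not-distinguished)
  h : Haven k
  h = Expansion.haven q D₁ π linked (3 + P₃) k<q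
  q≤M : q ≤ M
  q≤M = ≤-trans (m≤m+n q _) (m≤m*n (q + 3 * q) (suc D₁))
  2M≡ : ∀ q d → 2 * ((q + 3 * q) * d) ≡ 8 * d * q
  2M≡ = solve-∀
  twinWidth : ∀ tw → TwinWidthAtMost (cfi tw) 4
  twinWidth tw = TwinWidth.twinWidth≤4 M P₃ L P≡ ρ (≤-trans (≤-reflexive (2M≡ q (suc D₁))) small) tw
    (≤-trans (≤-trans (s≤s z≤n) k<q) q≤M)
  count : ∀ q d x → 2 * ((q + 3 * q) * d) * (2 * 2) + 3 * ((q + 3 * q) * d) * ((x + x) * 2)
    ≡ q * (4 * d * (8 + 12 * x))
  count = solve-∀
  size≡ : CFI.size M (3 + P₃) ρ ≡ q * (4 * suc D₁ * (8 + 12 * L))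
  size≡ = trans (cong (λ P → 2 * M * (2 * 2) + 3 * M * (P * 2)) P≡) (count q (suc D₁) L)

abstract
  -- (4/3)^32 exceeds 256. Being a power of two, 32 also makes the number 8 · 32 · q of nodes a
  -- power of two for the `q` chosen below.
  expander₃₂ : ∀ q → 1 ≤ q → Σ (Fin 32 → Permutation′ (q + 3 * q)) λ π →
    ∀ A B → q ≤ card A → q ≤ card B → ∃ λ d → Hit A B (π d)
  expander₃₂ = expander 32 (toWitness {a? = 3 ^ 32 * 256 <? 4 ^ 32} _)

theorem3p6 : ∃[ C ] (∀ (k : ℕ) → 2 ≤ k →
    Σ Graph λ G → Σ Graph λ H →
    ¬ Isomorphic G H
    × TwinWidthAtMost G 4 × TwinWidthAtMost H 4
    × n G ≤ C * (k * ⌈log₂ k ⌉) × n H ≤ C * (k * ⌈log₂ k ⌉)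
    × NotDistinguishedByWL k G H)
-- 65536 is 4 · 128 · 128: `q` is at most 4k, four blocks per unit of `q` have 32 slots each, and 8
-- + 12 · (9 + ℓ) is at most 128ℓ because ℓ is positive.
theorem3p6 = 65536 , λ k 2≤k → finish k (⌈log₂ k ⌉) (⌈log₂⌉-bounds k 2≤k) 2≤k
  (≤-trans (≤-reflexive (≡-sym (⌈log₂2^n⌉≡n 1))) (⌈log₂⌉-mono-≤ 2≤k))
  where
  finish : ∀ k ℓ → k ≤ 2 ^ ℓ × 2 ^ ℓ ≤ 2 * (k ∸ 1) → 2 ≤ k → 1 ≤ ℓ → Σ Graph λ G → Σ Graph λ H →
    ¬ Isomorphic G H
    × TwinWidthAtMost G 4 × TwinWidthAtMost H 4
    × n G ≤ 65536 * (k * ℓ) × n H ≤ 65536 * (k * ℓ)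
    × NotDistinguishedByWL k G H
  finish k ℓ (k≤ , ≤2k) 2≤k 1≤ℓ =
    -- With `L` equal to 9 + ℓ, this `P₃` makes `3 + P₃` compute to `L + L`.
    let G , H , ≇ , tG , tH , nG , nH , wl = pair-from-expander k q 31 (6 + ℓ + (9 + ℓ)) (9 + ℓ) k<q refl (≤-reflexive 256q)
                                             (expander₃₂ q (≤-trans (s≤s z≤n) k<q))
    in G , H , ≇ , tG , tH , ≤-trans (≤-reflexive nG) bound , ≤-trans (≤-reflexive nH) bound , wl
    where
    -- A power of two above `k`, so that the 256q nodes fill all leaves of a tree of depth 9 + ℓ.
    q = 2 * 2 ^ ℓ
    k<q : suc k ≤ q
    k<q = ≤-trans (+-mono-≤ (≤-trans (≤-trans (s≤s z≤n) 2≤k) k≤) k≤) (≤-reflexive (cong (2 ^ ℓ +_) (≡-sym (+-identityʳ _))))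
    256q : 256 * (2 * 2 ^ ℓ) ≡ 2 ^ (9 + ℓ)
    256q = trans (≡-sym (*-assoc 256 2 (2 ^ ℓ))) (≡-sym (^-distribˡ-+-* 2 9 ℓ))
    bound : q * (128 * (8 + 12 * (9 + ℓ))) ≤ 65536 * (k * ℓ)
    bound = begin
      2 * 2 ^ ℓ * (128 * (8 + 12 * (9 + ℓ)))      ≤⟨ *-mono-≤ (*-monoʳ-≤ 2 (≤-trans ≤2k (*-monoʳ-≤ 2 (m∸n≤m k 1)))) (*-monoʳ-≤ 128 linear) ⟩
      2 * (2 * k) * (128 * (128 * ℓ))             ≡⟨ collect 128 k ℓ ⟩
      65536 * (k * ℓ)                             ∎
      where
      open ≤-Reasoning
      expand : ∀ a b c ℓ → a + b * (c + ℓ) ≡ (a + b * c) * 1 + b * ℓ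
      expand = solve-∀
      linear : 8 + 12 * (9 + ℓ) ≤ 128 * ℓ
      linear = begin
        8 + 12 * (9 + ℓ)      ≡⟨ expand 8 12 9 ℓ ⟩
        116 * 1 + 12 * ℓ      ≤⟨ +-monoˡ-≤ (12 * ℓ) (*-monoʳ-≤ 116 1≤ℓ) ⟩
        116 * ℓ + 12 * ℓ      ≡⟨ *-distribʳ-+ ℓ 116 12 ⟨
        128 * ℓ               ∎
      collect : ∀ a k ℓ → 2 * (2 * k) * (a * (a * ℓ)) ≡ 4 * a * a * (k * ℓ)
      collect = solve-∀
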